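{- The spaces $(\mathfrak{C}, \diamond)$ and $(\mathfrak{C}, \sqcup\!\sqcup)$ are commutative $\mathbb F_q$-algebras (with unit the empty word $1$). In particular, Conjecture 3.2.2 of Shi's thesis (asserting that the shuffle product $\sqcup\!\sqcup$ on $\mathfrak C$ is associative) holds.
   Context: Let $\mathbb F_q$ be the finite field with $q$ elements, of characteristic $p$. Let $\Sigma=\{x_n\}_{n\geq 1}$ be an alphabet with weight $w(x_n)=n$; let $\langle\Sigma\rangle$ be the set of words over $\Sigma$ (the empty word is denoted $1$), and let $\mathfrak C=\mathbb F_q\langle\Sigma\rangle$ be the $\mathbb F_q$-vector space with basis $\langle\Sigma\rangle$, equipped with concatenation. A nonempty word is written $\mathfrak a=x_a\mathfrak a_-$, where $x_a$ is its first letter. For $a,b,i\in\mathbb N$ put $\Delta^i_{a,b}=(-1)^{a-1}\binom{i-1}{a-1}+(-1)^{b-1}\binom{i-1}{b-1}\in\mathbb F_p$ if $(q-1)\mid i$ and $0<i<a+b$, and $\Delta^i_{a,b}=0$ otherwise. Define $\mathbb F_q$-bilinear products $\diamond$ (diamond product) and $\sqcup\!\sqcup$ (shuffle product) on $\mathfrak C$ recursively by $1\diamond\mathfrak a=\mathfrak a\diamond 1=\mathfrak a$, $1\sqcup\!\sqcup\mathfrak a=\mathfrak a\sqcup\!\sqcup 1=\mathfrak a$, and for nonempty words $\mathfrak a,\mathfrak b$: $\mathfrak a\diamond\mathfrak b=x_{a+b}(\mathfrak a_-\sqcup\!\sqcup\mathfrak b_-)+\sum_{i+j=a+b}\Delta^j_{a,b}\,x_i(x_j\sqcup\!\sqcup(\mathfrak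 a_-\sqcup\!\sqcup\mathfrak b_-))$, $\mathfrak a\sqcup\!\sqcup\mathfrak b=x_a(\mathfrak a_-\sqcup\!\sqcup\mathfrak b)+x_b(\mathfrak a\sqcup\!\sqcup\mathfrak b_-)+\mathfrak a\diamond\mathfrak b$. -}

module Defs where

open import Level using (Level; _⊔_)
open import Data.Nat using (ℕ; zero; suc; _∸_; _<?_)
open import Data.Nat.Divisibility using (_∣?_)
open import Data.Nat.Combinatorics using (_C_)
import Data.Nat as ℕ
open import Data.Integer using (ℤ; +_; -[1+_])
import Data.Integer as ℤ
open import Data.Fin using (Fin)
open import Data.List using (List; []; _∷_; _++_; map; length; concatMap; upTo)
import Data.List.Properties as LP
open import Data.Product using (_×_; _,_; ∃)
open import Relation.Nullary using (¬_; yes; no)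
open import Relation.Nullary.Decidable using (_×-dec_)
open import Relation.Binary.PropositionalEquality using (_≡_)
open import Algebra.Bundles using (CommutativeRing)
open import Algebra.Structures using (IsCommutativeRing)
open import Algebra.Module.Structures using (IsModule)

record IsFiniteField {c ℓ : Level} (F : CommutativeRing c ℓ) (q : ℕ) : Set (c ⊔ ℓ) where
  open CommutativeRing F
  field
    1≉0      : ¬ (1# ≈ 0#)
    inverse  : ∀ x → ¬ (x ≈ 0#) → ∃ λ y → (x * y) ≈ 1#
    toFin    : Carrier → Fin q
    fromFin  : Fin q → Carrier
    toFin-cong : ∀ {x y} → x ≈ y → toFin x ≡ toFin y
    from-to  : ∀ x → fromFin (toFin x) ≈ x
    to-from  : ∀ i → toFin (fromFin i) ≡ i

module WordAlgebra {c ℓ : Level} (F : CommutativeRing c ℓ) (q : ℕ) where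

  open CommutativeRing F renaming (Carrier to K)

  -- Letters: the natural number n stands for the letter x_(n+1),
  -- so that every letter x_m (m ≥ 1) is represented exactly once.
  Letter : Set
  Letter = ℕ

  weight : Letter → ℕ
  weight n = suc n

  -- the letter of weight m (only used with m ≥ 1)
  x : ℕ → Letter
  x m = m ∸ 1

  Word : Set
  Word = List Letter

  -- Elements of ℭ: finite formal F-linear combinations of words.
  Poly : Set c
  Poly = List (K × Word)

  coeff : Poly → Word → K
  coeff [] w = 0#
  coeff ((a , u) ∷ P) w with LP.≡-dec ℕ._≟_ u w
  ... | yes _ = a + coeff P w
  ... | no  _ = coeff P w

  infix 4 _≈ₚ_
  _≈ₚ_ : Poly → Poly → Set ℓ
  P ≈ₚ Q = ∀ w → coeff P w ≈ coeff Q w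

  infixl 6 _+ₚ_
  _+ₚ_ : Poly → Poly → Poly
  P +ₚ Q = P ++ Q

  0ₚ : Poly
  0ₚ = []

  1ₚ : Poly
  1ₚ = (1# , []) ∷ []

  -ₚ_ : Poly → Poly
  -ₚ P = map (λ { (a , u) → (- a , u) }) P

  infixr 7 _•_
  _•_ : K → Poly → Poly
  k • P = map (λ { (a , u) → (k * a , u) }) P

  _•ʳ_ : Poly → K → Poly
  P •ʳ k = k • P

  word : Word → Poly
  word u = (1# , u) ∷ []

  prefix : Letter → Poly → Poly
  prefix l P = map (λ { (a , u) → (a , l ∷ u) }) P

  bilin : (Word → Word → Poly) → Poly → Poly → Poly
  bilin f P Q = concatMap (λ { (a , u) → concatMap (λ { (b , v) → (a * b) • f u v }) Q }) P

  linʳ : (Word → Poly) → Poly → Poly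
  linʳ f Q = concatMap (λ { (b , v) → b • f v }) Q

  fromℕ : ℕ → K
  fromℕ zero = 0#
  fromℕ (suc n) = 1# + fromℕ n

  fromℤ : ℤ → K
  fromℤ (+ n) = fromℕ n
  fromℤ -[1+ n ] = - fromℕ (suc n)

  sgn : ℕ → ℤ
  sgn zero = ℤ.+ 1
  sgn (suc n) = ℤ.- sgn n

  Δℤ : ℕ → ℕ → ℕ → ℤ
  Δℤ i a b with ((q ∸ 1) ∣? i) ×-dec ((0 <? i) ×-dec (i <? a ℕ.+ b))
  ... | yes _ = (sgn (a ∸ 1) ℤ.* (+ ((i ∸ 1) C (a ∸ 1))))
                ℤ.+ (sgn (b ∸ 1) ℤ.* (+ ((i ∸ 1) C (b ∸ 1))))
  ... | no  _ = + 0

  Δ : ℕ → ℕ → ℕ → K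
  Δ i a b = fromℤ (Δℤ i a b)

  -- Fuelled mutual recursion for the shuffle (shF) and diamond (dmF)
  -- products of words; with sufficient fuel (see below) they compute
  -- exactly the recursive definitions of the paper.
  shF : ℕ → Word → Word → Poly
  dmF : ℕ → Word → Word → Poly

  shF n [] v = word v
  shF n u@(_ ∷ _) [] = word u
  shF zero (_ ∷ _) (_ ∷ _) = []
  shF (suc n) (a ∷ u) (b ∷ v) =
    prefix a (shF n u (b ∷ v)) +ₚ prefix b (shF n (a ∷ u) v) +ₚ dmF n (a ∷ u) (b ∷ v)

  dmF n [] v = word v
  dmF n u@(_ ∷ _) [] = word u
  dmF zero (_ ∷ _) (_ ∷ _) = []
  dmF (suc n) (a ∷ u) (b ∷ v) =
    prefix (x (A ℕ.+ B)) (shF n u v)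
    +ₚ concatMap
         (λ j → Δ j A B • prefix (x (A ℕ.+ B ∸ j)) (linʳ (shF n (x j ∷ [])) (shF n u v)))
         (upTo (A ℕ.+ B))
    where
      A = weight a
      B = weight b

  -- fuel 2·(|u|+|v|)+1 suffices for both products
  fuel : Word → Word → ℕ
  fuel u v = suc (2 ℕ.* (length u ℕ.+ length v))

  _◇ʷ_ : Word → Word → Poly
  u ◇ʷ v = dmF (fuel u v) u v

  _⧢ʷ_ : Word → Word → Poly
  u ⧢ʷ v = shF (fuel u v) u v

  infixl 7 _◇_ _⧢_
  _◇_ : Poly → Poly → Poly
  _◇_ = bilin _◇ʷ_

  _⧢_ : Poly → Poly → Poly
  _⧢_ = bilin _⧢ʷ_

  record IsCommutativeAlgebra (_∙_ : Poly → Poly → Poly) : Set (c ⊔ ℓ) where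
    field
      isCommutativeRing : IsCommutativeRing _≈ₚ_ _+ₚ_ _∙_ -ₚ_ 0ₚ 1ₚ
      isModule          : IsModule F _≈ₚ_ _+ₚ_ 0ₚ -ₚ_ _•_ _•ʳ_
      •-∙-assoc         : ∀ k P Q → (k • (P ∙ Q)) ≈ₚ ((k • P) ∙ Q)

{-# OPTIONS --safe #-}
module Submission where

-- Both products form a commutative tridendriform algebra: with (x_a w) ▷ v = x_a (w ⧢ v) one has
-- 𝔞 ⧢ 𝔟 = 𝔞 ▷ 𝔟 + 𝔟 ▷ 𝔞 + 𝔞 ◇ 𝔟 and 𝔞 ◇ 𝔟 = (x_a ◇ x_b) ▷ (𝔞₋ ⧢ 𝔟₋).  By induction on the total length,
-- associativity of ⧢ and ◇ follows once (x_a ◇ x_b) ◇ x_c is symmetric in a, b, c.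
--
-- For letters, use the generating series e(s) = ∑ s^(a-1) x_a.  Then
--   e(s) ◇ e(t) = (e(s) - e(t)) ▷ M(t - s),   M(r) = - ∑ r^(j-1) x_j over j ≥ 0 with (q-1) ∣ j and x_0 = 1,
-- and, M being odd, the required symmetry becomes M(α) ⧢ M(β) = M(α + β) ⧢ (M(α) + M(β)).
-- In depth one, multiplying by the Moore determinant β^q α - β α^q, which is invariant under α ↦ α + β by
-- Frobenius, makes the sums telescope.  In depth two, the coefficient of x_k x_l is α^(k-1) Q(α,β) + β^(k-1) Q(β,α)
-- with Q(α,β) = ∑ (β + ν α)^(l-1) over ν ∈ 𝔽_q (by the power sums of 𝔽_q), and Q(α,β) is invariant under β ↦ β + α
-- and odd in β.

open import Defs
open import Level using (Level; _⊔_)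
open import Data.Nat using (ℕ; zero; suc; _∸_)
import Data.Nat as ℕ
import Data.Nat.Properties as ℕ
open import Data.Nat.Divisibility using (_∣_; _∣?_; divides)
import Data.Nat.Divisibility as ℕ
open import Data.Nat.Induction using (<-rec)
open import Data.Integer using (ℤ; +_; -[1+_]; _⊖_; _◃_)
import Data.Integer as ℤ
import Data.Integer.Properties as ℤ
import Data.Sign as Sign
open import Data.Fin using (Fin; zero; suc; punchIn; inject≤)
import Data.Fin as Fin
import Data.Fin.Properties as Fin
open import Data.Fin.Permutation using (permutation)
open import Data.Vec.Functional using (Vector; replicate; removeAt)
open import Data.List using (List; []; _∷_; _++_; length; concatMap; applyUpTo; upTo)
import Data.List.Properties as List
open import Data.List.Relation.Unary.All as All using (All; []; _∷_)
import Data.List.Relation.Unary.All.Properties as All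
open import Data.Maybe using (Maybe; just; nothing)
open import Data.Product using (_×_; _,_; ∃; proj₁; proj₂)
open import Data.Sum using (inj₁; inj₂)
open import Data.Empty using (⊥-elim)
open import Function using (_∘_)
open import Relation.Nullary using (Dec; yes; no; ¬_)
open import Relation.Nullary.Decidable using (_×-dec_)
open import Relation.Binary.Definitions using (Tri; tri<; tri≈; tri>)
open import Relation.Binary.PropositionalEquality as ≡ using (_≡_)
open import Algebra.Bundles using (CommutativeMonoid; CommutativeRing)
open import Algebra.Structures using (IsMonoid)
open import Algebra.Solver.Ring.AlmostCommutativeRing using (fromCommutativeRing; _-Raw-AlmostCommutative⟶_)
import Algebra.Solver.Ring
import Algebra.Properties.Ring
import Algebra.Properties.CommutativeSemiring.Exp
import Algebra.Properties.Semiring.Mult.TCOptimised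
import Algebra.Properties.CommutativeMonoid.Sum as MonoidSum
import Algebra.Properties.Semiring.Sum as Sum
import Relation.Binary.Reasoning.Setoid

-- Put α = u - t, β = t - s, γ = u - s. By (x_a ▷ v) ◇ x_b = (x_a ◇ x_b) ▷ v, the series (e(s) ◇
-- e(t)) ◇ e(u) equals P ▷ (M(β) ⧢ M(α)) - N ▷ (M(β) ⧢ M(γ)) with P = e(u) - e(t) and N = e(u) -
-- e(s). Exchanging t and u sends α to -α, swaps β and γ, and sends P to -P and N to N - P; with M
-- odd, comparing the coefficients of P leaves exactly the quoted identity. This exchange suffices,
-- since symmetry in the first two letters is immediate. The convention x_0 = 1 brings x_(a+b) under
-- the same formula, but at the price of denominators α, β, γ, which are not units among power
-- series. They occur only in depth one, so there the Moore determinant has to clear them and has to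
-- be shown not to be a zero divisor. The series have scalar coefficients because a functional on
-- words is applied from the start. Its values on the first letter, with the other letters fixed,
-- form the sequence `G`. The depths one and two above count only those other letters, whereas
-- `depth₂` and `depth₃` also count the first one.

-- Commutative rings: integer coefficients, finite sums, signed binomials

module RingTools {c ℓ : Level} (R : CommutativeRing c ℓ) where

  open CommutativeRing R public hiding (zero)
  open Algebra.Properties.Ring ring public
    using (-0#≈0#; -‿involutive; -‿distribˡ-*; -‿distribʳ-*; -‿+-comm)
  open Algebra.Properties.CommutativeSemiring.Exp commutativeSemiring public
    using (_^_; ^-congˡ; ^-homo-*; ^-assocʳ; ^-distrib-*)
  open Algebra.Properties.Semiring.Mult.TCOptimised semiring public using (1+×; ×-homo-+; ×1-homo-*) renaming (_×_ to _⋆_)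
  open Relation.Binary.Reasoning.Setoid setoid public

  -- The canonical map from ℤ. Equality in R need not be decidable, so the ring solver takes its
  -- coefficients from ℤ.
  ⟦_⟧ℤ : ℤ → Carrier
  ⟦ + n ⟧ℤ      = n ⋆ 1#
  ⟦ -[1+ n ] ⟧ℤ = - (suc n ⋆ 1#)

  ⊖-homo : ∀ m n → ⟦ m ⊖ n ⟧ℤ ≈ m ⋆ 1# - n ⋆ 1#
  ⊖-homo m zero = sym (trans (+-congˡ -0#≈0#) (+-identityʳ _))
  ⊖-homo zero (suc n) = sym (+-identityˡ _)
  ⊖-homo (suc m) (suc n) = begin
    ⟦ suc m ⊖ suc n ⟧ℤ  ≡⟨ ≡.cong ⟦_⟧ℤ (ℤ.[1+m]⊖[1+n]≡m⊖n m n) ⟩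
    ⟦ m ⊖ n ⟧ℤ  ≈⟨ ⊖-homo m n ⟩
    m ⋆ 1# - n ⋆ 1#  ≈⟨ +-congʳ (+-identityˡ _) ⟨
    0# + m ⋆ 1# - n ⋆ 1#  ≈⟨ +-congʳ (+-congʳ (-‿inverseʳ 1#)) ⟨
    1# - 1# + m ⋆ 1# - n ⋆ 1#  ≈⟨ +-congʳ (+-assoc _ _ _) ⟩
    1# + (- 1# + m ⋆ 1#) - n ⋆ 1#  ≈⟨ +-congʳ (+-congˡ (+-comm _ _)) ⟩
    1# + (m ⋆ 1# - 1#) - n ⋆ 1#  ≈⟨ +-congʳ (+-assoc _ _ _) ⟨
    1# + m ⋆ 1# - 1# - n ⋆ 1#  ≈⟨ +-assoc _ _ _ ⟩
    1# + m ⋆ 1# + (- 1# - n ⋆ 1#)  ≈⟨ +-congˡ (-‿+-comm _ _) ⟩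
    1# + m ⋆ 1# - (1# + n ⋆ 1#)  ≈⟨ +-cong (1+× m 1#) (-‿cong (1+× n 1#)) ⟨
    suc m ⋆ 1# - suc n ⋆ 1#  ∎

  -‿homoℤ : ∀ i → ⟦ ℤ.- i ⟧ℤ ≈ - ⟦ i ⟧ℤ
  -‿homoℤ (+ zero)  = sym -0#≈0#
  -‿homoℤ (+ suc n) = refl
  -‿homoℤ -[1+ n ]  = sym (-‿involutive _)

  +-homoℤ : ∀ i j → ⟦ i ℤ.+ j ⟧ℤ ≈ ⟦ i ⟧ℤ + ⟦ j ⟧ℤ
  +-homoℤ (+ m) (+ n) = ×-homo-+ 1# m n
  +-homoℤ (+ m) -[1+ n ] = ⊖-homo m (suc n)
  +-homoℤ -[1+ m ] (+ n) = trans (⊖-homo n (suc m)) (+-comm _ _)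
  +-homoℤ -[1+ m ] -[1+ n ] = begin
    - (suc (suc (m ℕ.+ n)) ⋆ 1#)  ≡⟨ ≡.cong (λ k → - (suc k ⋆ 1#)) (ℕ.+-suc m n) ⟨
    - ((suc m ℕ.+ suc n) ⋆ 1#)  ≈⟨ -‿cong (×-homo-+ 1# (suc m) (suc n)) ⟩
    - (suc m ⋆ 1# + suc n ⋆ 1#)  ≈⟨ -‿+-comm _ _ ⟨
    - (suc m ⋆ 1#) - suc n ⋆ 1#  ∎

  *-homoℤ : ∀ i j → ⟦ i ℤ.* j ⟧ℤ ≈ ⟦ i ⟧ℤ * ⟦ j ⟧ℤ
  *-homoℤ (+ m) (+ n) = trans (reflexive (≡.cong ⟦_⟧ℤ (ℤ.+◃n≡+n (m ℕ.* n)))) (×1-homo-* m n)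
  *-homoℤ (+ m) -[1+ n ] = begin
    ⟦ Sign.- ◃ m ℕ.* suc n ⟧ℤ  ≡⟨ ≡.cong ⟦_⟧ℤ (ℤ.-◃n≡-n (m ℕ.* suc n)) ⟩
    ⟦ ℤ.- (+ (m ℕ.* suc n)) ⟧ℤ  ≈⟨ -‿homoℤ (+ (m ℕ.* suc n)) ⟩
    - ((m ℕ.* suc n) ⋆ 1#)  ≈⟨ -‿cong (×1-homo-* m (suc n)) ⟩
    - (m ⋆ 1# * (suc n ⋆ 1#))  ≈⟨ -‿distribʳ-* _ _ ⟩
    m ⋆ 1# * - (suc n ⋆ 1#)  ∎
  *-homoℤ -[1+ m ] (+ n) = begin
    ⟦ Sign.- ◃ suc m ℕ.* n ⟧ℤ  ≡⟨ ≡.cong ⟦_⟧ℤ (ℤ.-◃n≡-n (suc m ℕ.* n)) ⟩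
    ⟦ ℤ.- (+ (suc m ℕ.* n)) ⟧ℤ  ≈⟨ -‿homoℤ (+ (suc m ℕ.* n)) ⟩
    - ((suc m ℕ.* n) ⋆ 1#)  ≈⟨ -‿cong (×1-homo-* (suc m) n) ⟩
    - (suc m ⋆ 1# * (n ⋆ 1#))  ≈⟨ -‿distribˡ-* _ _ ⟩
    - (suc m ⋆ 1#) * (n ⋆ 1#)  ∎
  *-homoℤ -[1+ m ] -[1+ n ] = begin
    (suc m ℕ.* suc n) ⋆ 1#  ≈⟨ ×1-homo-* (suc m) (suc n) ⟩
    suc m ⋆ 1# * (suc n ⋆ 1#)  ≈⟨ -‿involutive _ ⟨
    - - (suc m ⋆ 1# * (suc n ⋆ 1#))  ≈⟨ -‿cong (-‿distribʳ-* _ _) ⟩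
    - (suc m ⋆ 1# * - (suc n ⋆ 1#))  ≈⟨ -‿distribˡ-* _ _ ⟩
    - (suc m ⋆ 1#) * - (suc n ⋆ 1#)  ∎

  private
    ℤ⟶R : ℤ.+-*-rawRing -Raw-AlmostCommutative⟶ fromCommutativeRing R
    ℤ⟶R = record
      { ⟦_⟧    = ⟦_⟧ℤ
      ; +-homo = +-homoℤ
      ; *-homo = *-homoℤ
      ; -‿homo = -‿homoℤ
      ; 0-homo = refl
      ; 1-homo = refl
      }

    equal? : ∀ i j → Maybe (⟦ i ⟧ℤ ≈ ⟦ j ⟧ℤ)
    equal? i j with i ℤ.≟ j
    ... | yes i≡j = just (reflexive (≡.cong ⟦_⟧ℤ i≡j))
    ... | no  _   = nothing

  open Algebra.Solver.Ring ℤ.+-*-rawRing (fromCommutativeRing R) ℤ⟶R equal? public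
    using (solve; _:=_; _:+_; _:*_; _:-_; :-_; con)

  abstract
    ∑ : ℕ → (ℕ → Carrier) → Carrier
    ∑ zero    f = 0#
    ∑ (suc n) f = f 0 + ∑ n (λ i → f (suc i))

    ∑-zero : ∀ (f : ℕ → Carrier) → ∑ 0 f ≈ 0#
    ∑-zero f = refl

    ∑-suc : ∀ n (f : ℕ → Carrier) → ∑ (suc n) f ≈ f 0 + ∑ n (λ i → f (suc i))
    ∑-suc n f = refl

    ∑-cong : ∀ n {f g : ℕ → Carrier} → (∀ i → i ℕ.< n → f i ≈ g i) → ∑ n f ≈ ∑ n g
    ∑-cong zero    f≈g = refl
    ∑-cong (suc n) f≈g = +-cong (f≈g 0 ℕ.z<s) (∑-cong n (λ i i<n → f≈g (suc i) (ℕ.s<s i<n)))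

    ∑-0 : ∀ n {f : ℕ → Carrier} → (∀ i → i ℕ.< n → f i ≈ 0#) → ∑ n f ≈ 0#
    ∑-0 zero    f≈0 = refl
    ∑-0 (suc n) f≈0 =
      trans (+-cong (f≈0 0 ℕ.z<s) (∑-0 n (λ i i<n → f≈0 (suc i) (ℕ.s<s i<n)))) (+-identityˡ 0#)

    ∑-+ : ∀ n (f g : ℕ → Carrier) → ∑ n (λ i → f i + g i) ≈ ∑ n f + ∑ n g
    ∑-+ zero    f g = sym (+-identityˡ 0#)
    ∑-+ (suc n) f g = trans (+-congˡ (∑-+ n _ _))
      (solve 4 (λ a b c d → a :+ b :+ (c :+ d) := a :+ c :+ (b :+ d)) refl _ _ _ _)

    ∑-*ˡ : ∀ n x (f : ℕ → Carrier) → x * ∑ n f ≈ ∑ n (λ i → x * f i)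
    ∑-*ˡ zero    x f = zeroʳ x
    ∑-*ˡ (suc n) x f = trans (distribˡ _ _ _) (+-congˡ (∑-*ˡ n x _))

    ∑-split : ∀ m n (f : ℕ → Carrier) → ∑ (m ℕ.+ n) f ≈ ∑ m f + ∑ n (λ i → f (m ℕ.+ i))
    ∑-split zero    n f = sym (+-identityˡ _)
    ∑-split (suc m) n f = trans (+-congˡ (∑-split m n _)) (sym (+-assoc _ _ _))

  -- ⨁ n f = ∑ f k l over k + l = n.
  ⨁ : ℕ → (ℕ → ℕ → Carrier) → Carrier
  ⨁ zero    f = f 0 0
  ⨁ (suc n) f = f 0 (suc n) + ⨁ n (λ k l → f (suc k) l)

  ⨁-cong : ∀ n {f g : ℕ → ℕ → Carrier} → (∀ k l → k ℕ.+ l ≡ n → f k l ≈ g k l) → ⨁ n f ≈ ⨁ n g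
  ⨁-cong zero    f≈g = f≈g 0 0 ≡.refl
  ⨁-cong (suc n) f≈g =
    +-cong (f≈g 0 (suc n) ≡.refl) (⨁-cong n (λ k l k+l≡n → f≈g (suc k) l (≡.cong suc k+l≡n)))

  ⨁-0 : ∀ n {f : ℕ → ℕ → Carrier} → (∀ k l → k ℕ.+ l ≡ n → f k l ≈ 0#) → ⨁ n f ≈ 0#
  ⨁-0 zero    f≈0 = f≈0 0 0 ≡.refl
  ⨁-0 (suc n) f≈0 = trans
    (+-cong (f≈0 0 (suc n) ≡.refl) (⨁-0 n (λ k l k+l≡n → f≈0 (suc k) l (≡.cong suc k+l≡n))))
    (+-identityˡ 0#)

  ⨁-+ : ∀ n (f g : ℕ → ℕ → Carrier) → ⨁ n (λ k l → f k l + g k l) ≈ ⨁ n f + ⨁ n g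
  ⨁-+ zero    f g = refl
  ⨁-+ (suc n) f g = trans (+-congˡ (⨁-+ n _ _))
    (solve 4 (λ a b c d → a :+ b :+ (c :+ d) := a :+ c :+ (b :+ d)) refl _ _ _ _)

  ⨁-*ˡ : ∀ n x (f : ℕ → ℕ → Carrier) → x * ⨁ n f ≈ ⨁ n (λ k l → x * f k l)
  ⨁-*ˡ zero    x f = refl
  ⨁-*ˡ (suc n) x f = trans (distribˡ _ _ _) (+-congˡ (⨁-*ˡ n x _))

  ⨁-last : ∀ n (f : ℕ → ℕ → Carrier) → ⨁ (suc n) f ≈ ⨁ n (λ k l → f k (suc l)) + f (suc n) 0
  ⨁-last zero    f = refl
  ⨁-last (suc n) f = trans (+-congˡ (⨁-last n (λ k l → f (suc k) l))) (sym (+-assoc _ _ _))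

  ⨁-swap : ∀ n (f : ℕ → ℕ → Carrier) → ⨁ n f ≈ ⨁ n (λ k l → f l k)
  ⨁-swap zero    f = refl
  ⨁-swap (suc n) f = begin
    f 0 (suc n) + ⨁ n (λ k l → f (suc k) l)  ≈⟨ +-comm _ _ ⟩
    ⨁ n (λ k l → f (suc k) l) + f 0 (suc n)  ≈⟨ +-congʳ (⨁-swap n _) ⟩
    ⨁ n (λ k l → f (suc l) k) + f 0 (suc n)  ≈⟨ ⨁-last n (λ k l → f l k) ⟨
    ⨁ (suc n) (λ k l → f l k)  ∎

  ⨁-comm : ∀ m n (f : ℕ → ℕ → ℕ → ℕ → Carrier) →
    ⨁ m (λ i j → ⨁ n (f i j)) ≈ ⨁ n (λ k l → ⨁ m (λ i j → f i j k l))
  ⨁-comm zero    n f = refl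
  ⨁-comm (suc m) n f = trans (+-congˡ (⨁-comm m n _)) (sym (⨁-+ n _ _))

  abstract
    ⨁-∑ : ∀ n (f : ℕ → ℕ → Carrier) → ⨁ n f ≈ ∑ (suc n) (λ k → f k (n ∸ k))
    ⨁-∑ zero    f = sym (+-identityʳ _)
    ⨁-∑ (suc n) f = +-congˡ (⨁-∑ n _)

    ⨁-∑-comm : ∀ m n (f : ℕ → ℕ → ℕ → Carrier) →
      ⨁ m (λ i j → ∑ n (f i j)) ≈ ∑ n (λ k → ⨁ m (λ i j → f i j k))
    ⨁-∑-comm m zero    f = ⨁-0 m (λ _ _ _ → refl)
    ⨁-∑-comm m (suc n) f = trans (⨁-+ m _ _) (+-congˡ (⨁-∑-comm m n _))

    -- Both sides run over the pairs with k + l < N, by rows on the left and by antidiagonals on the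
    -- right.
    ∑-triangle : ∀ N (f : ℕ → ℕ → Carrier) → ∑ N (λ k → ∑ (N ∸ k) (f k)) ≈ ∑ N (λ m → ⨁ m f)
    ∑-triangle zero    f = refl
    ∑-triangle (suc N) f = begin
      f 0 0 + ∑ N (λ l → f 0 (suc l)) + ∑ N (λ k → ∑ (N ∸ k) (f (suc k)))
        ≈⟨ +-assoc _ _ _ ⟩
      f 0 0 + (∑ N (λ l → f 0 (suc l)) + ∑ N (λ k → ∑ (N ∸ k) (f (suc k))))
        ≈⟨ +-congˡ (+-congˡ (∑-triangle N _)) ⟩
      f 0 0 + (∑ N (λ l → f 0 (suc l)) + ∑ N (λ m → ⨁ m (λ k l → f (suc k) l)))
        ≈⟨ +-congˡ (∑-+ N _ _) ⟨
      ∑ (suc N) (λ m → ⨁ m f) ∎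

  -- b n k = (-1)ᵏ (n choose k)
  b : ℕ → ℕ → Carrier
  b zero    zero    = 1#
  b zero    (suc k) = 0#
  b (suc n) zero    = b n zero
  b (suc n) (suc k) = b n (suc k) - b n k

  b-n-0 : ∀ n → b n 0 ≈ 1#
  b-n-0 zero    = refl
  b-n-0 (suc n) = b-n-0 n

  b-vanish : ∀ {n k} → n ℕ.< k → b n k ≈ 0#
  b-vanish {zero}  {suc k} _ = refl
  b-vanish {suc n} {suc k} (ℕ.s≤s n<k) =
    trans (+-cong (b-vanish (ℕ.m<n⇒m<1+n n<k)) (trans (-‿cong (b-vanish n<k)) -0#≈0#)) (+-identityˡ 0#)

  x-0≈x : ∀ x → x - 0# ≈ x
  x-0≈x = solve 1 (λ x → x :- con (+ 0) := x) refl

  0-x≈-x : ∀ x → 0# - x ≈ - x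
  0-x≈-x = solve 1 (λ x → con (+ 0) :- x := :- x) refl

  binomial : ∀ x y n → (y - x) ^ n ≈ ⨁ n (λ k l → b n k * (x ^ k * y ^ l))
  binomial x y zero = solve 0 (con (+ 1) := con (+ 1) :* (con (+ 1) :* con (+ 1))) refl
  binomial x y (suc n) = begin
    (y - x) * (y - x) ^ n
      ≈⟨ *-congˡ (binomial x y n) ⟩
    (y - x) * ⨁ n (λ k l → b n k * (x ^ k * y ^ l))
      ≈⟨ ⨁-*ˡ n _ _ ⟩
    ⨁ n (λ k l → (y - x) * (b n k * (x ^ k * y ^ l)))
      ≈⟨ ⨁-cong n (λ k l _ → solve 5 (λ x y b u v →
           (y :- x) :* (b :* (u :* v)) := b :* (u :* (y :* v)) :+ (:- b) :* ((x :* u) :* v)) refl x y _ _ _) ⟩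
    ⨁ n (λ k l → b n k * (x ^ k * y ^ suc l) + (- b n k) * (x ^ suc k * y ^ l))
      ≈⟨ ⨁-+ n _ _ ⟩
    ⨁ n (λ k l → b n k * (x ^ k * y ^ suc l)) + ⨁ n (λ k l → (- b n k) * (x ^ suc k * y ^ l))
      -- The zero is replaced by the vanishing term of index n + 1, which completes the antidiagonal
      -- for `⨁-last`.
      ≈⟨ +-congʳ (+-identityʳ _) ⟨
    ⨁ n (λ k l → b n k * (x ^ k * y ^ suc l)) + 0# + ⨁ n (λ k l → (- b n k) * (x ^ suc k * y ^ l))
      ≈⟨ +-congʳ (+-congˡ (trans (*-congʳ (b-vanish (ℕ.n<1+n n))) (zeroˡ _))) ⟨
    ⨁ n (λ k l → b n k * (x ^ k * y ^ suc l)) + b n (suc n) * (x ^ suc n * y ^ 0)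
        + ⨁ n (λ k l → (- b n k) * (x ^ suc k * y ^ l))
      ≈⟨ +-congʳ (⨁-last n (λ k l → b n k * (x ^ k * y ^ l))) ⟨
    b n 0 * (x ^ 0 * y ^ suc n) + ⨁ n (λ k l → b n (suc k) * (x ^ suc k * y ^ l))
        + ⨁ n (λ k l → (- b n k) * (x ^ suc k * y ^ l))
      ≈⟨ +-assoc _ _ _ ⟩
    b n 0 * (x ^ 0 * y ^ suc n) + (⨁ n (λ k l → b n (suc k) * (x ^ suc k * y ^ l))
        + ⨁ n (λ k l → (- b n k) * (x ^ suc k * y ^ l)))
      ≈⟨ +-congˡ (⨁-+ n _ _) ⟨
    b n 0 * (x ^ 0 * y ^ suc n) + ⨁ n (λ k l → b n (suc k) * (x ^ suc k * y ^ l)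
        + (- b n k) * (x ^ suc k * y ^ l))
      ≈⟨ +-congˡ (⨁-cong n (λ k l _ → sym (distribʳ _ _ _))) ⟩
    ⨁ (suc n) (λ k l → b (suc n) k * (x ^ k * y ^ l)) ∎

  b-n-n : ∀ n → b n n ≈ (- 1#) ^ n
  b-n-n zero    = refl
  b-n-n (suc n) = begin
    b n (suc n) - b n n  ≈⟨ +-congʳ (b-vanish (ℕ.n<1+n n)) ⟩
    0# - b n n  ≈⟨ 0-x≈-x _ ⟩
    - b n n  ≈⟨ -‿cong (b-n-n n) ⟩
    - (- 1#) ^ n  ≈⟨ solve 1 (λ x → :- x := (:- con (+ 1)) :* x) refl _ ⟩
    (- 1#) ^ suc n  ∎

  δ : ℕ → Carrier
  δ zero    = 1#
  δ (suc _) = 0#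

  ⨁-δʳ : ∀ n (f : ℕ → ℕ → Carrier) → ⨁ n (λ k l → δ l * f k l) ≈ f n 0
  ⨁-δʳ zero    f = *-identityˡ _
  ⨁-δʳ (suc n) f = begin
    ⨁ (suc n) (λ k l → δ l * f k l)  ≈⟨ ⨁-last n (λ k l → δ l * f k l) ⟩
    ⨁ n (λ k l → 0# * f k (suc l)) + 1# * f (suc n) 0  ≈⟨ +-cong (⨁-0 n (λ _ _ _ → zeroˡ _)) (*-identityˡ _) ⟩
    0# + f (suc n) 0  ≈⟨ +-identityˡ _ ⟩
    f (suc n) 0  ∎

  ⨁-δˡ : ∀ n (f : ℕ → ℕ → Carrier) → ⨁ n (λ k l → δ k * f k l) ≈ f 0 n
  ⨁-δˡ n f = trans (⨁-swap n _) (⨁-δʳ n (λ k l → f l k))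

  1^n≈1 : ∀ n → 1# ^ n ≈ 1#
  1^n≈1 zero    = refl
  1^n≈1 (suc n) = trans (*-identityˡ _) (1^n≈1 n)

  -x^n : ∀ x n → (- x) ^ n ≈ (- 1#) ^ n * x ^ n
  -x^n x n = trans (^-congˡ n (solve 1 (λ x → :- x := (:- con (+ 1)) :* x) refl x)) (^-distrib-* (- 1#) x n)

  -- The index is shifted because the letter n stands for x_(n+1).
  χ : ℕ → ℕ → Carrier
  χ p n with p ∣? suc n
  ... | yes _ = 1#
  ... | no  _ = 0#

  χ-yes : ∀ {p n} → p ∣ suc n → χ p n ≈ 1#
  χ-yes {p} {n} p∣n with p ∣? suc n
  ... | yes _   = refl
  ... | no  p∤n = ⊥-elim (p∤n p∣n)

  χ-no : ∀ {p n} → ¬ p ∣ suc n → χ p n ≈ 0#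
  χ-no {p} {n} p∤n with p ∣? suc n
  ... | yes p∣n = ⊥-elim (p∤n p∣n)
  ... | no  _   = refl

  χ-⇔ : ∀ {p m n} → (p ∣ suc m → p ∣ suc n) → (p ∣ suc n → p ∣ suc m) → χ p m ≈ χ p n
  χ-⇔ {p} {m} {n} to from with p ∣? suc m
  ... | yes p∣m = sym (χ-yes (to p∣m))
  ... | no  p∤m = sym (χ-no (λ p∣n → p∤m (from p∣n)))

  χ-+ : ∀ p n → χ p (p ℕ.+ n) ≈ χ p n
  χ-+ p n = χ-⇔ (λ p∣ → ℕ.∣m+n∣m⇒∣n (≡.subst (p ∣_) (≡.sym (ℕ.+-suc p n)) p∣) ℕ.∣-refl)
                (λ p∣ → ≡.subst (p ∣_) (ℕ.+-suc p n) (ℕ.∣m∣n⇒∣m+n ℕ.∣-refl p∣))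

  Regular : Carrier → Set (c ⊔ ℓ)
  Regular x = ∀ y → x * y ≈ 0# → y ≈ 0#

  cancel : ∀ {x} → Regular x → ∀ y z → x * y ≈ x * z → y ≈ z
  cancel {x} x-reg y z xy≈xz = begin
    y  ≈⟨ solve 2 (λ y z → y := (y :- z) :+ z) refl y z ⟩
    (y - z) + z  ≈⟨ +-congʳ (x-reg (y - z) (begin
      x * (y - z)  ≈⟨ solve 3 (λ x y z → x :* (y :- z) := x :* y :- x :* z) refl x y z ⟩
      x * y - x * z  ≈⟨ +-congʳ xy≈xz ⟩
      x * z - x * z  ≈⟨ -‿inverseʳ _ ⟩
      0#  ∎)) ⟩
    0# + z  ≈⟨ +-identityˡ z ⟩
    z  ∎

record Hom {c₁ ℓ₁ c₂ ℓ₂ : Level} (R : CommutativeRing c₁ ℓ₁) (S : CommutativeRing c₂ ℓ₂) :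
           Set (c₁ ⊔ ℓ₁ ⊔ c₂ ⊔ ℓ₂) where
  private
    module R = RingTools R
    module S = RingTools S
  field
    ⟦_⟧    : R.Carrier → S.Carrier
    ⟦⟧-cong : ∀ {x y} → x R.≈ y → ⟦ x ⟧ S.≈ ⟦ y ⟧
    +-homo : ∀ x y → ⟦ x R.+ y ⟧ S.≈ ⟦ x ⟧ S.+ ⟦ y ⟧
    *-homo : ∀ x y → ⟦ x R.* y ⟧ S.≈ ⟦ x ⟧ S.* ⟦ y ⟧
    1-homo : ⟦ R.1# ⟧ S.≈ S.1#

  open S using (solve; _:=_; _:+_; _:*_; _:-_; :-_; con; begin_; step-≈-⟩; step-≈-⟨; _∎)

  0-homo : ⟦ R.0# ⟧ S.≈ S.0#
  0-homo = begin
    ⟦ R.0# ⟧  ≈⟨ solve 1 (λ x → x := x :+ x :- x) S.refl _ ⟩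
    ⟦ R.0# ⟧ S.+ ⟦ R.0# ⟧ S.- ⟦ R.0# ⟧  ≈⟨ S.+-congʳ (+-homo _ _) ⟨
    ⟦ R.0# R.+ R.0# ⟧ S.- ⟦ R.0# ⟧  ≈⟨ S.+-congʳ (⟦⟧-cong (R.+-identityˡ _)) ⟩
    ⟦ R.0# ⟧ S.- ⟦ R.0# ⟧  ≈⟨ S.-‿inverseʳ _ ⟩
    S.0#  ∎

  -‿homo : ∀ x → ⟦ R.- x ⟧ S.≈ S.- ⟦ x ⟧
  -‿homo x = begin
    ⟦ R.- x ⟧  ≈⟨ solve 2 (λ x y → y := x :+ y :- x) S.refl ⟦ x ⟧ _ ⟩
    ⟦ x ⟧ S.+ ⟦ R.- x ⟧ S.- ⟦ x ⟧  ≈⟨ S.+-congʳ (+-homo _ _) ⟨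
    ⟦ x R.- x ⟧ S.- ⟦ x ⟧  ≈⟨ S.+-congʳ (⟦⟧-cong (R.-‿inverseʳ _)) ⟩
    ⟦ R.0# ⟧ S.- ⟦ x ⟧  ≈⟨ S.+-congʳ 0-homo ⟩
    S.0# S.- ⟦ x ⟧  ≈⟨ S.0-x≈-x _ ⟩
    S.- ⟦ x ⟧  ∎

  sub-homo : ∀ x y → ⟦ x R.- y ⟧ S.≈ ⟦ x ⟧ S.- ⟦ y ⟧
  sub-homo x y = S.trans (+-homo x (R.- y)) (S.+-congˡ (-‿homo y))

  ^-homo : ∀ x n → ⟦ x R.^ n ⟧ S.≈ ⟦ x ⟧ S.^ n
  ^-homo x zero    = 1-homo
  ^-homo x (suc n) = S.trans (*-homo _ _) (S.*-congˡ (^-homo x n))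

  b-homo : ∀ n k → ⟦ R.b n k ⟧ S.≈ S.b n k
  b-homo zero    zero    = 1-homo
  b-homo zero    (suc k) = 0-homo
  b-homo (suc n) zero    = b-homo n zero
  b-homo (suc n) (suc k) = S.trans (sub-homo _ _) (S.+-cong (b-homo n (suc k)) (S.-‿cong (b-homo n k)))

  χ-homo : ∀ p n → ⟦ R.χ p n ⟧ S.≈ S.χ p n
  χ-homo p n with p ∣? suc n
  ... | yes _ = 1-homo
  ... | no  _ = 0-homo

  ⨁-homo : ∀ n f → ⟦ R.⨁ n f ⟧ S.≈ S.⨁ n (λ k l → ⟦ f k l ⟧)
  ⨁-homo zero    f = S.refl
  ⨁-homo (suc n) f = S.trans (+-homo _ _) (S.+-congˡ (⨁-homo n _))

-- Power series

module PowerSeries {c ℓ : Level} (R : CommutativeRing c ℓ) where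

  open RingTools R

  Series : Set c
  Series = ℕ → Carrier

  infix  4 _≋_
  infixl 6 _⊞_
  infixl 7 _⊛_

  _≋_ : Series → Series → Set ℓ
  f ≋ g = ∀ n → f n ≈ g n

  _⊞_ : Series → Series → Series
  (f ⊞ g) n = f n + g n

  ⊟_ : Series → Series
  (⊟ f) n = - f n

  _⊛_ : Series → Series → Series
  (f ⊛ g) n = ⨁ n (λ k l → f k * g l)

  𝟘 : Series
  𝟘 _ = 0#

  const : Carrier → Series
  const x zero    = x
  const x (suc _) = 0#

  X : Series
  X zero    = 0#
  X (suc n) = const 1# n

  tail : Series → Series
  tail f n = f (suc n)

  ⊛-cong : ∀ {f f′ g g′} → f ≋ f′ → g ≋ g′ → f ⊛ g ≋ f′ ⊛ g′
  ⊛-cong f≋f′ g≋g′ n = ⨁-cong n (λ k l _ → *-cong (f≋f′ k) (g≋g′ l))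

  ⊛-comm : ∀ f g → f ⊛ g ≋ g ⊛ f
  ⊛-comm f g n = trans (⨁-swap n _) (⨁-cong n (λ _ _ _ → *-comm _ _))

  ⊛-distribˡ : ∀ f g h → f ⊛ (g ⊞ h) ≋ (f ⊛ g) ⊞ (f ⊛ h)
  ⊛-distribˡ f g h n = trans (⨁-cong n (λ _ _ _ → distribˡ _ _ _)) (⨁-+ n _ _)

  ⊛-distribʳ : ∀ f g h → (g ⊞ h) ⊛ f ≋ (g ⊛ f) ⊞ (h ⊛ f)
  ⊛-distribʳ f g h n = trans (⨁-cong n (λ _ _ _ → distribʳ _ _ _)) (⨁-+ n _ _)

  scale-⊛ : ∀ x f g n → ((λ k → x * f k) ⊛ g) n ≈ x * (f ⊛ g) n
  scale-⊛ x f g n = trans (⨁-cong n (λ _ _ _ → *-assoc _ _ _)) (sym (⨁-*ˡ n x _))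

  const-⊛ : ∀ x f n → (const x ⊛ f) n ≈ x * f n
  const-⊛ x f zero    = refl
  const-⊛ x f (suc n) = trans (+-congˡ (⨁-0 n (λ _ _ _ → zeroˡ _))) (+-identityʳ _)

  X-⊛-zero : ∀ f → (X ⊛ f) 0 ≈ 0#
  X-⊛-zero f = zeroˡ _

  X-⊛-suc : ∀ f n → (X ⊛ f) (suc n) ≈ f n
  X-⊛-suc f n = trans (+-congʳ (zeroˡ _)) (trans (+-identityˡ _) (trans (const-⊛ 1# f n) (*-identityˡ _)))

  ⊛-assoc : ∀ f g h → (f ⊛ g) ⊛ h ≋ f ⊛ (g ⊛ h)
  ⊛-assoc f g h zero    = *-assoc _ _ _
  ⊛-assoc f g h (suc n) = begin
    f 0 * g 0 * h (suc n) + (((λ k → f 0 * tail g k) ⊞ (tail f ⊛ g)) ⊛ h) n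
      ≈⟨ +-congˡ (⊛-distribʳ h _ _ n) ⟩
    f 0 * g 0 * h (suc n) + (((λ k → f 0 * tail g k) ⊛ h) n + ((tail f ⊛ g) ⊛ h) n)
      ≈⟨ +-cong (*-assoc _ _ _) (+-cong (scale-⊛ (f 0) (tail g) h n) (⊛-assoc (tail f) g h n)) ⟩
    f 0 * (g 0 * h (suc n)) + (f 0 * (tail g ⊛ h) n + (tail f ⊛ (g ⊛ h)) n)
      ≈⟨ +-assoc _ _ _ ⟨
    f 0 * (g 0 * h (suc n)) + f 0 * (tail g ⊛ h) n + (tail f ⊛ (g ⊛ h)) n
      ≈⟨ +-congʳ (distribˡ _ _ _) ⟨
    f 0 * (g ⊛ h) (suc n) + (tail f ⊛ (g ⊛ h)) n ∎

  ⊛-identityˡ : ∀ f → const 1# ⊛ f ≋ f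
  ⊛-identityˡ f n = trans (const-⊛ 1# f n) (*-identityˡ _)

  series : CommutativeRing c ℓ
  series = record
    { Carrier = Series
    ; _≈_ = _≋_
    ; _+_ = _⊞_
    ; _*_ = _⊛_
    ; -_  = ⊟_
    ; 0#  = 𝟘
    ; 1#  = const 1#
    ; isCommutativeRing = record
      { isRing = record
        { +-isAbelianGroup = record
          { isGroup = record
            { isMonoid = record
              { isSemigroup = record
                { isMagma = record
                  { isEquivalence = record
                    { refl = λ _ → refl ; sym = λ e n → sym (e n) ; trans = λ e e′ n → trans (e n) (e′ n) }
                  ; ∙-cong = λ e e′ n → +-cong (e n) (e′ n)
                  }
                ; assoc = λ f g h n → +-assoc _ _ _
                }
              ; identity = (λ f n → +-identityˡ _) , (λ f n → +-identityʳ _)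
              }
            ; inverse = (λ f n → -‿inverseˡ _) , (λ f n → -‿inverseʳ _)
            ; ⁻¹-cong = λ e n → -‿cong (e n)
            }
          ; comm = λ f g n → +-comm _ _
          }
        ; *-cong = ⊛-cong
        ; *-assoc = ⊛-assoc
        ; *-identity = ⊛-identityˡ , (λ f n → trans (⊛-comm f _ n) (⊛-identityˡ f n))
        ; distrib = ⊛-distribˡ , ⊛-distribʳ
        }
      ; *-comm = ⊛-comm
      }
    }

  constHom : Hom R series
  constHom = record
    { ⟦_⟧ = const
    ; ⟦⟧-cong = λ { x≈y zero → x≈y ; x≈y (suc n) → refl }
    ; +-homo = λ { x y zero → refl ; x y (suc n) → sym (+-identityˡ _) }
    ; *-homo = λ { x y n → trans (const-* x y n) (sym (const-⊛ x (const y) n)) }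
    ; 1-homo = λ n → refl
    }
    where
    const-* : ∀ x y n → const (x * y) n ≈ x * const y n
    const-* x y zero    = refl
    const-* x y (suc n) = sym (zeroʳ x)

  X-regular : RingTools.Regular series X
  X-regular f Xf≋0 n = trans (sym (X-⊛-suc f n)) (Xf≋0 (suc n))

  -- In degree n + 1 of the product every term except `f 0 * g (suc n)` contains an earlier
  -- coefficient of g, already known to be zero. The bound `N` makes this induction structural.
  regular-head : ∀ f → Regular (f 0) → RingTools.Regular series f
  regular-head f f₀-reg g fg≋0 n = below (suc n) n (ℕ.n<1+n n)
    where
    below : ∀ N n → n ℕ.< N → g n ≈ 0#
    below (suc N) zero    _ = f₀-reg _ (fg≋0 0)
    below (suc N) (suc n) (ℕ.s≤s n<N) = f₀-reg _ (begin
      f 0 * g (suc n)  ≈⟨ +-identityʳ _ ⟨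
      f 0 * g (suc n) + 0#  ≈⟨ +-congˡ (⨁-0 n (λ k l k+l≡n → trans (*-congˡ (below N l
                                                  (ℕ.≤-<-trans (ℕ.m+n≤o⇒n≤o k (ℕ.≤-reflexive k+l≡n)) n<N))) (zeroʳ _))) ⟨
      (f ⊛ g) (suc n)  ≈⟨ fg≋0 (suc n) ⟩
      0#  ∎)

open PowerSeries public using (series)

module MapSeries {c ℓ : Level} {R S : CommutativeRing c ℓ} (h : Hom R S) where
  open Hom h
  private
    module S = RingTools S
    module PR = PowerSeries R
    module PS = PowerSeries S

  mapHom : Hom (series R) (series S)
  mapHom = record
    { ⟦_⟧ = λ f n → ⟦ f n ⟧
    ; ⟦⟧-cong = λ e n → ⟦⟧-cong (e n)
    ; +-homo = λ f g n → +-homo _ _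
    ; *-homo = λ f g n → S.trans (⨁-homo n _) (S.⨁-cong n (λ _ _ _ → *-homo _ _))
    ; 1-homo = λ { zero → 1-homo ; (suc n) → 0-homo }
    }

open MapSeries public using (mapHom)

-- Series in two variables s and t

module TwoVariables {c ℓ : Level} (R : CommutativeRing c ℓ) where

  private
    module R = RingTools R
    module P₁ = PowerSeries R
    module P₂ = PowerSeries (series R)

  open RingTools (series (series R))

  swapHom : Hom (series (series R)) (series (series R))
  swapHom = record
    { ⟦_⟧ = λ f m n → f n m
    ; ⟦⟧-cong = λ e m n → e n m
    ; +-homo = λ f g m n → R.refl
    ; *-homo = swap-*
    ; 1-homo = λ { zero zero → R.refl ; zero (suc n) → R.refl ; (suc m) zero → R.refl ; (suc m) (suc n) → R.refl }
    }
    where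
    ⨁-at : ∀ n f m → RingTools.⨁ (series R) n f m ≡ R.⨁ n (λ k l → f k l m)
    ⨁-at zero    f m = ≡.refl
    ⨁-at (suc n) f m = ≡.cong (f 0 (suc n) m R.+_) (⨁-at n _ m)

    swap-* : ∀ f g m n → (f * g) n m R.≈ ((λ i j → f j i) * (λ i j → g j i)) m n
    swap-* f g m n = R.begin
      (f * g) n m  R.≡⟨ ⨁-at n _ m ⟩
      R.⨁ n (λ k l → R.⨁ m (λ i j → f k i R.* g l j))  R.≈⟨ R.⨁-comm n m _ ⟩
      R.⨁ m (λ i j → R.⨁ n (λ k l → f k i R.* g l j))  R.≡⟨ ⨁-at m _ n ⟨
      ((λ i j → f j i) * (λ i j → g j i)) m n                         R.∎

  -- In `f m n` the outer index m is the exponent of s and the inner index n that of t.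
  s t : Carrier
  s = P₂.X
  t = P₂.const P₁.X

  inS inT : P₁.Series → Carrier
  inS G n = P₁.const (G n)
  inT G = P₂.const G

  swap : Carrier → Carrier
  swap f m n = f n m

  swap-s : swap s ≈ t
  swap-s zero zero = R.refl
  swap-s zero (suc zero) = R.refl
  swap-s zero (suc (suc n)) = R.refl
  swap-s (suc m) zero = R.refl
  swap-s (suc m) (suc zero) = R.refl
  swap-s (suc m) (suc (suc n)) = R.refl

  swap-inT : ∀ G → swap (inT G) ≈ inS G
  swap-inT G m zero    = R.refl
  swap-inT G m (suc n) = R.refl

  -- Multiplication by the k-th power of the variable; padding with zeros avoids truncated
  -- subtraction in the indices.
  shiftBy : ℕ → P₁.Series → P₁.Series
  shiftBy zero    G n       = G n
  shiftBy (suc k) G zero    = R.0#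
  shiftBy (suc k) G (suc n) = shiftBy k G n

  shiftBy-< : ∀ {k n} G → n ℕ.< k → shiftBy k G n R.≈ R.0#
  shiftBy-< {suc k} {zero}  G _ = R.refl
  shiftBy-< {suc k} {suc n} G (ℕ.s≤s n<k) = shiftBy-< G n<k

  shiftBy-+ : ∀ k n G → shiftBy k G (k ℕ.+ n) ≡ G n
  shiftBy-+ zero    n G = ≡.refl
  shiftBy-+ (suc k) n G = shiftBy-+ k n G

  s*-zero : ∀ f n → (s * f) 0 n R.≈ R.0#
  s*-zero f n = P₂.X-⊛-zero f n

  s*-suc : ∀ f m n → (s * f) (suc m) n R.≈ f m n
  s*-suc f m n = P₂.X-⊛-suc f m n

  t*-zero : ∀ f m → (t * f) m 0 R.≈ R.0#
  t*-zero f m = R.trans (P₂.const-⊛ P₁.X f m 0) (P₁.X-⊛-zero (f m))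

  t*-suc : ∀ f m n → (t * f) m (suc n) R.≈ f m n
  t*-suc f m n = R.trans (P₂.const-⊛ P₁.X f m (suc n)) (P₁.X-⊛-suc (f m) n)

  [t-s]*_ : ∀ f → (t - s) * f ≈ t * f - s * f
  [t-s]*_ f = solve 3 (λ s t f → (t :- s) :* f := t :* f :- s :* f) (λ _ _ → R.refl) s t f

  [t-s]^k*inT : ∀ k G m n → ((t - s) ^ k * inT G) m n R.≈ R.b k m R.* shiftBy k G (m ℕ.+ n)
  [t-s]^k*inT zero G zero    n = R.trans (*-identityˡ (inT G) zero n) (R.sym (R.*-identityˡ _))
  [t-s]^k*inT zero G (suc m) n = R.trans (*-identityˡ (inT G) (suc m) n) (R.sym (R.zeroˡ _))
  [t-s]^k*inT (suc k) G m n = R.trans (*-assoc (t - s) _ (inT G) m n)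
    (R.trans (([t-s]* (((t - s) ^ k) * inT G)) m n) (step m n))
    where
    f = (t - s) ^ k * inT G
    step : ∀ m n → (t * f) m n R.- (s * f) m n R.≈ R.b (suc k) m R.* shiftBy (suc k) G (m ℕ.+ n)
    step zero zero = R.trans (R.+-cong (t*-zero f 0) (R.-‿cong (s*-zero f 0)))
      (R.trans (R.x-0≈x _) (R.sym (R.zeroʳ _)))
    step zero (suc n) = R.trans (R.+-cong (t*-suc f 0 n) (R.-‿cong (s*-zero f (suc n))))
      (R.trans (R.x-0≈x _) ([t-s]^k*inT k G 0 n))
    step (suc m) zero = R.begin
      (t * f) (suc m) 0 R.- (s * f) (suc m) 0
        R.≈⟨ R.+-cong (t*-zero f (suc m)) (R.-‿cong (R.trans (s*-suc f m 0) ([t-s]^k*inT k G m 0))) ⟩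
      R.0# R.- R.b k m R.* shiftBy k G (m ℕ.+ 0)
        R.≈⟨ R.+-congʳ (extra (ℕ.<-cmp k m)) ⟨
      R.b k (suc m) R.* shiftBy k G (m ℕ.+ 0) R.- R.b k m R.* shiftBy k G (m ℕ.+ 0)
        R.≈⟨ R.solve 3 (λ x y z → x R.:* z R.:- y R.:* z R.:= (x R.:- y) R.:* z) R.refl _ _ _ ⟩
      (R.b k (suc m) R.- R.b k m) R.* shiftBy k G (m ℕ.+ 0) R.∎
      where
      -- For n = 0 the factor t contributes nothing, so the term with `b k (suc m)` is missing from
      -- Pascal's rule. It is zero anyway: by the binomial if k ≤ m, by the shift if m < k.
      extra : Tri (k ℕ.< m) (k ≡ m) (m ℕ.< k) → R.b k (suc m) R.* shiftBy k G (m ℕ.+ 0) R.≈ R.0#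
      extra (tri< k<m _ _) = R.trans (R.*-congʳ (R.b-vanish (ℕ.m<n⇒m<1+n k<m))) (R.zeroˡ _)
      extra (tri≈ _ ≡.refl _) = R.trans (R.*-congʳ (R.b-vanish (ℕ.n<1+n k))) (R.zeroˡ _)
      extra (tri> _ _ m<k) = R.trans (R.*-congˡ (shiftBy-< G (ℕ.≤-<-trans (ℕ.≤-reflexive (ℕ.+-identityʳ m)) m<k))) (R.zeroʳ _)
    step (suc m) (suc n) = R.begin
      (t * f) (suc m) (suc n) R.- (s * f) (suc m) (suc n)
        R.≈⟨ R.+-cong (R.trans (t*-suc f (suc m) n) ([t-s]^k*inT k G (suc m) n))
                      (R.-‿cong (R.trans (s*-suc f m (suc n)) ([t-s]^k*inT k G m (suc n)))) ⟩
      R.b k (suc m) R.* shiftBy k G (suc m ℕ.+ n) R.- R.b k m R.* shiftBy k G (m ℕ.+ suc n)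
        R.≡⟨ ≡.cong (λ i → R.b k (suc m) R.* shiftBy k G i R.- R.b k m R.* shiftBy k G (m ℕ.+ suc n)) (≡.sym (ℕ.+-suc m n)) ⟩
      R.b k (suc m) R.* shiftBy k G (m ℕ.+ suc n) R.- R.b k m R.* shiftBy k G (m ℕ.+ suc n)
        R.≈⟨ R.solve 3 (λ x y z → x R.:* z R.:- y R.:* z R.:= (x R.:- y) R.:* z) R.refl _ _ _ ⟩
      (R.b k (suc m) R.- R.b k m) R.* shiftBy k G (m ℕ.+ suc n) R.∎

  [s-t]^k*inS : ∀ k G m n → ((s - t) ^ k * inS G) m n R.≈ R.b k n R.* shiftBy k G (m ℕ.+ n)
  [s-t]^k*inS k G m n = R.begin
    ((s - t) ^ k * inS G) m n
      R.≈⟨ *-cong (^-congˡ k (+-cong (λ m n → swap-s n m) (-‿cong (sym swap-s)))) (sym (swap-inT G)) m n ⟩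
    (swap (t - s) ^ k * swap (inT G)) m n
      R.≈⟨ *-congʳ {swap (inT G)} (Hom.^-homo swapHom (t - s) k) m n ⟨
    (swap ((t - s) ^ k) * swap (inT G)) m n
      R.≈⟨ Hom.*-homo swapHom ((t - s) ^ k) (inT G) m n ⟨
    ((t - s) ^ k * inT G) n m
      R.≈⟨ [t-s]^k*inT k G n m ⟩
    R.b k n R.* shiftBy k G (n ℕ.+ m)
      R.≡⟨ ≡.cong (λ i → R.b k n R.* shiftBy k G i) (ℕ.+-comm n m) ⟩
    R.b k n R.* shiftBy k G (m ℕ.+ n) R.∎

  -- (G(t) - G(s)) / (t - s)
  divided : P₁.Series → Carrier
  divided G m n = G (suc (m ℕ.+ n))

  [t-s]*divided : ∀ G → (t - s) * divided G ≈ inT G - inS G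
  [t-s]*divided G m n = R.trans (([t-s]* divided G) m n) (step m n)
    where
    f = divided G
    step : ∀ m n → (t * f) m n R.- (s * f) m n R.≈ inT G m n R.- inS G m n
    step zero zero = R.trans (R.+-cong (t*-zero f 0) (R.-‿cong (s*-zero f 0)))
      (R.trans (R.-‿inverseʳ _) (R.sym (R.-‿inverseʳ _)))
    step zero (suc n) = R.+-cong (t*-suc f 0 n) (R.-‿cong (s*-zero f (suc n)))
    step (suc m) zero = R.+-cong (t*-zero f (suc m))
      (R.-‿cong (R.trans (s*-suc f m 0) (R.reflexive (≡.cong (λ i → G (suc i)) (ℕ.+-identityʳ m)))))
    step (suc m) (suc n) = R.begin
      (t * f) (suc m) (suc n) R.- (s * f) (suc m) (suc n)
        R.≈⟨ R.+-cong (t*-suc f (suc m) n) (R.-‿cong (s*-suc f m (suc n))) ⟩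
      G (suc (suc (m ℕ.+ n))) R.- G (suc (m ℕ.+ suc n))
        R.≡⟨ ≡.cong (λ i → G (suc i) R.- G (suc (m ℕ.+ suc n))) (≡.sym (ℕ.+-suc m n)) ⟩
      G (suc (m ℕ.+ suc n)) R.- G (suc (m ℕ.+ suc n))
        R.≈⟨ R.trans (R.-‿inverseʳ _) (R.sym (R.-‿inverseʳ _)) ⟩
      R.0# R.- R.0# R.∎

-- Finite fields and algebras over them

module FiniteField {c ℓ : Level} (F : CommutativeRing c ℓ) (e : ℕ)
                   (fin : IsFiniteField F (suc (suc e))) where

  open RingTools F
  open IsFiniteField fin

  -- `p` is q - 1, the order of the multiplicative group, and not the characteristic.
  p q : ℕ
  p = suc e
  q = suc p

  toFin-injective : ∀ {x y} → toFin x ≡ toFin y → x ≈ y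
  toFin-injective {x} {y} eq =
    trans (sym (from-to x)) (trans (reflexive (≡.cong fromFin eq)) (from-to y))

  fromFin-injective : ∀ {i j} → fromFin i ≈ fromFin j → i ≡ j
  fromFin-injective {i} {j} eq = ≡.trans (≡.sym (to-from i)) (≡.trans (toFin-cong eq) (to-from j))

  _≟_ : ∀ x y → Dec (x ≈ y)
  x ≟ y with toFin x Fin.≟ toFin y
  ... | yes eq = yes (toFin-injective eq)
  ... | no neq = no (neq ∘ toFin-cong)

  x*y≈0⇒y≈0 : ∀ {x y} → ¬ x ≈ 0# → x * y ≈ 0# → y ≈ 0#
  x*y≈0⇒y≈0 {x} {y} x≉0 xy≈0 with inverse x x≉0
  ... | z , xz≈1 = begin
    y  ≈⟨ *-identityˡ y ⟨
    1# * y  ≈⟨ *-congʳ xz≈1 ⟨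
    x * z * y  ≈⟨ solve 3 (λ x y z → x :* z :* y := z :* (x :* y)) refl x y z ⟩
    z * (x * y)  ≈⟨ *-congˡ xy≈0 ⟩
    z * 0#  ≈⟨ zeroʳ z ⟩
    0#  ∎

  module _ {c′ ℓ′ : Level} (M : CommutativeMonoid c′ ℓ′) where
    private module M = CommutativeMonoid M
    open MonoidSum M using (sum; sum-cong-≋; sum-permute)

    total : (Carrier → M.Carrier) → M.Carrier
    total f = sum (f ∘ fromFin)

    total-cong : ∀ {f g} → (∀ x → f x M.≈ g x) → total f M.≈ total g
    total-cong f≈g = sum-cong-≋ (f≈g ∘ fromFin)

    reindex : (f : Carrier → M.Carrier) → (∀ {x y} → x ≈ y → f x M.≈ f y) →
      (σ τ : Carrier → Carrier) → (∀ {x y} → x ≈ y → σ x ≈ σ y) → (∀ {x y} → x ≈ y → τ x ≈ τ y) →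
      (∀ x → σ (τ x) ≈ x) → (∀ x → τ (σ x) ≈ x) → total f M.≈ total (f ∘ σ)
    reindex f f-cong σ τ σ-cong τ-cong στ τσ = M.trans
      (sum-permute (f ∘ fromFin) (permutation (toFin ∘ σ ∘ fromFin) (toFin ∘ τ ∘ fromFin)
        (λ i → ≡.trans (toFin-cong (trans (σ-cong (from-to _)) (στ _))) (to-from i))
        (λ i → ≡.trans (toFin-cong (trans (τ-cong (from-to _)) (τσ _))) (to-from i))))
      (sum-cong-≋ {_} {λ i → f (fromFin (toFin (σ (fromFin i))))} {λ i → f (σ (fromFin i))} (λ i → f-cong (from-to _)))

  module Scale (x : Carrier) (x≉0 : ¬ x ≈ 0#) where
    private
      x⁻¹ = proj₁ (inverse x x≉0)
      xx⁻¹≈1 = proj₂ (inverse x x≉0)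

    reindex-* : ∀ {c′ ℓ′ : Level} (M : CommutativeMonoid c′ ℓ′) (f : Carrier → CommutativeMonoid.Carrier M) →
      (∀ {y z} → y ≈ z → CommutativeMonoid._≈_ M (f y) (f z)) →
      CommutativeMonoid._≈_ M (total M f) (total M (λ y → f (x * y)))
    reindex-* M f f-cong = reindex M f f-cong (x *_) (x⁻¹ *_) *-congˡ *-congˡ
      (λ y → trans (sym (*-assoc _ _ _)) (trans (*-congʳ xx⁻¹≈1) (*-identityˡ y)))
      (λ y → trans (sym (*-assoc _ _ _)) (trans (*-congʳ (trans (*-comm _ _) xx⁻¹≈1)) (*-identityˡ y)))

  private module Π = MonoidSum *-commutativeMonoid

  ∏-unit : ∀ {n} (t : Vector Carrier n) → (∀ i → ∃ λ y → t i * y ≈ 1#) → ∃ λ y → Π.sum t * y ≈ 1#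
  ∏-unit {zero}  t units = 1# , *-identityˡ 1#
  ∏-unit {suc n} t units with units zero | ∏-unit (t ∘ suc) (units ∘ suc)
  ... | y , ty≈1 | z , tz≈1 = y * z , (begin
    t zero * Π.sum (t ∘ suc) * (y * z)  ≈⟨ solve 4 (λ a b c d → a :* b :* (c :* d) := a :* c :* (b :* d)) refl _ _ _ _ ⟩
    t zero * y * (Π.sum (t ∘ suc) * z)  ≈⟨ *-cong ty≈1 tz≈1 ⟩
    1# * 1#  ≈⟨ *-identityˡ 1# ⟩
    1#  ∎)

  i₀ : Fin q
  i₀ = toFin 0#

  nonzero : ∀ j → ¬ fromFin (punchIn i₀ j) ≈ 0#
  nonzero j eq = Fin.punchInᵢ≢i i₀ j (≡.trans (≡.sym (to-from _)) (toFin-cong eq))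

  -- Multiplication by x permutes F; compare the products of the nonzero elements before and after.
  x^p≈1 : ∀ x → ¬ x ≈ 0# → x ^ p ≈ 1#
  x^p≈1 x x≉0 = begin
    x ^ p  ≈⟨ Π.sum-replicate p ⟨
    Π.sum (replicate p x)  ≈⟨ Π.sum-cong-≋ (λ j → factor-nonzero (nonzero j)) ⟨
    Π.sum (removeAt factors i₀)  ≈⟨ *-identityˡ _ ⟨
    1# * Π.sum (removeAt factors i₀) ≈⟨ *-congʳ (factor-zero (from-to 0#)) ⟨
    factors i₀ * Π.sum (removeAt factors i₀) ≈⟨ Π.sum-remove {i = i₀} factors ⟨
    C  ≈⟨ *-identityʳ C ⟨
    C * 1#  ≈⟨ *-congˡ Uy≈1 ⟨
    C * (U * y)  ≈⟨ *-assoc _ _ _ ⟨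
    C * U * y  ≈⟨ *-congʳ CU≈U ⟩
    U * y  ≈⟨ Uy≈1 ⟩
    1#  ∎
    where
    -- Replacing 0 by 1 turns the product of the nonzero elements into one over all of F, to which
    -- the bijection z ↦ x z applies; `factor` is 1 at 0, where nothing gets multiplied by x.
    u : Carrier → Carrier
    u z with z ≟ 0#
    ... | yes _ = 1#
    ... | no  _ = z

    factor : Carrier → Carrier
    factor z with z ≟ 0#
    ... | yes _ = 1#
    ... | no  _ = x

    factor-zero : ∀ {z} → z ≈ 0# → factor z ≈ 1#
    factor-zero {z} z≈0 with z ≟ 0#
    ... | yes _   = refl
    ... | no  z≉0 = ⊥-elim (z≉0 z≈0)

    factor-nonzero : ∀ {z} → ¬ z ≈ 0# → factor z ≈ x
    factor-nonzero {z} z≉0 with z ≟ 0#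
    ... | yes z≈0 = ⊥-elim (z≉0 z≈0)
    ... | no  _   = refl

    u-cong : ∀ {y z} → y ≈ z → u y ≈ u z
    u-cong {y} {z} y≈z with y ≟ 0# | z ≟ 0#
    ... | yes _   | yes _   = refl
    ... | yes y≈0 | no  z≉0 = ⊥-elim (z≉0 (trans (sym y≈z) y≈0))
    ... | no  y≉0 | yes z≈0 = ⊥-elim (y≉0 (trans y≈z z≈0))
    ... | no  _   | no  _   = y≈z

    u-* : ∀ z → u (x * z) ≈ factor z * u z
    u-* z with z ≟ 0# | (x * z) ≟ 0#
    ... | yes _   | yes _    = sym (*-identityˡ 1#)
    ... | yes z≈0 | no  xz≉0 = ⊥-elim (xz≉0 (trans (*-congˡ z≈0) (zeroʳ x)))
    ... | no  z≉0 | yes xz≈0 = ⊥-elim (z≉0 (x*y≈0⇒y≈0 x≉0 xz≈0))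
    ... | no  _   | no  _    = refl

    u-unit : ∀ z → ∃ λ y → u z * y ≈ 1#
    u-unit z with z ≟ 0#
    ... | yes _   = 1# , *-identityˡ 1#
    ... | no  z≉0 = inverse z z≉0

    factors = factor ∘ fromFin
    C = Π.sum factors
    U = total *-commutativeMonoid u
    y = proj₁ (∏-unit (u ∘ fromFin) (u-unit ∘ fromFin))
    Uy≈1 = proj₂ (∏-unit (u ∘ fromFin) (u-unit ∘ fromFin))

    CU≈U : C * U ≈ U
    CU≈U = begin
      C * U  ≈⟨ Π.∑-distrib-+ factors (u ∘ fromFin) ⟨
      Π.sum (λ i → factors i * u (fromFin i))  ≈⟨ Π.sum-cong-≋ (λ i → sym (u-* (fromFin i))) ⟩
      total *-commutativeMonoid (λ y → u (x * y))  ≈⟨ Scale.reindex-* x x≉0 *-commutativeMonoid u u-cong ⟨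
      U  ∎

  x^q≈x : ∀ x → x ^ q ≈ x
  x^q≈x x with x ≟ 0#
  ... | yes x≈0 = trans (*-congʳ x≈0) (trans (zeroˡ _) (sym x≈0))
  ... | no  x≉0 = trans (*-congˡ (x^p≈1 x x≉0)) (*-identityʳ x)

  -- Horner evaluation; c 0 is the leading coefficient of a polynomial of degree less than n.
  eval : ℕ → (ℕ → Carrier) → Carrier → Carrier
  eval zero    c x = 0#
  eval (suc n) c x = x * eval n c x + c n

  eval-⨁ : ∀ n c x → eval (suc n) c x ≈ ⨁ n (λ k l → c k * x ^ l)
  eval-⨁ zero    c x = solve 2 (λ x c → x :* con (+ 0) :+ c := c :* con (+ 1)) refl x (c 0)
  eval-⨁ (suc n) c x = begin
    x * eval (suc n) c x + c (suc n)
      ≈⟨ +-congʳ (*-congˡ (eval-⨁ n c x)) ⟩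
    x * ⨁ n (λ k l → c k * x ^ l) + c (suc n)
      ≈⟨ +-congʳ (⨁-*ˡ n x _) ⟩
    ⨁ n (λ k l → x * (c k * x ^ l)) + c (suc n)
      ≈⟨ +-cong (⨁-cong n (λ k l _ → solve 3 (λ x c y → x :* (c :* y) := c :* (x :* y)) refl x _ _)) (sym (*-identityʳ _)) ⟩
    ⨁ n (λ k l → c k * x ^ suc l) + c (suc n) * 1#
      ≈⟨ ⨁-last n (λ k l → c k * x ^ l) ⟨
    ⨁ (suc n) (λ k l → c k * x ^ l) ∎

  -- The partial Horner values at a are the coefficients of the quotient by X - a, and the last
  -- value is the remainder.
  synthetic-division : ∀ n c a x →
    eval (suc n) c x ≈ (x - a) * eval n (λ i → eval (suc i) c a) x + eval (suc n) c a
  synthetic-division zero c a x =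
    solve 3 (λ x a c → x :* con (+ 0) :+ c := (x :- a) :* con (+ 0) :+ (a :* con (+ 0) :+ c)) refl x a (c 0)
  synthetic-division (suc n) c a x = trans (+-congʳ (*-congˡ (synthetic-division n c a x)))
    (solve 5 (λ x a c r v → x :* ((x :- a) :* r :+ v) :+ c := (x :- a) :* (x :* r :+ v) :+ (a :* v :+ c))
      refl x a (c (suc n)) _ _)

  -- Division by X - r 0 leaves a quotient that vanishes at the other roots, hence is zero by
  -- induction. Its coefficients are Horner values at r 0, and `c k` is one such value minus r 0
  -- times the preceding one.
  no-more-roots : ∀ n c (r : Fin n → Carrier) → (∀ {i j} → r i ≈ r j → i ≡ j) →
    (∀ i → eval n c (r i) ≈ 0#) → ∀ k → k ℕ.< n → c k ≈ 0#
  no-more-roots (suc n) c r r-inj root k k<n = begin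
    c k  ≈⟨ solve 3 (λ a v c → c := (a :* v :+ c) :- a :* v) refl a (eval k c a) (c k) ⟩
    eval (suc k) c a - a * eval k c a  ≈⟨ +-cong (vanish (suc k) k<n) (-‿cong (*-congˡ (vanish k (ℕ.<⇒≤ k<n)))) ⟩
    0# - a * 0#  ≈⟨ solve 1 (λ a → con (+ 0) :- a :* con (+ 0) := con (+ 0)) refl a ⟩
    0#  ∎
    where
    a = r zero
    quotient = λ i → eval (suc i) c a

    quotient-root : ∀ i → eval n quotient (r (suc i)) ≈ 0#
    quotient-root i = x*y≈0⇒y≈0 {r (suc i) - a}
      (λ eq → Fin.0≢1+n (≡.sym (r-inj (begin
        r (suc i)  ≈⟨ solve 2 (λ x a → x := (x :- a) :+ a) refl _ a ⟩
        (r (suc i) - a) + a  ≈⟨ +-congʳ eq ⟩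
        0# + a  ≈⟨ +-identityˡ a ⟩
        a  ∎))))
      (begin
        (r (suc i) - a) * eval n quotient (r (suc i))  ≈⟨ +-identityʳ _ ⟨
        (r (suc i) - a) * eval n quotient (r (suc i)) + 0#  ≈⟨ +-congˡ (root zero) ⟨
        (r (suc i) - a) * eval n quotient (r (suc i)) + eval (suc n) c a  ≈⟨ synthetic-division n c a (r (suc i)) ⟨
        eval (suc n) c (r (suc i))  ≈⟨ root (suc i) ⟩
        0#  ∎)

    vanish : ∀ k → k ℕ.≤ suc n → eval k c a ≈ 0#
    vanish zero    _ = refl
    vanish (suc k) (ℕ.s≤s k≤n) with ℕ.m≤n⇒m<n∨m≡n k≤n
    ... | inj₁ k<n    = no-more-roots n quotient (r ∘ suc) (Fin.suc-injective ∘ r-inj) quotient-root k k<n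
    ... | inj₂ ≡.refl = root zero

  -- The coefficients are listed from the leading one down, so `δ (n ∸ k)` selects the constant
  -- term.
  eval-+const : ∀ n (f : ℕ → Carrier) y x → eval (suc n) (λ k → f k + y * δ (n ∸ k)) x ≈ ⨁ n (λ k l → f k * x ^ l) + y
  eval-+const n f y x = begin
    eval (suc n) (λ k → f k + y * δ (n ∸ k)) x
      ≈⟨ eval-⨁ n _ x ⟩
    ⨁ n (λ k l → (f k + y * δ (n ∸ k)) * x ^ l)
      ≈⟨ ⨁-cong n (λ k l k+l≡n → trans
           (*-congʳ (+-congˡ (*-congˡ (reflexive (≡.cong δ (≡.trans (≡.cong (_∸ k) (≡.sym k+l≡n)) (ℕ.m+n∸m≡n k l)))))))
           (solve 4 (λ a y d z → (a :+ y :* d) :* z := a :* z :+ d :* (y :* z)) refl (f k) y (δ l) (x ^ l))) ⟩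
    ⨁ n (λ k l → f k * x ^ l + δ l * (y * x ^ l))
      ≈⟨ ⨁-+ n _ _ ⟩
    ⨁ n (λ k l → f k * x ^ l) + ⨁ n (λ k l → δ l * (y * x ^ l))
      ≈⟨ +-congˡ (trans (⨁-δʳ n (λ k l → y * x ^ l)) (*-identityʳ y)) ⟩
    ⨁ n (λ k l → f k * x ^ l) + y ∎

  ⨁-leading : ∀ n y x → ⨁ n (λ k l → y * δ k * x ^ l) ≈ y * x ^ n
  ⨁-leading n y x = trans
    (⨁-cong n (λ k l _ → solve 3 (λ y d z → y :* d :* z := d :* (y :* z)) refl y (δ k) (x ^ l)))
    (⨁-δˡ n (λ k l → y * x ^ l))

  ⨁-1^k : ∀ n (f : ℕ → Carrier) x → ⨁ n (λ k l → f k * x ^ l) ≈ ⨁ n (λ k l → f k * (1# ^ suc k * x ^ l))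
  ⨁-1^k n f x = ⨁-cong n (λ k l _ → *-congˡ (sym (trans (*-congʳ (1^n≈1 (suc k))) (*-identityˡ _))))

  -- (X - 1)^q - X^q + 1 has degree less than q and vanishes on all of F.
  b-q-coefficients : ∀ k → k ℕ.< q → b q (suc k) + 1# * δ (p ∸ k) ≈ 0#
  b-q-coefficients = no-more-roots q _ fromFin fromFin-injective (root ∘ fromFin)
    where
    root : ∀ x → eval q (λ k → b q (suc k) + 1# * δ (p ∸ k)) x ≈ 0#
    root x = begin
      eval q (λ k → b q (suc k) + 1# * δ (p ∸ k)) x
        ≈⟨ eval-+const p (λ k → b q (suc k)) 1# x ⟩
      ⨁ p (λ k l → b q (suc k) * x ^ l) + 1#
        ≈⟨ +-congʳ (⨁-1^k p (λ k → b q (suc k)) x) ⟩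
      ⨁ p (λ k l → b q (suc k) * (1# ^ suc k * x ^ l)) + 1#
        ≈⟨ solve 3 (λ u v o → v :+ o := (u :+ v) :- u :+ o) refl (b q 0 * (1# ^ 0 * x ^ q)) _ _ ⟩
      ⨁ q (λ k l → b q k * (1# ^ k * x ^ l)) - b q 0 * (1# ^ 0 * x ^ q) + 1#
        ≈⟨ +-congʳ (+-cong (sym (binomial 1# x q)) (-‿cong (*-cong (b-n-0 q) (*-identityˡ _)))) ⟩
      (x - 1#) ^ q - 1# * x ^ q + 1#
        ≈⟨ +-congʳ (+-cong (x^q≈x (x - 1#)) (-‿cong (*-congˡ (x^q≈x x)))) ⟩
      x - 1# - 1# * x + 1#
        ≈⟨ solve 1 (λ x → x :- con (+ 1) :- con (+ 1) :* x :+ con (+ 1) := con (+ 0)) refl x ⟩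
      0# ∎

  [-1]^p≈1 : (- 1#) ^ p ≈ 1#
  [-1]^p≈1 = x^p≈1 (- 1#) (λ eq → 1≉0 (begin
    1#  ≈⟨ solve 0 (con (+ 1) := :- (:- con (+ 1))) refl ⟩
    - (- 1#)  ≈⟨ -‿cong eq ⟩
    - 0#  ≈⟨ -0#≈0# ⟩
    0#  ∎))

  private module ∑F = MonoidSum +-commutativeMonoid

  powerSum : ℕ → Carrier
  powerSum n = total +-commutativeMonoid (_^ n)

  -- The translation x ↦ x + 1 preserves the sum of all elements, so the q ones that it adds must
  -- sum to 0.
  powerSum-0 : powerSum 0 ≈ 0#
  powerSum-0 = begin
    powerSum 0
      ≈⟨ solve 2 (λ a b → b := a :+ b :- a) refl (∑F.sum fromFin) (powerSum 0) ⟩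
    ∑F.sum fromFin + powerSum 0 - ∑F.sum fromFin
      ≈⟨ +-congʳ (∑F.∑-distrib-+ fromFin (λ _ → 1#)) ⟨
    total +-commutativeMonoid (_+ 1#) - ∑F.sum fromFin
      ≈⟨ +-congʳ (reindex +-commutativeMonoid (λ x → x) (λ x≈y → x≈y) (_+ 1#) (_- 1#) +-congʳ +-congʳ
           (λ x → solve 1 (λ x → (x :- con (+ 1)) :+ con (+ 1) := x) refl x)
           (λ x → solve 1 (λ x → (x :+ con (+ 1)) :- con (+ 1) := x) refl x)) ⟨
    ∑F.sum fromFin - ∑F.sum fromFin
      ≈⟨ -‿inverseʳ _ ⟩
    0# ∎

  -- The function 1 - x^p is 1 at 0 and vanishes elsewhere, so its total is 1; together with
  -- `powerSum p` this makes `powerSum 0`.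
  powerSum-p : powerSum p ≈ - 1#
  powerSum-p = begin
    powerSum p
      ≈⟨ solve 2 (λ a b → a := a :+ b :- b) refl (powerSum p) (∑F.sum (λ i → 1# - fromFin i ^ p)) ⟩
    powerSum p + ∑F.sum (λ i → 1# - fromFin i ^ p) - ∑F.sum (λ i → 1# - fromFin i ^ p)
      ≈⟨ +-congʳ (∑F.∑-distrib-+ (λ i → fromFin i ^ p) (λ i → 1# - fromFin i ^ p)) ⟨
    ∑F.sum (λ i → fromFin i ^ p + (1# - fromFin i ^ p)) - ∑F.sum (λ i → 1# - fromFin i ^ p)
      ≈⟨ +-cong (∑F.sum-cong-≋ (λ i → solve 1 (λ x → x :+ (con (+ 1) :- x) := con (+ 1)) refl (fromFin i ^ p)))
                (-‿cong (∑F.sum-remove {i = i₀} (λ i → 1# - fromFin i ^ p))) ⟩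
    powerSum 0 - (1# - fromFin i₀ ^ p + ∑F.sum (removeAt (λ i → 1# - fromFin i ^ p) i₀))
      ≈⟨ +-cong powerSum-0 (-‿cong (+-cong
           (+-congˡ (-‿cong (trans (*-congʳ (from-to 0#)) (zeroˡ _))))
           (trans (∑F.sum-cong-≋ (λ j → trans (+-congˡ (-‿cong (x^p≈1 _ (nonzero j)))) (-‿inverseʳ 1#)))
                  (∑F.sum-replicate-zero p)))) ⟩
    0# - (1# - 0# + 0#)
      ≈⟨ solve 0 (con (+ 0) :- (con (+ 1) :- con (+ 0) :+ con (+ 0)) := :- con (+ 1)) refl ⟩
    - 1# ∎

  -- The exponent has to be positive: 0 ^ 0 is 1 while 0 ^ p is 0.
  powerSum-+p : ∀ n → powerSum (p ℕ.+ suc n) ≈ powerSum (suc n)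
  powerSum-+p n = total-cong +-commutativeMonoid {_^ (p ℕ.+ suc n)} {_^ suc n} (λ x → begin
    x ^ (p ℕ.+ suc n)  ≡⟨ ≡.cong (x ^_) (ℕ.+-suc p n) ⟩
    x ^ (q ℕ.+ n)  ≈⟨ ^-homo-* x q n ⟩
    x ^ q * x ^ n  ≈⟨ *-congʳ (x^q≈x x) ⟩
    x ^ suc n  ∎)

  -- With S = powerSum n, the polynomial S(Xⁿ - 1) vanishes on all p nonzero elements.
  powerSum-<p : ∀ n → suc n ℕ.< p → powerSum (suc n) ≈ 0#
  powerSum-<p n′ n<p = trans (solve 1 (λ s → s := s :* con (+ 1) :+ (:- s) :* con (+ 0)) refl S)
      (no-more-roots (suc n) (λ k → S * δ k + (- S) * δ (n ∸ k)) roots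
        (λ eq → Fin.inject≤-injective _ _ _ _ (Fin.punchIn-injective i₀ _ _ (fromFin-injective eq)))
        (λ i → root (roots i) (nonzero _)) 0 ℕ.z<s)
    where
    n = suc n′
    S = powerSum n

    roots : Fin (suc n) → Carrier
    roots i = fromFin (punchIn i₀ (inject≤ i n<p))

    root : ∀ x → ¬ x ≈ 0# → eval (suc n) (λ k → S * δ k + (- S) * δ (n ∸ k)) x ≈ 0#
    root x x≉0 = begin
      eval (suc n) (λ k → S * δ k + (- S) * δ (n ∸ k)) x
        ≈⟨ eval-+const n (λ k → S * δ k) (- S) x ⟩
      ⨁ n (λ k l → S * δ k * x ^ l) - S
        ≈⟨ +-congʳ (⨁-leading n S x) ⟩
      S * x ^ n - S
        ≈⟨ +-congʳ (trans (*-comm _ _) x^nS≈S) ⟩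
      S - S
        ≈⟨ -‿inverseʳ S ⟩
      0# ∎
      where
      open Sum semiring using (*-distribˡ-sum)
      x^nS≈S : x ^ n * S ≈ S
      x^nS≈S = begin
        x ^ n * S  ≈⟨ *-distribˡ-sum (x ^ n) (λ i → fromFin i ^ n) ⟩
        ∑F.sum (λ i → x ^ n * fromFin i ^ n)  ≈⟨ ∑F.sum-cong-≋ (λ i → sym (^-distrib-* x (fromFin i) n)) ⟩
        ∑F.sum (λ i → (x * fromFin i) ^ n)  ≈⟨ Scale.reindex-* x x≉0 +-commutativeMonoid (_^ n) (^-congˡ n) ⟨
        S  ∎

  -- Periodicity lowers the exponent until it lies between 1 and p.
  powerSum-suc : ∀ n → powerSum (suc n) ≈ - χ p n
  powerSum-suc = <-rec (λ n → powerSum (suc n) ≈ - χ p n) step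
    where
    step : ∀ n → (∀ {m} → m ℕ.< n → powerSum (suc m) ≈ - χ p m) → powerSum (suc n) ≈ - χ p n
    step n rec with ℕ.<-cmp (suc n) p
    ... | tri< n<p _ _ = trans (powerSum-<p n n<p)
      (sym (trans (-‿cong (χ-no (λ p∣n → ℕ.<⇒≱ n<p (ℕ.∣⇒≤ p∣n)))) -0#≈0#))
    ... | tri≈ _ ≡.refl _ = trans powerSum-p (sym (-‿cong (χ-yes {p} {e} ℕ.∣-refl)))
    ... | tri> _ _ (ℕ.s≤s p≤n) with ℕ.m≤n⇒∃[o]m+o≡n p≤n
    ...   | m , ≡.refl = begin
      powerSum (suc (p ℕ.+ m))  ≡⟨ ≡.cong powerSum (ℕ.+-suc p m) ⟨
      powerSum (p ℕ.+ suc m)  ≈⟨ powerSum-+p m ⟩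
      powerSum (suc m)  ≈⟨ rec (ℕ.m<n+m m ℕ.z<s) ⟩
      - χ p m  ≈⟨ -‿cong (χ-+ p m) ⟨
      - χ p (p ℕ.+ m)  ∎

-- Frobenius, parity and power sums in an 𝔽_q-algebra

module FAlgebra {c ℓ c′ ℓ′ : Level} (F : CommutativeRing c ℓ) (e : ℕ)
                (fin : IsFiniteField F (suc (suc e)))
                (R : CommutativeRing c′ ℓ′) (ι : Hom F R) where

  private module F = RingTools F
  module FF = FiniteField F e fin
  open FF using (p; q; total; total-cong; reindex; powerSum; powerSum-0; powerSum-suc)
  open RingTools R
  open Hom ι
  open IsFiniteField fin using (fromFin)
  open Sum semiring using (sum; sum-cong-≋; *-distribˡ-sum)

  b-q : ∀ k → k ℕ.< p → b q (suc k) ≈ 0#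
  b-q k k<p = begin
    b q (suc k)  ≈⟨ b-homo q (suc k) ⟨
    ⟦ F.b q (suc k) ⟧  ≈⟨ ⟦⟧-cong (F.trans (F.trans (F.sym (F.+-identityʳ _)) (F.+-congˡ (F.sym
                               (F.trans (F.*-identityˡ _) (δ-pos (ℕ.m<n⇒0<n∸m k<p)))))) (FF.b-q-coefficients k (ℕ.m<n⇒m<1+n k<p))) ⟩
    ⟦ F.0# ⟧  ≈⟨ 0-homo ⟩
    0#  ∎
    where
    δ-pos : ∀ {n} → 0 ℕ.< n → F.δ n F.≈ F.0#
    δ-pos {suc n} _ = F.refl

  b-q-q : b q q ≈ - 1#
  b-q-q = begin
    b q q  ≈⟨ b-homo q q ⟨
    ⟦ F.b q q ⟧  ≈⟨ ⟦⟧-cong (F.solve 1 (λ x → x F.:= x F.:+ F.con (+ 1) F.:* F.con (+ 1) F.:- F.con (+ 1)) F.refl (F.b q q)) ⟩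
    ⟦ F.b q q F.+ F.1# F.* F.1# F.- F.1# ⟧
      ≈⟨ ⟦⟧-cong (F.+-congʳ (F.trans (F.+-congˡ (F.*-congˡ (F.reflexive (≡.cong F.δ (≡.sym (ℕ.n∸n≡0 p))))))
           (FF.b-q-coefficients p (ℕ.n<1+n p)))) ⟩
    ⟦ F.0# F.- F.1# ⟧  ≈⟨ trans (⟦⟧-cong (F.0-x≈-x _)) (trans (-‿homo _) (-‿cong 1-homo)) ⟩
    - 1#  ∎

  -- All inner binomial coefficients vanish by `b-q`, which is an identity in F carried over to R.
  frobenius : ∀ x y → (y - x) ^ q ≈ y ^ q - x ^ q
  frobenius x y = begin
    (y - x) ^ q
      ≈⟨ binomial x y q ⟩
    b q 0 * (1# * y ^ q) + ⨁ p (λ k l → b q (suc k) * (x ^ suc k * y ^ l))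
      ≈⟨ +-congˡ (⨁-last e (λ k l → b q (suc k) * (x ^ suc k * y ^ l))) ⟩
    b q 0 * (1# * y ^ q) + (⨁ e (λ k l → b q (suc k) * (x ^ suc k * y ^ suc l)) + b q q * (x ^ q * 1#))
      ≈⟨ +-cong (*-congʳ (b-n-0 q)) (+-cong (⨁-0 e (λ k l k+l≡e → trans (*-congʳ (b-q k
           (ℕ.s≤s (ℕ.m+n≤o⇒m≤o k (ℕ.≤-reflexive k+l≡e))))) (zeroˡ _))) (*-congʳ b-q-q)) ⟩
    1# * (1# * y ^ q) + (0# + - 1# * (x ^ q * 1#))
      ≈⟨ solve 2 (λ x y → con (+ 1) :* (con (+ 1) :* y) :+ (con (+ 0) :+ (:- con (+ 1)) :* (x :* con (+ 1))) := y :- x) refl (x ^ q) (y ^ q) ⟩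
    y ^ q - x ^ q ∎

  [-1]^n : ∀ {n} → p ∣ n → (- 1#) ^ n ≈ 1#
  [-1]^n (divides k ≡.refl) = begin
    (- 1#) ^ (k ℕ.* p)  ≡⟨ ≡.cong ((- 1#) ^_) (ℕ.*-comm k p) ⟩
    (- 1#) ^ (p ℕ.* k)  ≈⟨ ^-assocʳ (- 1#) p k ⟨
    ((- 1#) ^ p) ^ k  ≈⟨ ^-congˡ k (^-congˡ p (trans (-‿homo F.1#) (-‿cong 1-homo))) ⟨
    (⟦ F.- F.1# ⟧ ^ p) ^ k  ≈⟨ ^-congˡ k (^-homo (F.- F.1#) p) ⟨
    ⟦ (F.- F.1#) F.^ p ⟧ ^ k  ≈⟨ ^-congˡ k (trans (⟦⟧-cong FF.[-1]^p≈1) 1-homo) ⟩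
    1# ^ k  ≈⟨ 1^n≈1 k ⟩
    1#  ∎

  even-power : ∀ {n} → p ∣ n → ∀ x → (- x) ^ n ≈ x ^ n
  even-power {n} p∣n x = trans (-x^n x n) (trans (*-congʳ ([-1]^n p∣n)) (*-identityˡ _))

  [-1]^pred : ∀ {n} → p ∣ suc n → (- 1#) ^ n ≈ - 1#
  [-1]^pred {n} p∣1+n = begin
    (- 1#) ^ n  ≈⟨ solve 1 (λ x → x := :- ((:- con (+ 1)) :* x)) refl _ ⟩
    - (- 1#) ^ suc n  ≈⟨ -‿cong ([-1]^n p∣1+n) ⟩
    - 1#  ∎

  -- For odd q the exponent n is odd, because p is even; for even q one has -1 = 1. The relation
  -- (-1)^p = 1 covers both cases at once.
  odd-power : ∀ {n} → p ∣ suc n → ∀ x → (- x) ^ n ≈ - (x ^ n)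
  odd-power {n} p∣1+n x = begin
    (- x) ^ n  ≈⟨ -x^n x n ⟩
    (- 1#) ^ n * x ^ n  ≈⟨ *-congʳ ([-1]^pred p∣1+n) ⟩
    - 1# * x ^ n  ≈⟨ solve 1 (λ x → (:- con (+ 1)) :* x := :- x) refl _ ⟩
    - (x ^ n)  ∎

  ∑F : (F.Carrier → Carrier) → Carrier
  ∑F = total +-commutativeMonoid

  ∑F-neg : ∀ f → ∑F (λ μ → - f μ) ≈ - ∑F f
  ∑F-neg f = begin
    ∑F (λ μ → - f μ)  ≈⟨ total-cong +-commutativeMonoid (λ μ → solve 1 (λ x → :- x := (:- con (+ 1)) :* x) refl (f μ)) ⟩
    ∑F (λ μ → - 1# * f μ)  ≈⟨ *-distribˡ-sum (- 1#) (f ∘ fromFin) ⟨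
    - 1# * ∑F f  ≈⟨ solve 1 (λ x → (:- con (+ 1)) :* x := :- x) refl _ ⟩
    - ∑F f  ∎

  ∑F-⨁ : ∀ n (f : F.Carrier → ℕ → ℕ → Carrier) → ∑F (λ μ → ⨁ n (f μ)) ≈ ⨁ n (λ k l → ∑F (λ μ → f μ k l))
  ∑F-⨁ zero    f = refl
  ∑F-⨁ (suc n) f = trans (Sum.∑-distrib-+ semiring (λ i → f (fromFin i) 0 (suc n)) (λ i → ⨁ n (λ k → f (fromFin i) (suc k))))
    (+-congˡ (∑F-⨁ n (λ μ k → f μ (suc k))))

  sum-homo : ∀ {n} (t : Vector F.Carrier n) → ⟦ Sum.sum F.semiring t ⟧ ≈ sum (λ i → ⟦ t i ⟧)
  sum-homo {zero}  t = 0-homo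
  sum-homo {suc n} t = trans (+-homo _ _) (+-congˡ (sum-homo (t ∘ suc)))

  -- For p ∣ r + 1 this equals ∑ (x + μ y)^r, since r-th powers are then odd.
  Q : ℕ → Carrier → Carrier → Carrier
  Q r y x = - ∑F (λ μ → (⟦ μ ⟧ * y - x) ^ r)

  Q-summand-cong : ∀ r y x {μ ν} → μ F.≈ ν → (⟦ μ ⟧ * y - x) ^ r ≈ (⟦ ν ⟧ * y - x) ^ r
  Q-summand-cong r y x μ≈ν = ^-congˡ r (+-congʳ (*-congʳ (⟦⟧-cong μ≈ν)))

  Q-cong : ∀ r {y y′ x x′} → y ≈ y′ → x ≈ x′ → Q r y x ≈ Q r y′ x′
  Q-cong r y≈y′ x≈x′ = -‿cong (total-cong +-commutativeMonoid
    (λ μ → ^-congˡ r (+-cong (*-congˡ {⟦ μ ⟧} y≈y′) (-‿cong x≈x′))))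

  Q-shift : ∀ r y x → Q r y (x + y) ≈ Q r y x
  Q-shift r y x = -‿cong (sym (trans
    (reindex +-commutativeMonoid (λ μ → (⟦ μ ⟧ * y - x) ^ r) (Q-summand-cong r y x)
      (F._- F.1#) (F._+ F.1#) F.+-congʳ F.+-congʳ
      (λ x → F.solve 1 (λ x → (x F.:+ F.con (+ 1)) F.:- F.con (+ 1) F.:= x) F.refl x)
      (λ x → F.solve 1 (λ x → (x F.:- F.con (+ 1)) F.:+ F.con (+ 1) F.:= x) F.refl x))
    (total-cong +-commutativeMonoid (λ μ → ^-congˡ r (begin
      ⟦ μ F.- F.1# ⟧ * y - x  ≈⟨ +-congʳ (*-congʳ (trans (sub-homo _ _) (+-congˡ (-‿cong 1-homo)))) ⟩
      (⟦ μ ⟧ - 1#) * y - x  ≈⟨ solve 3 (λ m y x → (m :- con (+ 1)) :* y :- x := m :* y :- (x :+ y)) refl _ y x ⟩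
      ⟦ μ ⟧ * y - (x + y)  ∎)))))

  reindex-neg : ∀ r y x → ∑F (λ μ → (⟦ μ ⟧ * y - x) ^ r) ≈ ∑F (λ μ → ((- ⟦ μ ⟧) * y - x) ^ r)
  reindex-neg r y x = trans
    (reindex +-commutativeMonoid (λ μ → (⟦ μ ⟧ * y - x) ^ r) (Q-summand-cong r y x)
      F.-_ F.-_ F.-‿cong F.-‿cong F.-‿involutive F.-‿involutive)
    (total-cong +-commutativeMonoid (λ μ → ^-congˡ r (+-congʳ (*-congʳ (-‿homo μ)))))

  Q-negˡ : ∀ r y x → Q r (- y) x ≈ Q r y x
  Q-negˡ r y x = -‿cong (sym (trans (reindex-neg r y x)
    (total-cong +-commutativeMonoid (λ μ → ^-congˡ r
      (solve 3 (λ m y x → (:- m) :* y :- x := m :* (:- y) :- x) refl ⟦ μ ⟧ y x)))))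

  Q-negʳ : ∀ {r} → p ∣ suc r → ∀ y x → Q r y (- x) ≈ - Q r y x
  Q-negʳ {r} p∣1+r y x = -‿cong (begin
    ∑F (λ μ → (⟦ μ ⟧ * y - - x) ^ r)  ≈⟨ total-cong +-commutativeMonoid (λ μ → ^-congˡ r
                                                      (solve 3 (λ m y x → m :* y :- (:- x) := :- ((:- m) :* y :- x)) refl ⟦ μ ⟧ y x)) ⟩
    ∑F (λ μ → (- ((- ⟦ μ ⟧) * y - x)) ^ r)  ≈⟨ total-cong +-commutativeMonoid (λ μ → odd-power p∣1+r ((- ⟦ μ ⟧) * y - x)) ⟩
    ∑F (λ μ → - (((- ⟦ μ ⟧) * y - x) ^ r))  ≈⟨ ∑F-neg (λ μ → ((- ⟦ μ ⟧) * y - x) ^ r) ⟩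
    - ∑F (λ μ → ((- ⟦ μ ⟧) * y - x) ^ r)  ≈⟨ -‿cong (reindex-neg r y x) ⟨
    - ∑F (λ μ → (⟦ μ ⟧ * y - x) ^ r)  ∎)

  -- Since p divides (k + 1) + l, the condition p ∣ l on the power sum becomes p ∣ k + 1. At l = 0
  -- the power sum is 0 and not -1, which `δ` corrects.
  -powerSum : ∀ {r} → p ∣ suc r → ∀ k l → k ℕ.+ l ≡ r → - ⟦ powerSum l ⟧ ≈ χ p k - δ l
  -powerSum {r} p∣1+r k zero k+l≡r = begin
    - ⟦ powerSum 0 ⟧  ≈⟨ -‿cong (trans (⟦⟧-cong powerSum-0) 0-homo) ⟩
    - 0#  ≈⟨ solve 0 (:- con (+ 0) := con (+ 1) :- con (+ 1)) refl ⟩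
    1# - 1#  ≈⟨ +-congʳ (χ-yes (≡.subst (λ i → p ∣ suc i) (≡.trans (≡.sym k+l≡r) (ℕ.+-identityʳ k)) p∣1+r)) ⟨
    χ p k - 1#  ∎
  -powerSum {r} p∣1+r k (suc l) k+l≡r = begin
    - ⟦ powerSum (suc l) ⟧  ≈⟨ -‿cong (trans (⟦⟧-cong (powerSum-suc l)) (trans (-‿homo _) (-‿cong (χ-homo p l)))) ⟩
    - - χ p l  ≈⟨ -‿involutive _ ⟩
    χ p l  ≈⟨ χ-⇔ (λ p∣l → ℕ.∣m+n∣m⇒∣n (≡.subst (p ∣_) (ℕ.+-comm (suc k) (suc l)) p∣) p∣l)
                                    (λ p∣k → ℕ.∣m+n∣m⇒∣n p∣ p∣k) ⟩
    χ p k  ≈⟨ x-0≈x _ ⟨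
    χ p k - 0#  ∎
    where
    p∣ : p ∣ suc k ℕ.+ suc l
    p∣ = ≡.subst (λ i → p ∣ suc i) (≡.sym k+l≡r) p∣1+r

  -- After expanding the powers, the sum over μ only sees the powers of μ and produces power sums.
  -- The exception at l = 0 yields the separate `x ^ r`, its sign coming from (-1)^r = -1.
  Q-expand : ∀ {r} → p ∣ suc r → ∀ y x →
    Q r y x ≈ ⨁ r (λ k l → χ p k * b r k * x ^ k * y ^ l) + x ^ r
  Q-expand {r} p∣1+r y x = begin
    - ∑F (λ μ → (⟦ μ ⟧ * y - x) ^ r)
      ≈⟨ -‿cong (total-cong +-commutativeMonoid (λ μ → trans (binomial x (⟦ μ ⟧ * y) r) (⨁-cong r (λ k l _ → rearrange μ k l)))) ⟩
    - ∑F (λ μ → ⨁ r (λ k l → b r k * x ^ k * y ^ l * ⟦ μ F.^ l ⟧))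
      ≈⟨ -‿cong (∑F-⨁ r (λ μ k l → b r k * x ^ k * y ^ l * ⟦ μ F.^ l ⟧)) ⟩
    - ⨁ r (λ k l → ∑F (λ μ → b r k * x ^ k * y ^ l * ⟦ μ F.^ l ⟧))
      ≈⟨ -‿cong (⨁-cong r (λ k l _ → trans (sym (*-distribˡ-sum (b r k * x ^ k * y ^ l) (λ i → ⟦ fromFin i F.^ l ⟧)))
           (*-congˡ (sym (sum-homo (λ i → fromFin i F.^ l)))))) ⟩
    - ⨁ r (λ k l → b r k * x ^ k * y ^ l * ⟦ powerSum l ⟧)
      ≈⟨ trans (solve 1 (λ x → :- x := (:- con (+ 1)) :* x) refl _) (⨁-*ˡ r (- 1#) _) ⟩
    ⨁ r (λ k l → - 1# * (b r k * x ^ k * y ^ l * ⟦ powerSum l ⟧))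
      ≈⟨ ⨁-cong r (λ k l k+l≡r → trans (solve 2 (λ x s → (:- con (+ 1)) :* (x :* s) := x :* (:- s)) refl _ _)
           (trans (*-congˡ (-powerSum p∣1+r k l k+l≡r))
             (solve 5 (λ b x y c d → b :* x :* y :* (c :- d) := c :* b :* x :* y :+ d :* ((:- con (+ 1)) :* (b :* x :* y))) refl
               (b r k) (x ^ k) (y ^ l) (χ p k) (δ l)))) ⟩
    ⨁ r (λ k l → χ p k * b r k * x ^ k * y ^ l + δ l * (- 1# * (b r k * x ^ k * y ^ l)))
      ≈⟨ ⨁-+ r _ _ ⟩
    ⨁ r (λ k l → χ p k * b r k * x ^ k * y ^ l) + ⨁ r (λ k l → δ l * (- 1# * (b r k * x ^ k * y ^ l)))
      ≈⟨ +-congˡ (⨁-δʳ r (λ k l → - 1# * (b r k * x ^ k * y ^ l))) ⟩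
    ⨁ r (λ k l → χ p k * b r k * x ^ k * y ^ l) + - 1# * (b r r * x ^ r * 1#)
      ≈⟨ +-congˡ (trans (*-congˡ (*-congʳ (*-congʳ (trans (b-n-n r) ([-1]^pred p∣1+r)))))
           (solve 1 (λ x → (:- con (+ 1)) :* ((:- con (+ 1)) :* x :* con (+ 1)) := x) refl _)) ⟩
    ⨁ r (λ k l → χ p k * b r k * x ^ k * y ^ l) + x ^ r ∎
    where
    rearrange : ∀ μ k l → b r k * (x ^ k * (⟦ μ ⟧ * y) ^ l) ≈ b r k * x ^ k * y ^ l * ⟦ μ F.^ l ⟧
    rearrange μ k l = trans (*-congˡ (*-congˡ (trans (^-distrib-* _ y l) (*-congʳ (sym (^-homo μ l))))))
      (solve 4 (λ b x m y → b :* (x :* (m :* y)) := b :* x :* y :* m) refl _ _ _ _)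

  module _ (κ r : ℕ) where

    -- The coefficient of ⟨κ⟩⟨r⟩ in M(x) ⧢ M(y).
    J : Carrier → Carrier → Carrier
    J x y = χ p r * χ p κ * (x ^ r * y ^ κ + x ^ κ * y ^ r)
      + ⨁ (κ ℕ.+ r) (λ k l → χ p k * χ p l * χ p r * (b r l + b r k) * (x ^ k * y ^ l))

  χχ≈0 : ∀ {k l} → ¬ (p ∣ suc k × p ∣ suc l) → χ p k * χ p l ≈ 0#
  χχ≈0 {k} {l} ¬both with p ∣? suc k
  ... | no  _   = zeroˡ _
  ... | yes p∣k with p ∣? suc l
  ...   | no  _   = zeroʳ _
  ...   | yes p∣l = ⊥-elim (¬both (p∣k , p∣l))

  χχ≈χ : ∀ {k l} → p ∣ suc k ℕ.+ suc l → χ p k * χ p l ≈ χ p k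
  χχ≈χ {k} {l} p∣ with p ∣? suc k
  ... | no  _   = zeroˡ _
  ... | yes p∣k = trans (*-congˡ (χ-yes (ℕ.∣m+n∣m⇒∣n p∣ p∣k))) (*-identityʳ 1#)

  ⨁-truncate : ∀ κ r (f : ℕ → Carrier) y → (∀ k → r ℕ.< k → f k ≈ 0#) →
    ⨁ (κ ℕ.+ r) (λ k l → f k * y ^ l) ≈ y ^ κ * ⨁ r (λ k l → f k * y ^ l)
  ⨁-truncate zero    r f y f≈0 = sym (*-identityˡ _)
  ⨁-truncate (suc κ) r f y f≈0 = begin
    ⨁ (suc (κ ℕ.+ r)) (λ k l → f k * y ^ l)
      ≈⟨ ⨁-last (κ ℕ.+ r) (λ k l → f k * y ^ l) ⟩
    ⨁ (κ ℕ.+ r) (λ k l → f k * y ^ suc l) + f (suc (κ ℕ.+ r)) * 1#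
      ≈⟨ +-cong (⨁-cong (κ ℕ.+ r) (λ k l _ → solve 3 (λ f y z → f :* (y :* z) := y :* (f :* z)) refl (f k) y (y ^ l)))
                (trans (*-congʳ (f≈0 _ (ℕ.s≤s (ℕ.m≤n+m r κ)))) (zeroˡ _)) ⟩
    ⨁ (κ ℕ.+ r) (λ k l → y * (f k * y ^ l)) + 0#
      ≈⟨ trans (+-identityʳ _) (sym (⨁-*ˡ (κ ℕ.+ r) y _)) ⟩
    y * ⨁ (κ ℕ.+ r) (λ k l → f k * y ^ l)
      ≈⟨ *-congˡ (⨁-truncate κ r f y f≈0) ⟩
    y * (y ^ κ * ⨁ r (λ k l → f k * y ^ l))
      ≈⟨ *-assoc _ _ _ ⟨
    y ^ suc κ * ⨁ r (λ k l → f k * y ^ l) ∎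

  module _ {κ r : ℕ} where

    -- A nonzero term of the sum needs k + 1, l + 1 and r + 1 divisible by p; then so is κ + 1,
    -- because (k + 1) + (l + 1) = (r + 1) + (κ + 1).
    J-vanish : ¬ (p ∣ suc r × p ∣ suc κ) → ∀ x y → J κ r x y ≈ 0#
    J-vanish ¬both x y = trans (+-cong (trans (*-congʳ (χχ≈0 ¬both)) (zeroˡ _))
        (⨁-0 (κ ℕ.+ r) term≈0)) (+-identityˡ 0#)
      where
      term≈0 : ∀ k l → k ℕ.+ l ≡ κ ℕ.+ r → χ p k * χ p l * χ p r * (b r l + b r k) * (x ^ k * y ^ l) ≈ 0#
      term≈0 k l eq with p ∣? suc r
      ... | no  _   = trans (*-congʳ (trans (*-congʳ (zeroʳ _)) (zeroˡ _))) (zeroˡ _)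
      ... | yes p∣r = trans (*-congʳ (trans (*-congʳ (trans (*-congʳ (χχ≈0 impossible)) (zeroˡ _))) (zeroˡ _))) (zeroˡ _)
        where
        impossible : ¬ (p ∣ suc k × p ∣ suc l)
        impossible (p∣k , p∣l) = ¬both (p∣r , ℕ.∣m+n∣m⇒∣n (≡.subst (p ∣_) sums (ℕ.∣m∣n⇒∣m+n p∣k p∣l)) p∣r)
          where
          sums : suc k ℕ.+ suc l ≡ suc r ℕ.+ suc κ
          sums = ≡.trans (≡.cong suc (≡.trans (ℕ.+-suc k l) (≡.cong suc (≡.trans eq (ℕ.+-comm κ r)))))
                         (≡.cong suc (≡.sym (ℕ.+-suc r κ)))

    -- The two halves of `b r l + b r k` separate. The half with `b r k` stops at k = r, so y^κ
    -- factors out and leaves the sum of `Q-expand`; the other half is its mirror image. The terms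
    -- outside the sum provide the extra x^r and y^r.
    J-formula : p ∣ suc r → p ∣ suc κ → ∀ x y → J κ r x y ≈ y ^ κ * Q r y x + x ^ κ * Q r x y
    J-formula p∣r p∣κ x y = begin
      J κ r x y
        ≈⟨ +-cong (*-congʳ (*-cong (χ-yes p∣r) (χ-yes p∣κ))) (⨁-cong (κ ℕ.+ r) split) ⟩
      1# * 1# * (x ^ r * y ^ κ + x ^ κ * y ^ r) + ⨁ (κ ℕ.+ r) (λ k l → f x k * y ^ l + f y l * x ^ k)
        ≈⟨ +-congˡ (trans (⨁-+ (κ ℕ.+ r) _ _) (+-congˡ (⨁-swap (κ ℕ.+ r) _))) ⟩
      1# * 1# * (x ^ r * y ^ κ + x ^ κ * y ^ r)
        + (⨁ (κ ℕ.+ r) (λ k l → f x k * y ^ l) + ⨁ (κ ℕ.+ r) (λ k l → f y k * x ^ l))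
        ≈⟨ +-congˡ (+-cong (⨁-truncate κ r (f x) y (f-vanish x)) (⨁-truncate κ r (f y) x (f-vanish y))) ⟩
      1# * 1# * (x ^ r * y ^ κ + x ^ κ * y ^ r)
        + (y ^ κ * ⨁ r (λ k l → f x k * y ^ l) + x ^ κ * ⨁ r (λ k l → f y k * x ^ l))
        ≈⟨ solve 6 (λ xr yr xκ yκ a b → con (+ 1) :* con (+ 1) :* (xr :* yκ :+ xκ :* yr) :+ (yκ :* a :+ xκ :* b)
             := yκ :* (a :+ xr) :+ xκ :* (b :+ yr)) refl (x ^ r) (y ^ r) (x ^ κ) (y ^ κ) _ _ ⟩
      y ^ κ * (⨁ r (λ k l → f x k * y ^ l) + x ^ r) + x ^ κ * (⨁ r (λ k l → f y k * x ^ l) + y ^ r)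
        ≈⟨ +-cong (*-congˡ (Q-expand p∣r y x)) (*-congˡ (Q-expand p∣r x y)) ⟨
      y ^ κ * Q r y x + x ^ κ * Q r x y ∎
      where
      f : Carrier → ℕ → Carrier
      f z k = χ p k * b r k * z ^ k

      f-vanish : ∀ z k → r ℕ.< k → f z k ≈ 0#
      f-vanish z k r<k = trans (*-congʳ (trans (*-congˡ (b-vanish r<k)) (zeroʳ _))) (zeroˡ _)

      split : ∀ k l → k ℕ.+ l ≡ κ ℕ.+ r →
        χ p k * χ p l * χ p r * (b r l + b r k) * (x ^ k * y ^ l) ≈ f x k * y ^ l + f y l * x ^ k
      split k l eq = begin
        χ p k * χ p l * χ p r * (b r l + b r k) * (x ^ k * y ^ l)
          ≈⟨ *-congʳ (*-congʳ (trans (*-congˡ (χ-yes p∣r)) (*-identityʳ _))) ⟩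
        χ p k * χ p l * (b r l + b r k) * (x ^ k * y ^ l)
          ≈⟨ solve 6 (λ a c d e x y → a :* c :* (d :+ e) :* (x :* y) := a :* c :* e :* x :* y :+ c :* a :* d :* y :* x)
               refl (χ p k) (χ p l) (b r l) (b r k) (x ^ k) (y ^ l) ⟩
        χ p k * χ p l * b r k * x ^ k * y ^ l + χ p l * χ p k * b r l * y ^ l * x ^ k
          ≈⟨ +-cong (*-congʳ (*-congʳ (*-congʳ (χχ≈χ p∣kl))))
                    (*-congʳ (*-congʳ (*-congʳ (χχ≈χ (≡.subst (p ∣_) (ℕ.+-comm (suc k) (suc l)) p∣kl))))) ⟩
        f x k * y ^ l + f y l * x ^ k ∎
        where
        p∣kl : p ∣ suc k ℕ.+ suc l
        p∣kl = ≡.subst (p ∣_) (≡.sym (≡.cong suc (≡.trans (ℕ.+-suc k l) (≡.trans (≡.cong suc eq) (≡.sym (ℕ.+-suc κ r))))))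
          (ℕ.∣m∣n⇒∣m+n p∣κ p∣r)

  J-cong : ∀ κ r {x x′ y y′} → x ≈ x′ → y ≈ y′ → J κ r x y ≈ J κ r x′ y′
  J-cong κ r x≈ y≈ = +-cong
    (*-congˡ (+-cong (*-cong (^-congˡ r x≈) (^-congˡ κ y≈)) (*-cong (^-congˡ κ x≈) (^-congˡ r y≈))))
    (⨁-cong (κ ℕ.+ r) (λ k l _ → *-congˡ (*-cong (^-congˡ k x≈) (^-congˡ l y≈))))

  module _ (κ r : ℕ) where

    divisible? : Dec (p ∣ suc r × p ∣ suc κ)
    divisible? = (p ∣? suc r) ×-dec (p ∣? suc κ)

    J-comm : ∀ x y → J κ r x y ≈ J κ r y x
    J-comm x y with divisible?
    ... | no ¬d = trans (J-vanish ¬d x y) (sym (J-vanish ¬d y x))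
    ... | yes (p∣r , p∣κ) = trans (J-formula p∣r p∣κ x y) (trans (+-comm _ _) (sym (J-formula p∣r p∣κ y x)))

    J-neg : ∀ x y → J κ r x (- y) ≈ - J κ r x y
    J-neg x y with divisible?
    ... | no ¬d = trans (J-vanish ¬d x (- y)) (trans (sym -0#≈0#) (-‿cong (sym (J-vanish ¬d x y))))
    ... | yes (p∣r , p∣κ) = begin
      J κ r x (- y)
        ≈⟨ J-formula p∣r p∣κ x (- y) ⟩
      (- y) ^ κ * Q r (- y) x + x ^ κ * Q r x (- y)
        ≈⟨ +-cong (*-cong (odd-power p∣κ y) (Q-negˡ r y x)) (*-congˡ (Q-negʳ p∣r x y)) ⟩
      (- (y ^ κ)) * Q r y x + x ^ κ * (- Q r x y)
        ≈⟨ solve 4 (λ a b c d → (:- a) :* b :+ c :* (:- d) := :- (a :* b :+ c :* d)) refl _ _ _ _ ⟩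
      - (y ^ κ * Q r y x + x ^ κ * Q r x y)
        ≈⟨ -‿cong (J-formula p∣r p∣κ x y) ⟨
      - J κ r x y ∎

    -- The depth-two case of M(x) ⧢ M(y) = M(x + y) ⧢ (M(x) + M(y)). The terms with (x + y)^κ
    -- cancel, since x and -y differ by x + y and `Q` is odd in its last argument; `Q-shift` reduces
    -- the other two.
    J-add : ∀ x y → J κ r x (x + y) + J κ r y (x + y) ≈ J κ r x y
    J-add x y with divisible?
    ... | no ¬d = trans (+-cong (J-vanish ¬d x (x + y)) (J-vanish ¬d y (x + y)))
                        (trans (+-identityˡ 0#) (sym (J-vanish ¬d x y)))
    ... | yes (p∣r , p∣κ) = begin
      J κ r x (x + y) + J κ r y (x + y)
        ≈⟨ +-cong (J-formula p∣r p∣κ x (x + y)) (J-formula p∣r p∣κ y (x + y)) ⟩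
      (x + y) ^ κ * Q r (x + y) x + x ^ κ * Q r x (x + y) + ((x + y) ^ κ * Q r (x + y) y + y ^ κ * Q r y (x + y))
        ≈⟨ +-cong (+-cong (*-congˡ opposite) (*-congˡ (trans (Q-cong r refl (+-comm x y)) (Q-shift r x y))))
                  (+-congˡ (*-congˡ (Q-shift r y x))) ⟩
      (x + y) ^ κ * (- Q r (x + y) y) + x ^ κ * Q r x y + ((x + y) ^ κ * Q r (x + y) y + y ^ κ * Q r y x)
        ≈⟨ solve 4 (λ a b c d → a :* (:- b) :+ c :+ (a :* b :+ d) := d :+ c) refl _ _ _ _ ⟩
      y ^ κ * Q r y x + x ^ κ * Q r x y
        ≈⟨ J-formula p∣r p∣κ x y ⟨
      J κ r x y ∎
      where
      opposite : Q r (x + y) x ≈ - Q r (x + y) y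
      opposite = begin
        Q r (x + y) x  ≈⟨ Q-cong r refl (solve 2 (λ x y → x := (:- y) :+ (x :+ y)) refl x y) ⟩
        Q r (x + y) (- y + (x + y)) ≈⟨ Q-shift r (x + y) (- y) ⟩
        Q r (x + y) (- y)  ≈⟨ Q-negʳ p∣r (x + y) y ⟩
        - Q r (x + y) y  ∎

-- Symmetry of (⟨i⟩ ◇ ⟨j⟩) ◇ ⟨m⟩ for letters

module Regularity {c ℓ : Level} (R : CommutativeRing c ℓ) where
  open RingTools R

  regular-≈ : ∀ {x y} → x ≈ y → Regular x → Regular y
  regular-≈ x≈y x-reg z yz≈0 = x-reg z (trans (*-congʳ x≈y) yz≈0)

  regular-* : ∀ {x y} → Regular x → Regular y → Regular (x * y)
  regular-* x-reg y-reg z xyz≈0 = y-reg z (x-reg _ (trans (sym (*-assoc _ _ _)) xyz≈0))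

  regular-^ : ∀ {x} n → Regular x → Regular (x ^ n)
  regular-^ zero    x-reg z 1z≈0 = trans (sym (*-identityˡ z)) 1z≈0
  regular-^ (suc n) x-reg = regular-* x-reg (regular-^ n x-reg)

  regular-neg : ∀ {x} → Regular x → Regular (- x)
  regular-neg {x} x-reg z -xz≈0 = x-reg z (begin
    x * z  ≈⟨ solve 2 (λ x z → x :* z := :- ((:- x) :* z)) refl x z ⟩
    - ((- x) * z)  ≈⟨ -‿cong -xz≈0 ⟩
    - 0#  ≈⟨ -0#≈0# ⟩
    0#  ∎)

module _ {c ℓ : Level} (R : CommutativeRing c ℓ) where
  open RingTools R

  -- The hypotheses say u = b / (1 - b) and v = a / (1 - a) without using inverses.
  geometric : ∀ {a b u v} → u ≈ b * (1# + u) → v ≈ a * (1# + v) → b * (u * v) - a * (u * v) ≈ a * u - b * v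
  geometric {a} {b} {u} {v} u≈ v≈ = begin
    b * (u * v) - a * (u * v)
      ≈⟨ solve 4 (λ b a u v → b :* (u :* v) :- a :* (u :* v) :=
           (b :* (con (+ 1) :+ u)) :* v :- u :* (a :* (con (+ 1) :+ v)) :+ (a :* u :- b :* v)) refl b a u v ⟩
    (b * (1# + u)) * v - u * (a * (1# + v)) + (a * u - b * v)
      ≈⟨ +-congʳ (+-cong (*-congʳ u≈) (-‿cong (*-congˡ v≈))) ⟨
    u * v - u * v + (a * u - b * v)
      ≈⟨ solve 2 (λ w r → w :- w :+ r := r) refl (u * v) _ ⟩
    a * u - b * v ∎

-- The telescoping sum of depth one

module Telescope {c ℓ : Level} (R : CommutativeRing c ℓ) (e : ℕ) where
  open RingTools R
  open PowerSeries R using (X; const; const-⊛; X-⊛-suc; X-⊛-zero)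
  private module Z = RingTools (series R)

  p : ℕ
  p = suc e

  -- The contribution of letter-by-letter ◇ to the coefficient of ⟨m⟩ in M(x) ⧢ M(y); the full coefficient
  -- also has the terms xᵐ/y and yᵐ/x.
  H : ℕ → Carrier → Carrier → Carrier
  H zero    x y = 0#
  H (suc m) x y = ⨁ m (λ k l → χ p k * χ p l * (x ^ k * y ^ l))

  X^k-low : ∀ k f n → n ℕ.< k → (X Z.^ k Z.* f) n ≈ 0#
  X^k-low (suc k) f zero    _ = trans (Z.*-assoc X (X Z.^ k) f 0) (X-⊛-zero (X Z.^ k Z.* f))
  X^k-low (suc k) f (suc n) (ℕ.s≤s n<k) = trans (Z.*-assoc X (X Z.^ k) f (suc n))
    (trans (X-⊛-suc (X Z.^ k Z.* f) n) (X^k-low k f n n<k))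

  X^k-high : ∀ k f n → (X Z.^ k Z.* f) (k ℕ.+ n) ≈ f n
  X^k-high zero    f n = Z.*-identityˡ f n
  X^k-high (suc k) f n = trans (Z.*-assoc X (X Z.^ k) f (suc k ℕ.+ n))
    (trans (X-⊛-suc (X Z.^ k Z.* f) (k ℕ.+ n)) (X^k-high k f n))

  -- The geometric series z / (1 - z) with z = x^p X^p.
  U : Carrier → ℕ → Carrier
  U x zero    = 0#
  U x (suc j) = χ p j * x ^ suc j

  monomial : Carrier → Z.Carrier
  monomial x = const x Z.* X Z.^ p

  monomial-low : ∀ x f n → n ℕ.< p → (monomial x Z.* f) n ≈ 0#
  monomial-low x f n n<p = trans (Z.*-assoc (const x) (X Z.^ p) f n)
    (trans (const-⊛ x (X Z.^ p Z.* f) n) (trans (*-congˡ (X^k-low p f n n<p)) (zeroʳ x)))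

  monomial-high : ∀ x f n → (monomial x Z.* f) (p ℕ.+ n) ≈ x * f n
  monomial-high x f n = trans (Z.*-assoc (const x) (X Z.^ p) f (p ℕ.+ n))
    (trans (const-⊛ x (X Z.^ p Z.* f) (p ℕ.+ n)) (*-congˡ (X^k-high p f n)))

  U-equation : ∀ x → U x Z.≈ monomial (x ^ p) Z.* (Z.1# Z.+ U x)
  U-equation x n with n ℕ.<? p
  ... | yes n<p = trans (low n n<p) (sym (monomial-low (x ^ p) (Z.1# Z.+ U x) n n<p))
    where
    low : ∀ n → n ℕ.< p → U x n ≈ 0#
    low zero    _   = refl
    low (suc j) j<p = trans (*-congʳ (χ-no (λ p∣j → ℕ.<⇒≱ j<p (ℕ.∣⇒≤ p∣j)))) (zeroˡ _)
  ... | no n≮p with ℕ.m≤n⇒∃[o]m+o≡n (ℕ.≮⇒≥ n≮p)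
  ...   | zero , ≡.refl = begin
    U x (p ℕ.+ 0)  ≡⟨ ≡.cong (U x) (ℕ.+-identityʳ p) ⟩
    χ p e * x ^ p  ≈⟨ *-congʳ (χ-yes {p} {e} ℕ.∣-refl) ⟩
    1# * x ^ p  ≈⟨ solve 1 (λ x → con (+ 1) :* x := x :* (con (+ 1) :+ con (+ 0))) refl (x ^ p) ⟩
    x ^ p * (1# + 0#)  ≈⟨ monomial-high (x ^ p) (Z.1# Z.+ U x) 0 ⟨
    (monomial (x ^ p) Z.* (Z.1# Z.+ U x)) (p ℕ.+ 0)  ∎
  ...   | suc j , ≡.refl = begin
    U x (p ℕ.+ suc j)  ≡⟨ ≡.cong (U x) (ℕ.+-suc p j) ⟩
    χ p (p ℕ.+ j) * x ^ suc (p ℕ.+ j)  ≈⟨ *-cong (χ-+ p j) (trans (reflexive (≡.cong (x ^_) (≡.sym (ℕ.+-suc p j)))) (^-homo-* x p (suc j))) ⟩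
    χ p j * (x ^ p * x ^ suc j)  ≈⟨ solve 3 (λ c x y → c :* (x :* y) := x :* (con (+ 0) :+ c :* y)) refl _ (x ^ p) (x ^ suc j) ⟩
    x ^ p * (0# + χ p j * x ^ suc j)  ≈⟨ monomial-high (x ^ p) (Z.1# Z.+ U x) (suc j) ⟨
    (monomial (x ^ p) Z.* (Z.1# Z.+ U x)) (p ℕ.+ suc j) ∎

  -- Exponents in `U` are one higher than in `H`, whence the factor x * y and the degree m + 1.
  UU-coefficient : ∀ x y m → (U x Z.* U y) (suc m) ≈ x * y * H m x y
  UU-coefficient x y zero = solve 4 (λ a b x y → con (+ 0) :* b :+ a :* con (+ 0) := x :* y :* con (+ 0)) refl _ _ x y
  UU-coefficient x y (suc m) = begin
    0# * U y (suc (suc m)) + ⨁ (suc m) (λ k l → U x (suc k) * U y l)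
      ≈⟨ +-congˡ (⨁-last m (λ k l → U x (suc k) * U y l)) ⟩
    0# * U y (suc (suc m)) + (⨁ m (λ k l → U x (suc k) * U y (suc l)) + U x (suc (suc m)) * 0#)
      ≈⟨ solve 3 (λ a b c → con (+ 0) :* a :+ (b :+ c :* con (+ 0)) := b) refl _ _ _ ⟩
    ⨁ m (λ k l → U x (suc k) * U y (suc l))
      ≈⟨ ⨁-cong m (λ k l _ → solve 6 (λ c d x y u v → c :* (x :* u) :* (d :* (y :* v)) := x :* y :* (c :* d :* (u :* v)))
           refl (χ p k) (χ p l) x y (x ^ k) (y ^ l)) ⟩
    ⨁ m (λ k l → x * y * (χ p k * χ p l * (x ^ k * y ^ l)))
      ≈⟨ ⨁-*ˡ m (x * y) _ ⟨
    x * y * H (suc m) x y ∎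

  -- This is `geometric` for `U x` and `U y`, read off in degree p + m + 1, where each `monomial`
  -- factor uses up p degrees.
  telescope : ∀ {m} → p ∣ suc m → ∀ x y →
    x * y * (x ^ p - y ^ p) * H m x y ≈ x ^ suc m * y ^ p - y ^ suc m * x ^ p
  telescope {m} p∣ x y = begin
    x * y * (x ^ p - y ^ p) * H m x y
      ≈⟨ solve 5 (λ x y u v h → x :* y :* (u :- v) :* h := u :* (x :* y :* h) :- v :* (x :* y :* h)) refl x y (x ^ p) (y ^ p) _ ⟩
    x ^ p * (x * y * H m x y) - y ^ p * (x * y * H m x y)
      ≈⟨ +-cong (*-congˡ (UU-coefficient x y m)) (-‿cong (*-congˡ (UU-coefficient x y m))) ⟨
    x ^ p * UV (suc m) - y ^ p * UV (suc m)
      ≈⟨ +-cong (monomial-high (x ^ p) UV (suc m)) (-‿cong (monomial-high (y ^ p) UV (suc m))) ⟨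
    (mx Z.* UV Z.- my Z.* UV) (p ℕ.+ suc m)
      ≈⟨ identity (p ℕ.+ suc m) ⟩
    (my Z.* U x Z.- mx Z.* U y) (p ℕ.+ suc m)
      ≈⟨ +-cong (monomial-high (y ^ p) (U x) (suc m)) (-‿cong (monomial-high (x ^ p) (U y) (suc m))) ⟩
    y ^ p * (χ p m * x ^ suc m) - x ^ p * (χ p m * y ^ suc m)
      ≈⟨ +-cong (*-congˡ (*-congʳ (χ-yes p∣))) (-‿cong (*-congˡ (*-congʳ (χ-yes p∣)))) ⟩
    y ^ p * (1# * x ^ suc m) - x ^ p * (1# * y ^ suc m)
      ≈⟨ solve 4 (λ a b c d → a :* (con (+ 1) :* b) :- c :* (con (+ 1) :* d) := b :* a :- d :* c) refl _ _ _ _ ⟩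
    x ^ suc m * y ^ p - y ^ suc m * x ^ p ∎
    where
    UV = U x Z.* U y
    mx = monomial (x ^ p)
    my = monomial (y ^ p)

    identity : mx Z.* UV Z.- my Z.* UV Z.≈ my Z.* U x Z.- mx Z.* U y
    identity = geometric (series R) (U-equation x) (U-equation y)

_∘ₕ_ : ∀ {c₁ ℓ₁ c₂ ℓ₂ c₃ ℓ₃ : Level} {R : CommutativeRing c₁ ℓ₁} {S : CommutativeRing c₂ ℓ₂} {T : CommutativeRing c₃ ℓ₃} →
  Hom S T → Hom R S → Hom R T
_∘ₕ_ {T = T} g f = record
  { ⟦_⟧ = G.⟦_⟧ ∘ F.⟦_⟧
  ; ⟦⟧-cong = G.⟦⟧-cong ∘ F.⟦⟧-cong
  ; +-homo = λ x y → T.trans (G.⟦⟧-cong (F.+-homo x y)) (G.+-homo _ _)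
  ; *-homo = λ x y → T.trans (G.⟦⟧-cong (F.*-homo x y)) (G.*-homo _ _)
  ; 1-homo = T.trans (G.⟦⟧-cong F.1-homo) G.1-homo
  }
  where
  module F = Hom f
  module G = Hom g
  module T = CommutativeRing T

-- Series in three variables and the exchange of t and u

module ThreeVariables {c ℓ : Level} (F : CommutativeRing c ℓ) where

  R₁ R₂ R₃ : CommutativeRing c ℓ
  R₁ = series F
  R₂ = series R₁
  R₃ = series R₂

  private
    module F = RingTools F
    module R₁ = RingTools R₁
    module R₂ = RingTools R₂
    module P₀ = PowerSeries F
    module P₁ = PowerSeries R₁
    module P₂ = PowerSeries R₂
    module V₂ = TwoVariables F
    module V₃ = TwoVariables R₁
  open RingTools R₃

  ιHom : Hom F R₃
  ιHom = P₂.constHom ∘ₕ (P₁.constHom ∘ₕ P₀.constHom)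

  ι : F.Carrier → Carrier
  ι = Hom.⟦_⟧ ιHom

  ι-* : ∀ x f i j k → (ι x * f) i j k F.≈ x F.* f i j k
  ι-* x f i j k = F.trans (P₂.const-⊛ (P₁.const (P₀.const x)) f i j k)
    (F.trans (P₁.const-⊛ (P₀.const x) (f i) j k) (P₀.const-⊛ x (f i j) k))

  -- The outer variable of R₂ is renamed to t or to s; the inner one is u.
  intoT intoS : Hom R₂ R₃
  intoT = P₂.constHom
  intoS = mapHom P₁.constHom

  -- In `f i j m` the exponents of s, t, u are i, j, m, one variable for each of the letters ⟨i⟩,
  -- ⟨j⟩, ⟨m⟩.
  s t u : Carrier
  s = V₃.s
  t = V₃.t
  u = P₂.const V₂.t

  α β γ : Carrier
  α = u - t
  β = t - s
  γ = u - s

  α+β≈γ : α + β ≈ γ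
  α+β≈γ = solve 3 (λ s t u → (u :- t) :+ (t :- s) := u :- s) (λ _ _ _ → F.refl) s t u

  at-s at-t at-u : P₀.Series → Carrier
  at-s G = V₃.inS (V₂.inS G)
  at-t G = V₃.inT (V₂.inS G)
  at-u G = V₃.inT (V₂.inT G)

  intoS-s : Hom.⟦_⟧ intoS V₂.s ≈ s
  intoS-s zero          = Hom.0-homo P₁.constHom
  intoS-s (suc zero)    = R₂.refl
  intoS-s (suc (suc n)) = Hom.0-homo P₁.constHom

  intoS-const : ∀ x → Hom.⟦_⟧ intoS (P₁.const x) ≈ P₂.const (P₁.const x)
  intoS-const x zero    = R₂.refl
  intoS-const x (suc n) = Hom.0-homo P₁.constHom

  -- Exchanges t and u, that is, the two inner indices.
  σHom : Hom R₃ R₃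
  σHom = mapHom V₂.swapHom

  σ : Carrier → Carrier
  σ = Hom.⟦_⟧ σHom

  σ-const : ∀ {f g} → V₂.swap f R₂.≈ g → σ (P₂.const f) ≈ P₂.const g
  σ-const eq zero    = eq
  σ-const eq (suc n) = R₂.refl

  σ-s : σ s ≈ s
  σ-s zero          = R₂.refl
  σ-s (suc zero)    = Hom.1-homo V₂.swapHom
  σ-s (suc (suc n)) = R₂.refl

  σ-t : σ t ≈ u
  σ-t = σ-const V₂.swap-s

  σ-u : σ u ≈ t
  σ-u = σ-const (λ m n → F.sym (V₂.swap-s n m))

  σ-at-s : ∀ G → σ (at-s G) ≈ at-s G
  σ-at-s G n zero    zero    = F.refl
  σ-at-s G n zero    (suc k) = F.refl
  σ-at-s G n (suc j) zero    = F.refl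
  σ-at-s G n (suc j) (suc k) = F.refl

  σ-at-t : ∀ G → σ (at-t G) ≈ at-u G
  σ-at-t G = σ-const (λ m n → F.sym (V₂.swap-inT G n m))

  σ-at-u : ∀ G → σ (at-u G) ≈ at-t G
  σ-at-u G = σ-const (V₂.swap-inT G)

  σ-sub : ∀ {x y x′ y′} → σ x ≈ x′ → σ y ≈ y′ → σ (x - y) ≈ x′ - y′
  σ-sub {x} {y} σx σy = trans (Hom.sub-homo σHom x y) (+-cong σx (-‿cong σy))

  σ-α : σ α ≈ - α
  σ-α = trans (σ-sub {u} {t} σ-u σ-t) (solve 2 (λ t u → t :- u := :- (u :- t)) (λ _ _ _ → F.refl) t u)

  σ-β : σ β ≈ γ
  σ-β = σ-sub {t} {s} σ-t σ-s

  σ-γ : σ γ ≈ β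
  σ-γ = σ-sub {u} {s} σ-u σ-s

  -- g l has the coefficients (b l i + b l k) G (i + k - l).
  g : P₀.Series → ℕ → R₂.Carrier
  g G l = (V₂.t R₂.- V₂.s) R₂.^ l R₂.* V₂.inT G R₂.+ (V₂.s R₂.- V₂.t) R₂.^ l R₂.* V₂.inS G

  g-coefficient : ∀ G l i k → g G l i k F.≈ (F.b l i F.+ F.b l k) F.* V₂.shiftBy l G (i ℕ.+ k)
  g-coefficient G l i k = F.trans (F.+-cong (V₂.[t-s]^k*inT l G i k) (V₂.[s-t]^k*inS l G i k))
    (F.sym (F.distribʳ _ _ _))

  intoT-g : ∀ G l → V₃.inT (g G l) ≈ α ^ l * at-u G + (- α) ^ l * at-t G
  intoT-g G l = begin
    V₃.inT (g G l)
      ≈⟨ h.+-homo ((V₂.t R₂.- V₂.s) R₂.^ l R₂.* V₂.inT G) _ ⟩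
    V₃.inT ((V₂.t R₂.- V₂.s) R₂.^ l R₂.* V₂.inT G) + V₃.inT ((V₂.s R₂.- V₂.t) R₂.^ l R₂.* V₂.inS G)
      ≈⟨ +-cong (h.*-homo ((V₂.t R₂.- V₂.s) R₂.^ l) _) (h.*-homo ((V₂.s R₂.- V₂.t) R₂.^ l) _) ⟩
    V₃.inT ((V₂.t R₂.- V₂.s) R₂.^ l) * at-u G + V₃.inT ((V₂.s R₂.- V₂.t) R₂.^ l) * at-t G
      ≈⟨ +-cong (*-congʳ {at-u G} (trans (h.^-homo _ l) (^-congˡ l (h.sub-homo V₂.t V₂.s))))
                (*-congʳ {at-t G} (trans (h.^-homo _ l) (^-congˡ l (trans (h.sub-homo V₂.s V₂.t)
                  (solve 2 (λ t u → t :- u := :- (u :- t)) (λ _ _ _ → F.refl) t u))))) ⟩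
    α ^ l * at-u G + (- α) ^ l * at-t G ∎
    where module h = Hom intoT

  intoS-g : ∀ G l → V₃.inS (g G l) ≈ γ ^ l * at-u G + (- γ) ^ l * at-s G
  intoS-g G l = begin
    V₃.inS (g G l)
      ≈⟨ h.+-homo ((V₂.t R₂.- V₂.s) R₂.^ l R₂.* V₂.inT G) ((V₂.s R₂.- V₂.t) R₂.^ l R₂.* V₂.inS G) ⟩
    V₃.inS ((V₂.t R₂.- V₂.s) R₂.^ l R₂.* V₂.inT G) + V₃.inS ((V₂.s R₂.- V₂.t) R₂.^ l R₂.* V₂.inS G)
      ≈⟨ +-cong (h.*-homo ((V₂.t R₂.- V₂.s) R₂.^ l) (V₂.inT G)) (h.*-homo ((V₂.s R₂.- V₂.t) R₂.^ l) (V₂.inS G)) ⟩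
    V₃.inS ((V₂.t R₂.- V₂.s) R₂.^ l) * V₃.inS (V₂.inT G) + V₃.inS ((V₂.s R₂.- V₂.t) R₂.^ l) * at-s G
      ≈⟨ +-cong (*-cong (trans (h.^-homo (V₂.t R₂.- V₂.s) l) (^-congˡ l (trans (h.sub-homo V₂.t V₂.s) (+-cong (intoS-const P₀.X) (-‿cong intoS-s)))))
                        (intoS-const G))
                (*-congʳ {at-s G} (trans (h.^-homo (V₂.s R₂.- V₂.t) l) (^-congˡ l (trans (h.sub-homo V₂.s V₂.t)
                  (trans (+-cong intoS-s (-‿cong (intoS-const P₀.X)))
                  (solve 2 (λ t u → t :- u := :- (u :- t)) (λ _ _ _ → F.refl) s u)))))) ⟩
    γ ^ l * at-u G + (- γ) ^ l * at-s G ∎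
    where module h = Hom intoS

  b-*-at : ∀ k i (f : R₁.Carrier) m → (R₁.b k i R₁.* f) m F.≈ F.b k i F.* f m
  b-*-at k i f m = F.trans (R₁.*-congʳ {f} (R₁.sym (Hom.b-homo P₀.constHom k i)) m) (P₀.const-⊛ (F.b k i) f m)

  shiftBy-at : ∀ k (f : R₂.Carrier) n m → V₃.shiftBy k f n m ≡ V₂.shiftBy k (λ i → f i m) n
  shiftBy-at zero    f n       m = ≡.refl
  shiftBy-at (suc k) f zero    m = ≡.refl
  shiftBy-at (suc k) f (suc n) m = shiftBy-at k f n m

  shiftBy-cong : ∀ k {G G′ : P₀.Series} → (∀ n → G n F.≈ G′ n) → ∀ n → V₂.shiftBy k G n F.≈ V₂.shiftBy k G′ n
  shiftBy-cong zero    e n       = e n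
  shiftBy-cong (suc k) e zero    = F.refl
  shiftBy-cong (suc k) e (suc n) = shiftBy-cong k e n

  -- For f the series of a family indexed by (n, m), combine k f is that of ⟨i⟩ ◇ ⟨j⟩ ↦ ⟨n⟩⟨k⟩ followed by the family.
  combine : ℕ → R₂.Carrier → Carrier
  combine k f = β ^ k * V₃.inT f + (s - t) ^ k * V₃.inS f

  combine-coefficient : ∀ k f i j m →
    combine k f i j m F.≈ (F.b k i F.+ F.b k j) F.* V₂.shiftBy k (λ n → f n m) (i ℕ.+ j)
  combine-coefficient k f i j m = F.begin
    combine k f i j m
      F.≈⟨ F.+-cong (V₃.[t-s]^k*inT k f i j m) (V₃.[s-t]^k*inS k f i j m) ⟩
    (R₁.b k i R₁.* V₃.shiftBy k f (i ℕ.+ j)) m F.+ (R₁.b k j R₁.* V₃.shiftBy k f (i ℕ.+ j)) m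
      F.≈⟨ F.+-cong (b-*-at k i _ m) (b-*-at k j _ m) ⟩
    F.b k i F.* V₃.shiftBy k f (i ℕ.+ j) m F.+ F.b k j F.* V₃.shiftBy k f (i ℕ.+ j) m
      F.≈⟨ F.distribʳ _ _ _ ⟨
    (F.b k i F.+ F.b k j) F.* V₃.shiftBy k f (i ℕ.+ j) m
      F.≡⟨ ≡.cong ((F.b k i F.+ F.b k j) F.*_) (shiftBy-at k f (i ℕ.+ j) m) ⟩
    (F.b k i F.+ F.b k j) F.* V₂.shiftBy k (λ n → f n m) (i ℕ.+ j) F.∎

  ⨁-at : ∀ n f i j m → ⨁ n f i j m ≡ F.⨁ n (λ k l → f k l i j m)
  ⨁-at zero    f i j m = ≡.refl
  ⨁-at (suc n) f i j m = ≡.cong (f 0 (suc n) i j m F.+_) (⨁-at n (λ k → f (suc k)) i j m)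

-- Polynomial identities for the Moore determinant

module Identities {c ℓ : Level} (R : CommutativeRing c ℓ) where
  open RingTools R

  -- Equals β^q α - β α^q when βᵖ and αᵖ are the powers with exponent p. They are separate symbols,
  -- so that the ring solver meets no symbolic exponents.
  discriminant : Carrier → Carrier → Carrier → Carrier → Carrier
  discriminant β βᵖ α αᵖ = β * (βᵖ * α - α * αᵖ)

  module _ {α β γ αᵖ βᵖ γᵖ : Carrier} (α+β≈γ : α + β ≈ γ) (frob : γ * γᵖ ≈ α * αᵖ + β * βᵖ) where

    -- The invariance of the Moore determinant under α ↦ α + β, without the common factor β. It
    -- allows the same multiplier to clear the denominators containing γ.
    shifted : βᵖ * α - α * αᵖ ≈ βᵖ * γ - γ * γᵖ
    shifted = begin
      βᵖ * α - α * αᵖ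
        ≈⟨ solve 4 (λ a b ap bp → bp :* a :- a :* ap := bp :* (a :+ b) :- (a :* ap :+ b :* bp)) refl α β αᵖ βᵖ ⟩
      βᵖ * (α + β) - (α * αᵖ + β * βᵖ)
        ≈⟨ +-cong (*-congˡ α+β≈γ) (-‿cong (sym frob)) ⟩
      βᵖ * γ - γ * γᵖ ∎

    -- Quotients by α, β and γ enter through their products with these elements, which are not
    -- units. Once `shifted` is used, the terms with P and α have the same shape as those with N and
    -- γ, so `half` and `collect` serve for both.
    discriminant-* : ∀ {αᵐ βᵐ γᵐ P N T₁ T₂ T₃ hₜ hₛ Hₐ H_g} →
      β * T₁ ≈ αᵐ * P - γᵐ * N → T₂ ≈ βᵐ * (hₜ - hₛ) → α * hₜ ≈ P → γ * hₛ ≈ N → T₃ ≈ P * Hₐ - N * H_g →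
      β * α * (βᵖ - αᵖ) * Hₐ ≈ β * βᵐ * αᵖ - α * αᵐ * βᵖ →
      β * γ * (βᵖ - γᵖ) * H_g ≈ β * βᵐ * γᵖ - γ * γᵐ * βᵖ →
      discriminant β βᵖ α αᵖ * (T₁ + T₂ + T₃)
        ≈ P * (β * βᵐ * βᵖ - α * αᵐ * αᵖ) - N * (β * βᵐ * βᵖ - γ * γᵐ * γᵖ)
    discriminant-* {αᵐ} {βᵐ} {γᵐ} {P} {N} {T₁} {T₂} {T₃} {hₜ} {hₛ} {Hₐ} {H_g} e₁ e₂ eₜ eₛ e₃ eₐ e_g = begin
      D * (T₁ + T₂ + T₃)
        ≈⟨ *-congˡ (+-cong (+-congˡ e₂) e₃) ⟩
      D * (T₁ + βᵐ * (hₜ - hₛ) + (P * Hₐ - N * H_g))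
        ≈⟨ solve 10 (λ b x t bm ht hs P N Ha Hg →
             b :* x :* (t :+ bm :* (ht :- hs) :+ (P :* Ha :- N :* Hg))
               := x :* (b :* t) :+ bm :* ht :* (b :* x) :+ P :* Ha :* (b :* x)
                    :- bm :* hs :* (b :* x) :- N :* Hg :* (b :* x))
             refl β (βᵖ * α - α * αᵖ) T₁ βᵐ hₜ hₛ P N Hₐ H_g ⟩
      x * (β * T₁) + βᵐ * hₜ * (β * x) + P * Hₐ * (β * x) - βᵐ * hₛ * (β * x) - N * H_g * (β * x)
        ≈⟨ +-cong (+-cong (+-congʳ (+-congʳ (*-congˡ e₁))) (-‿cong (*-congˡ (*-congˡ shifted)))) (-‿cong (*-congˡ (*-congˡ shifted))) ⟩
      x * (αᵐ * P - γᵐ * N) + βᵐ * hₜ * (β * x) + P * Hₐ * (β * x) - βᵐ * hₛ * (β * y) - N * H_g * (β * y)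
        ≈⟨ +-congʳ (+-congʳ (+-congʳ (+-congʳ
             (trans (solve 3 (λ x u v → x :* (u :- v) := x :* u :- x :* v) refl x (αᵐ * P) (γᵐ * N)) (+-congˡ (-‿cong (*-congʳ shifted))))))) ⟩
      x * (αᵐ * P) - y * (γᵐ * N) + βᵐ * hₜ * (β * x) + P * Hₐ * (β * x) - βᵐ * hₛ * (β * y) - N * H_g * (β * y)
        ≈⟨ rearranged ⟩
      P * (αᵐ * x) + βᵐ * β * (βᵖ - αᵖ) * (α * hₜ) + P * (β * α * (βᵖ - αᵖ) * Hₐ)
        - (N * (γᵐ * y) + βᵐ * β * (βᵖ - γᵖ) * (γ * hₛ) + N * (β * γ * (βᵖ - γᵖ) * H_g))
        ≈⟨ +-cong (+-cong (+-congˡ (*-congˡ eₜ)) (*-congˡ eₐ)) (-‿cong (+-cong (+-congˡ (*-congˡ eₛ)) (*-congˡ e_g))) ⟩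
      P * (αᵐ * x) + βᵐ * β * (βᵖ - αᵖ) * P + P * (β * βᵐ * αᵖ - α * αᵐ * βᵖ)
        - (N * (γᵐ * y) + βᵐ * β * (βᵖ - γᵖ) * N + N * (β * βᵐ * γᵖ - γ * γᵐ * βᵖ))
        ≈⟨ +-cong (collect α αᵖ αᵐ P) (-‿cong (collect γ γᵖ γᵐ N)) ⟩
      P * (β * βᵐ * βᵖ - α * αᵐ * αᵖ) - N * (β * βᵐ * βᵖ - γ * γᵐ * γᵖ) ∎
      where
      D = discriminant β βᵖ α αᵖ
      x = βᵖ * α - α * αᵖ
      y = βᵖ * γ - γ * γᵖ

      half : ∀ a aᵖ aᵐ P h H → (βᵖ * a - a * aᵖ) * (aᵐ * P) + βᵐ * h * (β * (βᵖ * a - a * aᵖ)) + P * H * (β * (βᵖ * a - a * aᵖ))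
        ≈ P * (aᵐ * (βᵖ * a - a * aᵖ)) + βᵐ * β * (βᵖ - aᵖ) * (a * h) + P * (β * a * (βᵖ - aᵖ) * H)
      half a aᵖ aᵐ P h H = solve 9 (λ b bp bm a ap am P h H →
        (bp :* a :- a :* ap) :* (am :* P) :+ bm :* h :* (b :* (bp :* a :- a :* ap)) :+ P :* H :* (b :* (bp :* a :- a :* ap))
        := P :* (am :* (bp :* a :- a :* ap)) :+ bm :* b :* (bp :- ap) :* (a :* h) :+ P :* (b :* a :* (bp :- ap) :* H))
        refl β βᵖ βᵐ a aᵖ aᵐ P h H

      rearranged : x * (αᵐ * P) - y * (γᵐ * N) + βᵐ * hₜ * (β * x) + P * Hₐ * (β * x) - βᵐ * hₛ * (β * y) - N * H_g * (β * y)
        ≈ P * (αᵐ * x) + βᵐ * β * (βᵖ - αᵖ) * (α * hₜ) + P * (β * α * (βᵖ - αᵖ) * Hₐ)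
        - (N * (γᵐ * y) + βᵐ * β * (βᵖ - γᵖ) * (γ * hₛ) + N * (β * γ * (βᵖ - γᵖ) * H_g))
      rearranged = trans
        (solve 6 (λ a b c d e f → a :- b :+ c :+ d :- e :- f := (a :+ c :+ d) :- (b :+ e :+ f)) refl _ _ _ _ _ _)
        (+-cong (half α αᵖ αᵐ P hₜ Hₐ) (-‿cong (half γ γᵖ γᵐ N hₛ H_g)))

      collect : ∀ a aᵖ aᵐ P → P * (aᵐ * (βᵖ * a - a * aᵖ)) + βᵐ * β * (βᵖ - aᵖ) * P + P * (β * βᵐ * aᵖ - a * aᵐ * βᵖ)
        ≈ P * (β * βᵐ * βᵖ - a * aᵐ * aᵖ)
      collect a aᵖ aᵐ P = solve 7 (λ b bp bm a ap am P →
        P :* (am :* (bp :* a :- a :* ap)) :+ bm :* b :* (bp :- ap) :* P :+ P :* (b :* bm :* ap :- a :* am :* bp)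
        := P :* (b :* bm :* bp :- a :* am :* ap)) refl β βᵖ βᵐ a aᵖ aᵐ P

    -- The exchange of t and u sends β to γ and α to -α but fixes the even power αᵖ; the determinant
    -- changes its sign.
    discriminant-swap : discriminant γ γᵖ (- α) αᵖ ≈ - discriminant β βᵖ α αᵖ
    discriminant-swap = begin
      γ * (γᵖ * - α - - α * αᵖ)
        ≈⟨ solve 4 (λ a ap g gp → g :* (gp :* (:- a) :- (:- a) :* ap) := :- (a :* (g :* gp) :- g :* a :* ap)) refl α αᵖ γ γᵖ ⟩
      - (α * (γ * γᵖ) - γ * α * αᵖ)
        ≈⟨ -‿cong (+-cong (*-congˡ frob) (-‿cong (*-congʳ (*-congʳ (sym α+β≈γ))))) ⟩
      - (α * (α * αᵖ + β * βᵖ) - (α + β) * α * αᵖ)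
        ≈⟨ solve 4 (λ a b ap bp → :- (a :* (a :* ap :+ b :* bp) :- (a :+ b) :* a :* ap) := :- (b :* (bp :* a :- a :* ap))) refl α β αᵖ βᵖ ⟩
      - (β * (βᵖ * α - α * αᵖ)) ∎

-- Symmetry of the generating series of (⟨i⟩ ◇ ⟨j⟩) ◇ ⟨m⟩

module Letters {c ℓ : Level} (F : CommutativeRing c ℓ) (e : ℕ)
               (fin : IsFiniteField F (suc (suc e))) where

  private
    module F = RingTools F
    module V₂ = TwoVariables F
    module V₃ = TwoVariables (series F)
  open ThreeVariables F
  open RingTools R₃
  open FAlgebra F e fin R₃ ιHom using (J; J-cong; J-comm; J-neg; J-add; odd-power; even-power; frobenius; χχ≈0)
  open FiniteField F e fin using (p; q)
  open Telescope R₃ e using (H; telescope)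
  open Identities R₃

  s-t≈-β : s - t ≈ - β
  s-t≈-β = solve 2 (λ s t → s :- t := :- (t :- s)) refl s t

  J-σ : ∀ κ r x y → σ (J κ r x y) ≈ J κ r (σ x) (σ y)
  J-σ κ r x y = trans (+-homo (χ p r * χ p κ * (x ^ r * y ^ κ + x ^ κ * y ^ r)) _) (+-cong
    (trans (*-homo (χ p r * χ p κ) (x ^ r * y ^ κ + x ^ κ * y ^ r)) (*-cong
      (trans (*-homo (χ p r) (χ p κ)) (*-cong (χ-homo p r) (χ-homo p κ)))
      (trans (+-homo (x ^ r * y ^ κ) (x ^ κ * y ^ r)) (+-cong (powers r κ) (powers κ r)))))
    (trans (⨁-homo (κ ℕ.+ r) _) (⨁-cong (κ ℕ.+ r) (λ k l _ →
      trans (*-homo (χ p k * χ p l * χ p r * (b r l + b r k)) (x ^ k * y ^ l)) (*-cong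
        (trans (*-homo (χ p k * χ p l * χ p r) (b r l + b r k)) (*-cong
          (trans (*-homo (χ p k * χ p l) (χ p r)) (*-cong
            (trans (*-homo (χ p k) (χ p l)) (*-cong (χ-homo p k) (χ-homo p l))) (χ-homo p r)))
          (trans (+-homo (b r l) (b r k)) (+-cong (b-homo r l) (b-homo r k)))))
        (powers k l))))))
    where
    open Hom σHom
    powers : ∀ k l → σ (x ^ k * y ^ l) ≈ σ x ^ k * σ y ^ l
    powers k l = trans (*-homo (x ^ k) (y ^ l)) (*-cong (^-homo x k) (^-homo y l))

  module _ (G : ℕ → F.Carrier) where

    Gs Gt Gu P N : Carrier
    Gs = at-s G
    Gt = at-t G
    Gu = at-u G
    P = Gu - Gt
    N = Gu - Gs

    -- Collects the terms in which ⟨i⟩ ◇ ⟨j⟩ yields ⟨n⟩⟨k⟩ and ⟨n⟩ ◇ ⟨m⟩ then yields a word ending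
    -- in ⟨l⟩, whose first letter is evaluated by `G`.
    W : ℕ → ℕ → Carrier
    W k l = χ p k * χ p l * combine k (g G l)

    inT-g-odd : ∀ {l} → p ∣ suc l → V₃.inT (g G l) ≈ α ^ l * P
    inT-g-odd {l} p∣l = trans (intoT-g G l) (trans (+-congˡ (*-congʳ (odd-power p∣l α)))
      (solve 3 (λ a u t → a :* u :+ (:- a) :* t := a :* (u :- t)) refl (α ^ l) Gu Gt))

    inS-g-odd : ∀ {l} → p ∣ suc l → V₃.inS (g G l) ≈ γ ^ l * N
    inS-g-odd {l} p∣l = trans (intoS-g G l) (trans (+-congˡ (*-congʳ (odd-power p∣l γ)))
      (solve 3 (λ a u t → a :* u :+ (:- a) :* t := a :* (u :- t)) refl (γ ^ l) Gu Gs))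

    combine-odd : ∀ {k} → p ∣ suc k → ∀ f → combine k f ≈ β ^ k * (V₃.inT f - V₃.inS f)
    combine-odd {k} p∣k f = trans (+-congˡ (*-congʳ (trans (^-congˡ k s-t≈-β) (odd-power p∣k β))))
      (solve 3 (λ a u t → a :* u :+ (:- a) :* t := a :* (u :- t)) refl (β ^ k) (V₃.inT f) (V₃.inS f))

    -- Only k and l with k + 1 and l + 1 divisible by p contribute. For them the powers are odd
    -- functions, which turns the sums in `combine` and `g` into the differences P and N.
    W-form : ∀ k l → W k l ≈ P * (χ p k * χ p l * (β ^ k * α ^ l)) - N * (χ p k * χ p l * (β ^ k * γ ^ l))
    W-form k l with p ∣? suc k | p ∣? suc l
    ... | yes p∣k | yes p∣l = begin
      1# * 1# * combine k (g G l)
        ≈⟨ *-congˡ (trans (combine-odd p∣k (g G l)) (*-congˡ (+-cong (inT-g-odd p∣l) (-‿cong (inS-g-odd p∣l))))) ⟩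
      1# * 1# * (β ^ k * (α ^ l * P - γ ^ l * N))
        ≈⟨ solve 5 (λ b a g P N → con (+ 1) :* con (+ 1) :* (b :* (a :* P :- g :* N))
             := P :* (con (+ 1) :* con (+ 1) :* (b :* a)) :- N :* (con (+ 1) :* con (+ 1) :* (b :* g)))
             refl (β ^ k) (α ^ l) (γ ^ l) P N ⟩
      P * (1# * 1# * (β ^ k * α ^ l)) - N * (1# * 1# * (β ^ k * γ ^ l)) ∎
    ... | yes _ | no _ = vanish 1# 0# (zeroʳ 1#)
      where
      vanish : ∀ x y → x * y ≈ 0# → ∀ {v w z} → x * y * v ≈ P * (x * y * w) - N * (x * y * z)
      vanish x y xy≈0 {v} {w} {z} = trans (*-congʳ xy≈0) (trans
        (solve 5 (λ P N v w z → con (+ 0) :* v := P :* (con (+ 0) :* w) :- N :* (con (+ 0) :* z)) refl P N v w z)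
        (+-cong (*-congˡ (*-congʳ (sym xy≈0))) (-‿cong (*-congˡ (*-congʳ (sym xy≈0))))))
    ... | no _ | _ = trans (*-congʳ (zeroˡ _)) (trans
        (solve 5 (λ P N v w z → con (+ 0) :* v := P :* (con (+ 0) :* w) :- N :* (con (+ 0) :* z)) refl P N _ _ _)
        (+-cong (*-congˡ (*-congʳ (sym (zeroˡ _)))) (-‿cong (*-congˡ (*-congʳ (sym (zeroˡ _)))))))

    ⨁-linear : ∀ n (c w w′ : ℕ → ℕ → Carrier) →
      ⨁ n (λ k l → c k l * (P * w k l - N * w′ k l))
        ≈ P * ⨁ n (λ k l → c k l * w k l) - N * ⨁ n (λ k l → c k l * w′ k l)
    ⨁-linear n c w w′ = begin
      ⨁ n (λ k l → c k l * (P * w k l - N * w′ k l))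
        ≈⟨ ⨁-cong n (λ k l _ → solve 5 (λ c P N w v → c :* (P :* w :- N :* v) := P :* (c :* w) :+ (:- N) :* (c :* v)) refl
             (c k l) P N (w k l) (w′ k l)) ⟩
      ⨁ n (λ k l → P * (c k l * w k l) + (- N) * (c k l * w′ k l))
        ≈⟨ ⨁-+ n (λ k l → P * (c k l * w k l)) (λ k l → (- N) * (c k l * w′ k l)) ⟩
      ⨁ n (λ k l → P * (c k l * w k l)) + ⨁ n (λ k l → (- N) * (c k l * w′ k l))
        ≈⟨ +-cong (⨁-*ˡ n P (λ k l → c k l * w k l)) (⨁-*ˡ n (- N) (λ k l → c k l * w′ k l)) ⟨
      P * ⨁ n (λ k l → c k l * w k l) + (- N) * ⨁ n (λ k l → c k l * w′ k l)
        ≈⟨ +-congˡ (solve 2 (λ x y → (:- x) :* y := :- (x :* y)) refl N _) ⟩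
      P * ⨁ n (λ k l → c k l * w k l) - N * ⨁ n (λ k l → c k l * w′ k l) ∎

    -- Generating series of the part of (⟨i⟩ ◇ ⟨j⟩) ◇ ⟨m⟩ whose words end in ⟨κ⟩⟨r⟩; G records the first letter.
    depth₃ : ℕ → ℕ → Carrier
    depth₃ κ r = W r κ + W κ r + ⨁ (κ ℕ.+ r) (λ k l → χ p r * (b r l + b r k) * W k l)

    depth₃-form : ∀ κ r → depth₃ κ r ≈ P * J κ r β α - N * J κ r β γ
    depth₃-form κ r = begin
      depth₃ κ r
        ≈⟨ +-cong (+-cong (W-form r κ) (W-form κ r)) (trans
             (⨁-cong (κ ℕ.+ r) (λ k l _ → *-congˡ (W-form k l)))
             (⨁-linear (κ ℕ.+ r) (λ k l → χ p r * (b r l + b r k)) (w α) (w γ))) ⟩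
      P * w α r κ - N * w γ r κ + (P * w α κ r - N * w γ κ r) + (P * B α - N * B γ)
        ≈⟨ solve 8 (λ P N a c d e f g → P :* a :- N :* c :+ (P :* d :- N :* e) :+ (P :* f :- N :* g)
             := P :* (a :+ d :+ f) :- N :* (c :+ e :+ g)) refl P N _ _ _ _ _ _ ⟩
      P * (w α r κ + w α κ r + B α) - N * (w γ r κ + w γ κ r + B γ)
        ≈⟨ +-cong (*-congˡ (toJ α)) (-‿cong (*-congˡ (toJ γ))) ⟩
      P * J κ r β α - N * J κ r β γ ∎
      where
      w : Carrier → ℕ → ℕ → Carrier
      w y k l = χ p k * χ p l * (β ^ k * y ^ l)

      B : Carrier → Carrier
      B y = ⨁ (κ ℕ.+ r) (λ k l → χ p r * (b r l + b r k) * w y k l)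

      toJ : ∀ y → w y r κ + w y κ r + B y ≈ J κ r β y
      toJ y = +-cong
        (solve 4 (λ c d x z → c :* d :* x :+ d :* c :* z := c :* d :* (x :+ z)) refl (χ p r) (χ p κ) (β ^ r * y ^ κ) (β ^ κ * y ^ r))
        (⨁-cong (κ ℕ.+ r) (λ k l _ → solve 5 (λ cr d ck cl x → cr :* d :* (ck :* cl :* x) := ck :* cl :* cr :* d :* x) refl
          (χ p r) (b r l + b r k) (χ p k) (χ p l) (β ^ k * y ^ l)))

    σ-P : σ P ≈ Gt - Gu
    σ-P = σ-sub {Gu} {Gt} (σ-at-u G) (σ-at-t G)

    σ-N : σ N ≈ Gt - Gs
    σ-N = σ-sub {Gu} {Gs} (σ-at-u G) (σ-at-s G)

    depth₃-symmetric : ∀ κ r → σ (depth₃ κ r) ≈ depth₃ κ r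
    depth₃-symmetric κ r = begin
      σ (depth₃ κ r)
        ≈⟨ ⟦⟧-cong (depth₃-form κ r) ⟩
      σ (P * J κ r β α - N * J κ r β γ)
        ≈⟨ σ-sub {P * J κ r β α} {N * J κ r β γ}
             (trans (*-homo P (J κ r β α)) (*-cong σ-P (trans (J-σ κ r β α) (J-cong κ r σ-β σ-α))))
             (trans (*-homo N (J κ r β γ)) (*-cong σ-N (trans (J-σ κ r β γ) (J-cong κ r σ-β σ-γ)))) ⟩
      (Gt - Gu) * J κ r γ (- α) - (Gt - Gs) * J κ r γ β
        ≈⟨ +-cong (*-congˡ (trans (J-neg κ r γ α) (-‿cong (J-comm κ r γ α)))) (-‿cong (*-congˡ (J-comm κ r γ β))) ⟩
      (Gt - Gu) * (- J κ r α γ) - (Gt - Gs) * J κ r β γ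
        -- Since Gt - Gs = N - P, the second product also contributes to the coefficient of P;
        -- `J-add` then applies to that coefficient.
        ≈⟨ solve 5 (λ s t u a b → (t :- u) :* (:- a) :- (t :- s) :* b := (u :- t) :* (a :+ b) :- (u :- s) :* b) refl
             Gs Gt Gu (J κ r α γ) (J κ r β γ) ⟩
      P * (J κ r α γ + J κ r β γ) - N * J κ r β γ
        ≈⟨ +-congʳ (*-congˡ (trans (+-cong (J-cong κ r refl (sym α+β≈γ)) (J-cong κ r refl (sym α+β≈γ)))
             (trans (J-add κ r α β) (J-comm κ r α β)))) ⟩
      P * J κ r β α - N * J κ r β γ
        ≈⟨ depth₃-form κ r ⟨
      depth₃ κ r ∎
      where open Hom σHom

    -- Words of length two in (⟨i⟩ ◇ ⟨j⟩) ◇ ⟨m⟩ arise from ⟨i+j+1⟩ ◇ ⟨m⟩ (T₁), from the letter ⟨n+m+1⟩ of ⟨n⟩ ◇ ⟨m⟩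
    -- for a word ⟨n⟩⟨k⟩ of ⟨i⟩ ◇ ⟨j⟩ (T₂), and from the letter ⟨l+k+1⟩ of ⟨l⟩ ⧢ ⟨k⟩ (T₃).
    T₁ T₂ : ℕ → Carrier
    T₁ m = V₃.divided (g G m)
    T₂ m = combine m (V₂.divided G)

    T₃ : ℕ → Carrier
    T₃ zero    = 0#
    T₃ (suc m) = ⨁ m W

    depth₂ : ℕ → Carrier
    depth₂ m = χ p m * (T₁ m + T₂ m) + T₃ m

    T₃-form : ∀ m → T₃ m ≈ P * H m β α - N * H m β γ
    T₃-form zero = solve 2 (λ P N → con (+ 0) := P :* con (+ 0) :- N :* con (+ 0)) refl P N
    T₃-form (suc m) = begin
      ⨁ m W
        ≈⟨ ⨁-cong m (λ k l _ → trans (W-form k l) (sym (*-identityˡ _))) ⟩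
      ⨁ m (λ k l → 1# * (P * w α k l - N * w γ k l))
        ≈⟨ ⨁-linear m (λ _ _ → 1#) (w α) (w γ) ⟩
      P * ⨁ m (λ k l → 1# * w α k l) - N * ⨁ m (λ k l → 1# * w γ k l)
        ≈⟨ +-cong (*-congˡ (⨁-cong m (λ k l _ → *-identityˡ _))) (-‿cong (*-congˡ (⨁-cong m (λ k l _ → *-identityˡ _)))) ⟩
      P * H (suc m) β α - N * H (suc m) β γ ∎
      where
      w : Carrier → ℕ → ℕ → Carrier
      w y k l = χ p k * χ p l * (β ^ k * y ^ l)

    T₃-vanish : ∀ {m} → ¬ p ∣ suc m → T₃ m ≈ 0#
    T₃-vanish {zero}  _   = refl
    T₃-vanish {suc m} p∤m = ⨁-0 m (λ k l k+l≡m → trans (*-congʳ (χχ≈0 (λ (p∣k , p∣l) → p∤m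
      (≡.subst (p ∣_) (≡.cong suc (≡.trans (ℕ.+-suc k l) (≡.cong suc k+l≡m))) (ℕ.∣m∣n⇒∣m+n p∣k p∣l))))) (zeroˡ _))

    β*T₁ : ∀ {m} → p ∣ suc m → β * T₁ m ≈ α ^ m * P - γ ^ m * N
    β*T₁ {m} p∣m = trans (V₃.[t-s]*divided (g G m)) (+-cong (inT-g-odd p∣m) (-‿cong (inS-g-odd p∣m)))

    -- The quotients P / α and N / γ, which exist as series because they are divided differences.
    hₜ hₛ : Carrier
    hₜ = V₃.inT (V₂.divided G)
    hₛ = V₃.inS (V₂.divided G)

    α*hₜ : α * hₜ ≈ P
    α*hₜ = begin
      α * hₜ  ≈⟨ *-congʳ {hₜ} (h.sub-homo V₂.t V₂.s) ⟨
      V₃.inT (V₂.t R₂.- V₂.s) * hₜ  ≈⟨ h.*-homo (V₂.t R₂.- V₂.s) (V₂.divided G) ⟨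
      V₃.inT ((V₂.t R₂.- V₂.s) R₂.* V₂.divided G)  ≈⟨ h.⟦⟧-cong (V₂.[t-s]*divided G) ⟩
      V₃.inT (V₂.inT G R₂.- V₂.inS G)  ≈⟨ h.sub-homo (V₂.inT G) (V₂.inS G) ⟩
      P  ∎
      where
      module h = Hom intoT
      module R₂ = RingTools R₂

    γ*hₛ : γ * hₛ ≈ N
    γ*hₛ = begin
      γ * hₛ  ≈⟨ *-congʳ {hₛ} (trans (h.sub-homo V₂.t V₂.s)
                                                              (+-cong (intoS-const _) (-‿cong intoS-s))) ⟨
      V₃.inS (V₂.t R₂.- V₂.s) * hₛ  ≈⟨ h.*-homo (V₂.t R₂.- V₂.s) (V₂.divided G) ⟨
      V₃.inS ((V₂.t R₂.- V₂.s) R₂.* V₂.divided G)  ≈⟨ h.⟦⟧-cong (V₂.[t-s]*divided G) ⟩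
      V₃.inS (V₂.inT G R₂.- V₂.inS G)  ≈⟨ h.sub-homo (V₂.inT G) (V₂.inS G) ⟩
      V₃.inS (V₂.inT G) - Gs  ≈⟨ +-congʳ (intoS-const G) ⟩
      N  ∎
      where
      module h = Hom intoS
      module R₂ = RingTools R₂

    frob : γ * γ ^ p ≈ α * α ^ p + β * β ^ p
    frob = begin
      γ ^ q  ≈⟨ ^-congˡ q (trans (sym α+β≈γ) (solve 2 (λ a b → a :+ b := a :- (:- b)) refl α β)) ⟩
      (α - - β) ^ q  ≈⟨ frobenius (- β) α ⟩
      α ^ q - - β * (- β) ^ p  ≈⟨ +-congˡ (-‿cong (*-congˡ (even-power ℕ.∣-refl β))) ⟩
      α ^ q - - β * β ^ p  ≈⟨ solve 3 (λ a b c → a :- (:- b) :* c := a :+ b :* c) refl (α ^ q) β (β ^ p) ⟩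
      α ^ q + β * β ^ p  ∎

    D : Carrier
    D = discriminant β (β ^ p) α (α ^ p)

    -- With a, b, c the powers of α, β, γ with exponent m + q, the right side is Gu (c - a) + Gt (a
    -- - b) + Gs (b - c). It alternates under the exchange of t and u, the exponent m + q being a
    -- multiple of p.
    D*depth₂ : ∀ {m} → p ∣ suc m → D * depth₂ m
      ≈ P * (β * β ^ m * β ^ p - α * α ^ m * α ^ p) - N * (β * β ^ m * β ^ p - γ * γ ^ m * γ ^ p)
    D*depth₂ {m} p∣m = trans (*-congˡ {D} (+-congʳ (trans (*-congʳ (χ-yes p∣m)) (*-identityˡ _))))
      (discriminant-* α+β≈γ frob (β*T₁ p∣m) (combine-odd p∣m (V₂.divided G)) α*hₜ γ*hₛ (T₃-form m)
        (telescope p∣m β α) (telescope p∣m β γ))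

    σ-^ : ∀ {x y} n → σ x ≈ y → σ (x ^ n) ≈ y ^ n
    σ-^ {x} n eq = trans (Hom.^-homo σHom x n) (^-congˡ n eq)

    σ-D : σ D ≈ - D
    σ-D = begin
      σ D
        ≈⟨ *-homo β (β ^ p * α - α * α ^ p) ⟩
      σ β * σ (β ^ p * α - α * α ^ p)
        ≈⟨ *-cong σ-β (σ-sub {β ^ p * α} {α * α ^ p}
             (trans (*-homo (β ^ p) α) (*-cong (σ-^ p σ-β) σ-α))
             (trans (*-homo α (α ^ p)) (*-cong σ-α (trans (σ-^ p σ-α) (even-power ℕ.∣-refl α))))) ⟩
      γ * (γ ^ p * - α - - α * α ^ p)
        ≈⟨ discriminant-swap α+β≈γ frob ⟩
      - D ∎
      where open Hom σHom

    σ-monomial : ∀ {x y} m → σ x ≈ y → σ (x * x ^ m * x ^ p) ≈ y * y ^ m * y ^ p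
    σ-monomial {x} m eq = trans (*-homo (x * x ^ m) (x ^ p)) (*-cong (trans (*-homo x (x ^ m)) (*-cong eq (σ-^ m eq))) (σ-^ p eq))
      where open Hom σHom

    -- Both `D` and `D * depth₂ m` change sign under σ, and the two signs cancel.
    D*σdepth₂ : ∀ {m} → p ∣ suc m → D * σ (depth₂ m) ≈ D * depth₂ m
    D*σdepth₂ {m} p∣m = begin
      D * σ (depth₂ m)
        ≈⟨ solve 2 (λ d x → d :* x := :- ((:- d) :* x)) refl D (σ (depth₂ m)) ⟩
      - ((- D) * σ (depth₂ m))
        ≈⟨ -‿cong (*-congʳ {σ (depth₂ m)} σ-D) ⟨
      - (σ D * σ (depth₂ m))
        ≈⟨ -‿cong (*-homo D (depth₂ m)) ⟨
      - σ (D * depth₂ m)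
        ≈⟨ -‿cong (⟦⟧-cong (D*depth₂ p∣m)) ⟩
      - σ (P * (b′ - a′) - N * (b′ - c′))
        ≈⟨ -‿cong (σ-sub {P * (b′ - a′)} {N * (b′ - c′)}
             (trans (*-homo P (b′ - a′)) (*-cong σ-P (σ-sub {b′} {a′} (σ-monomial m σ-β)
               (trans (σ-monomial m σ-α) (trans (*-cong (*-congˡ (odd-power p∣m α)) (even-power ℕ.∣-refl α))
                 (solve 3 (λ x y z → (:- x) :* (:- y) :* z := x :* y :* z) refl α (α ^ m) (α ^ p)))))))
             (trans (*-homo N (b′ - c′)) (*-cong σ-N (σ-sub {b′} {c′} (σ-monomial m σ-β) (σ-monomial m σ-γ))))) ⟩
      - ((Gt - Gu) * (c′ - a′) - (Gt - Gs) * (c′ - b′))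
        ≈⟨ solve 6 (λ s t u a b c → :- ((t :- u) :* (c :- a) :- (t :- s) :* (c :- b)) := (u :- t) :* (b :- a) :- (u :- s) :* (b :- c))
             refl Gs Gt Gu a′ b′ c′ ⟩
      P * (b′ - a′) - N * (b′ - c′)
        ≈⟨ D*depth₂ p∣m ⟨
      D * depth₂ m ∎
      where
      open Hom σHom
      a′ = α * α ^ m * α ^ p
      b′ = β * β ^ m * β ^ p
      c′ = γ * γ ^ m * γ ^ p

    -- Setting s = 0 turns D into t (tᵖu - u^q), and then t = 0 in the second factor leaves -u^q.
    D-regular : Regular D
    D-regular = P₂.regular-head D (Regularity.regular-≈ R₂ (R₂.sym D₀)
        (Regularity.regular-* R₂ P₁.X-regular (P₁.regular-head _ (Regularity.regular-≈ R₁ (R₁.sym E₀)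
          (Regularity.regular-neg R₁ (Regularity.regular-^ R₁ q P₀.X-regular))))))
      where
      module P₀ = PowerSeries F
      module P₁ = PowerSeries R₁
      module P₂ = PowerSeries R₂
      module R₁ = RingTools R₁
      module R₂ = RingTools R₂
      open FAlgebra F e fin R₂ (P₁.constHom ∘ₕ P₀.constHom) using () renaming (frobenius to frobenius₂)

      t₂ = V₂.s
      u₂ = V₂.t

      ^-head : ∀ x n → (x ^ n) 0 R₂.≈ x 0 R₂.^ n
      ^-head x zero    = R₂.refl
      ^-head x (suc n) = R₂.*-congˡ (^-head x n)

      β₀ : β 0 R₂.≈ t₂
      β₀ = R₂.x-0≈x t₂

      E : R₂.Carrier
      E = t₂ R₂.^ p R₂.* u₂ R₂.- u₂ R₂.^ q

      D₀ : D 0 R₂.≈ t₂ R₂.* E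
      D₀ = R₂.begin
        β 0 R₂.* ((β ^ p) 0 R₂.* α 0 R₂.- (α ^ q) 0)
          R₂.≈⟨ R₂.*-cong β₀ (R₂.+-cong (R₂.*-congʳ {α 0} (R₂.trans (^-head β p) (R₂.^-congˡ p β₀)))
                 (R₂.-‿cong (R₂.trans (^-head α q) (frobenius₂ t₂ u₂)))) ⟩
        t₂ R₂.* (t₂ R₂.^ p R₂.* (u₂ R₂.- t₂) R₂.- (u₂ R₂.^ q R₂.- t₂ R₂.* t₂ R₂.^ p))
          R₂.≈⟨ R₂.solve 4 (λ t u tp uq → t R₂.:* (tp R₂.:* (u R₂.:- t) R₂.:- (uq R₂.:- t R₂.:* tp)) R₂.:= t R₂.:* (tp R₂.:* u R₂.:- uq))
                 R₂.refl t₂ u₂ (t₂ R₂.^ p) (u₂ R₂.^ q) ⟩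
        t₂ R₂.* E R₂.∎

      u^-head : ∀ n → (u₂ R₂.^ n) 0 R₁.≈ P₀.X R₁.^ n
      u^-head zero    = R₁.refl
      u^-head (suc n) = R₁.*-congˡ {P₀.X} (u^-head n)

      E₀ : E 0 R₁.≈ R₁.- (P₀.X R₁.^ q)
      E₀ = R₁.trans (R₁.+-cong (R₁.trans (R₁.*-congʳ {P₀.X} (R₁.zeroˡ ((t₂ R₂.^ e) 0))) (R₁.zeroˡ P₀.X)) (R₁.-‿cong (u^-head q)))
        (R₁.+-identityˡ _)

    depth₂-vanish : ∀ {m} → ¬ p ∣ suc m → depth₂ m ≈ 0#
    depth₂-vanish {m} p∤m = trans
      (+-cong (trans (*-congʳ {T₁ m + T₂ m} (χ-no p∤m)) (zeroˡ (T₁ m + T₂ m))) (T₃-vanish p∤m)) (+-identityˡ 0#)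

    depth₂-symmetric : ∀ m → σ (depth₂ m) ≈ depth₂ m
    depth₂-symmetric m = symmetric (p ∣? suc m)
      where
      symmetric : Dec (p ∣ suc m) → σ (depth₂ m) ≈ depth₂ m
      symmetric (yes p∣m) = cancel {D} D-regular (σ (depth₂ m)) (depth₂ m) (D*σdepth₂ p∣m)
      symmetric (no  p∤m) = trans (Hom.⟦⟧-cong σHom (depth₂-vanish p∤m))
        (trans (Hom.0-homo σHom) (sym (depth₂-vanish p∤m)))

-- From generating series back to three letters

module LetterAssociativity {c ℓ : Level} (F : CommutativeRing c ℓ) (e : ℕ)
                           (fin : IsFiniteField F (suc (suc e))) where

  open RingTools F
  open TwoVariables F using (shiftBy; shiftBy-<; shiftBy-+)
  open FiniteField F e fin using (p)
  private
    module T = ThreeVariables F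
    module R₃ = RingTools T.R₃
    module L = Letters F e fin
    module ι = Hom T.ιHom

  shiftBy-∸ : ∀ {k n} (G : ℕ → Carrier) → k ℕ.≤ n → shiftBy k G n ≡ G (n ∸ k)
  shiftBy-∸ {k} {n} G k≤n = ≡.trans (≡.cong (shiftBy k G) (≡.sym (ℕ.m+[n∸m]≡n k≤n))) (shiftBy-+ k (n ∸ k) G)

  shiftBy-scale : ∀ k x (G : ℕ → Carrier) n → shiftBy k (λ i → x * G i) n ≈ x * shiftBy k G n
  shiftBy-scale zero    x G n       = refl
  shiftBy-scale (suc k) x G zero    = sym (zeroʳ x)
  shiftBy-scale (suc k) x G (suc n) = shiftBy-scale k x G n

  shiftBy-add : ∀ k (G G′ : ℕ → Carrier) n → shiftBy k (λ i → G i + G′ i) n ≈ shiftBy k G n + shiftBy k G′ n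
  shiftBy-add zero    G G′ n       = refl
  shiftBy-add (suc k) G G′ zero    = sym (+-identityˡ 0#)
  shiftBy-add (suc k) G G′ (suc n) = shiftBy-add k G G′ n

  open T using (shiftBy-cong)

  -- d k i j = Δ^(k+1)_(i+1,j+1), except that the truncation k ≤ i + j is left to shiftBy or to the summation range.
  d : ℕ → ℕ → ℕ → Carrier
  d k i j = χ p k * (b k i + b k j)

  d-comm : ∀ k i j → d k i j ≈ d k j i
  d-comm k i j = *-congˡ (+-comm _ _)

  ι-d : ∀ k i j → R₃._≈_ (T.ι (d k i j)) (R₃._*_ (R₃.χ p k) (R₃._+_ (R₃.b k i) (R₃.b k j)))
  ι-d k i j = R₃.trans (ι.*-homo (χ p k) (b k i + b k j))
    (R₃.*-cong (ι.χ-homo p k) (R₃.trans (ι.+-homo (b k i) (b k j)) (R₃.+-cong (ι.b-homo k i) (ι.b-homo k j))))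

  module _ (i j m : ℕ) where

    -- The coefficient of s^i t^j u^m in `L.W`. Out-of-range terms are zero through `shiftBy`, so no
    -- side conditions on k and l are carried along.
    w : (ℕ → Carrier) → ℕ → ℕ → Carrier
    w G k l = d k i j * shiftBy k (λ n → d l n m * shiftBy l G (n ℕ.+ m)) (i ℕ.+ j)

    w-cong : ∀ k l {G G′ : ℕ → Carrier} → (∀ n → G n ≈ G′ n) → w G k l ≈ w G′ k l
    w-cong k l eq = *-congˡ (shiftBy-cong k (λ n → *-congˡ (shiftBy-cong l eq (n ℕ.+ m))) (i ℕ.+ j))

    w-add : ∀ k l (G G′ : ℕ → Carrier) → w (λ n → G n + G′ n) k l ≈ w G k l + w G′ k l
    w-add k l G G′ = trans (*-congˡ (trans
      (shiftBy-cong k (λ n → trans (*-congˡ (shiftBy-add l G G′ (n ℕ.+ m))) (distribˡ _ _ _)) (i ℕ.+ j))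
      (shiftBy-add k _ _ (i ℕ.+ j)))) (distribˡ _ _ _)

    w-scale : ∀ k l x (G : ℕ → Carrier) → w (λ n → x * G n) k l ≈ x * w G k l
    w-scale k l x G = trans (*-congˡ (trans
      (shiftBy-cong k (λ n → trans (*-congˡ (shiftBy-scale l x G (n ℕ.+ m)))
        (solve 3 (λ d x y → d :* (x :* y) := x :* (d :* y)) refl _ x _)) (i ℕ.+ j))
      (shiftBy-scale k x _ (i ℕ.+ j))))
      (solve 3 (λ d x y → d :* (x :* y) := x :* (d :* y)) refl _ x _)

    w-∑ : ∀ k l n (G : ℕ → ℕ → Carrier) → w (λ a → ∑ n (λ r → G r a)) k l ≈ ∑ n (λ r → w (G r) k l)
    w-∑ k l zero G = trans (w-cong k l (λ a → trans (∑-zero (λ r → G r a)) (sym (zeroˡ 0#))))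
      (trans (w-scale k l 0# (λ _ → 0#)) (trans (zeroˡ _) (sym (∑-zero (λ r → w (G r) k l)))))
    w-∑ k l (suc n) G = trans (w-cong k l (λ a → ∑-suc n (λ r → G r a))) (trans (w-add k l (G 0) _)
      (trans (+-congˡ (w-∑ k l n (λ r → G (suc r)))) (sym (∑-suc n (λ r → w (G r) k l)))))

    W-at : ∀ G k l → L.W G k l i j m ≈ w G k l
    W-at G k l = begin
      L.W G k l i j m
        ≈⟨ R₃.*-congʳ {C} (R₃.sym (R₃.trans (ι.*-homo (χ p k) (χ p l)) (R₃.*-cong (ι.χ-homo p k) (ι.χ-homo p l)))) i j m ⟩
      (R₃._*_ (T.ι (χ p k * χ p l)) C) i j m
        ≈⟨ T.ι-* (χ p k * χ p l) C i j m ⟩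
      χ p k * χ p l * C i j m
        ≈⟨ *-congˡ (T.combine-coefficient k (T.g G l) i j m) ⟩
      χ p k * χ p l * ((b k i + b k j) * shiftBy k (λ n → T.g G l n m) (i ℕ.+ j))
        ≈⟨ solve 4 (λ c c′ b s → c :* c′ :* (b :* s) := c :* b :* (c′ :* s)) refl (χ p k) (χ p l) (b k i + b k j) _ ⟩
      d k i j * (χ p l * shiftBy k (λ n → T.g G l n m) (i ℕ.+ j))
        ≈⟨ *-congˡ (shiftBy-scale k (χ p l) _ (i ℕ.+ j)) ⟨
      d k i j * shiftBy k (λ n → χ p l * T.g G l n m) (i ℕ.+ j)
        ≈⟨ *-congˡ (shiftBy-cong k (λ n → trans (*-congˡ (T.g-coefficient G l n m)) (sym (*-assoc _ _ _))) (i ℕ.+ j)) ⟩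
      w G k l ∎
      where C = T.combine k (T.g G l)

    depth₃ : (ℕ → Carrier) → ℕ → ℕ → Carrier
    depth₃ G κ r = w G r κ + w G κ r + ⨁ (κ ℕ.+ r) (λ k l → d r l k * w G k l)

    depth₃-at : ∀ G κ r → L.depth₃ G κ r i j m ≈ depth₃ G κ r
    depth₃-at G κ r = +-cong (+-cong (W-at G r κ) (W-at G κ r))
      (trans (reflexive (T.⨁-at (κ ℕ.+ r) _ i j m)) (⨁-cong (κ ℕ.+ r) (λ k l _ → begin
        _
          ≈⟨ R₃.*-congʳ {L.W G k l} (R₃.sym (ι-d r l k)) i j m ⟩
        (R₃._*_ (T.ι (d r l k)) (L.W G k l)) i j m
          ≈⟨ T.ι-* (d r l k) (L.W G k l) i j m ⟩
        d r l k * L.W G k l i j m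
          ≈⟨ *-congˡ (W-at G k l) ⟩
        d r l k * w G k l ∎)))

    t₁ t₂ t₃ : (ℕ → Carrier) → ℕ → Carrier
    t₁ G n = d n (suc (i ℕ.+ j)) m * shiftBy n G (suc (i ℕ.+ j) ℕ.+ m)
    t₂ G n = d n i j * shiftBy n (λ a → G (suc (a ℕ.+ m))) (i ℕ.+ j)
    t₃ G zero    = 0#
    t₃ G (suc n) = ⨁ n (w G)

    depth₂ : (ℕ → Carrier) → ℕ → Carrier
    depth₂ G n = t₁ G n + t₂ G n + t₃ G n

    T₃-at : ∀ G n → L.T₃ G n i j m ≈ t₃ G n
    T₃-at G zero    = refl
    T₃-at G (suc n) = trans (reflexive (T.⨁-at n _ i j m)) (⨁-cong n (λ k l _ → W-at G k l))

    depth₂-at : ∀ G n → L.depth₂ G n i j m ≈ depth₂ G n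
    depth₂-at G n = +-cong (begin
      (R₃._*_ (R₃.χ p n) T₁₂) i j m
        ≈⟨ R₃.*-congʳ {T₁₂} (R₃.sym (ι.χ-homo p n)) i j m ⟩
      (R₃._*_ (T.ι (χ p n)) T₁₂) i j m
        ≈⟨ T.ι-* (χ p n) T₁₂ i j m ⟩
      χ p n * (T.g G n (suc (i ℕ.+ j)) m + T.combine n (TwoVariables.divided F G) i j m)
        ≈⟨ *-congˡ (+-cong (T.g-coefficient G n (suc (i ℕ.+ j)) m) (T.combine-coefficient n (TwoVariables.divided F G) i j m)) ⟩
      χ p n * ((b n (suc (i ℕ.+ j)) + b n m) * shiftBy n G (suc (i ℕ.+ j) ℕ.+ m)
        + (b n i + b n j) * shiftBy n (λ a → G (suc (a ℕ.+ m))) (i ℕ.+ j))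
        ≈⟨ solve 5 (λ c x y z w → c :* (x :* y :+ z :* w) := c :* x :* y :+ c :* z :* w) refl _ _ _ _ _ ⟩
      t₁ G n + t₂ G n ∎) (T₃-at G n)
      where T₁₂ = R₃._+_ (L.T₁ G n) (L.T₂ G n)

  depth₃-swap : ∀ G κ r i j m → depth₃ i j m G κ r ≈ depth₃ i m j G κ r
  depth₃-swap G κ r i j m = trans (sym (depth₃-at i j m G κ r))
    (trans (L.depth₃-symmetric G κ r i m j) (depth₃-at i m j G κ r))

  depth₂-swap : ∀ G n i j m → depth₂ i j m G n ≈ depth₂ i m j G n
  depth₂-swap G n i j m = trans (sym (depth₂-at i j m G n))
    (trans (L.depth₂-symmetric G n i m j) (depth₂-at i m j G n))

  ∑-extend : ∀ {n N} → n ℕ.≤ N → (f : ℕ → Carrier) → (∀ i → n ℕ.≤ i → f i ≈ 0#) → ∑ n f ≈ ∑ N f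
  ∑-extend {n} n≤N f f≈0 with ℕ.m≤n⇒∃[o]m+o≡n n≤N
  ... | o , ≡.refl = begin
    ∑ n f  ≈⟨ +-identityʳ _ ⟨
    ∑ n f + 0#  ≈⟨ +-congˡ (∑-0 o (λ i _ → f≈0 (n ℕ.+ i) (ℕ.m≤m+n n i))) ⟨
    ∑ n f + ∑ o (λ i → f (n ℕ.+ i))  ≈⟨ ∑-split n o f ⟨
    ∑ (n ℕ.+ o) f  ∎

  module _ (Γ : List ℕ → Carrier) where

    Ψ : ℕ → ℕ → ℕ → Carrier
    Ψ i l k = Γ (i ∷ l ∷ k ∷ []) + Γ (i ∷ k ∷ l ∷ [])
      + (Γ (i ∷ suc (l ℕ.+ k) ∷ []) + ∑ (suc (l ℕ.+ k)) (λ r → d r l k * Γ (i ∷ (l ℕ.+ k ∸ r) ∷ r ∷ [])))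

    -- The functional Γ applied to (⟨i⟩ ◇ ⟨j⟩) ◇ ⟨m⟩; Ψ i l k is Γ applied to ⟨i⟩(⟨l⟩ ⧢ ⟨k⟩).
    Θ : ℕ → ℕ → ℕ → Carrier
    Θ i j m = Γ (suc (suc (i ℕ.+ j) ℕ.+ m) ∷ [])
      + ∑ (suc (suc (i ℕ.+ j) ℕ.+ m)) (λ l → d l (suc (i ℕ.+ j)) m * Γ ((suc (i ℕ.+ j) ℕ.+ m ∸ l) ∷ l ∷ []))
      + ∑ (suc (i ℕ.+ j)) (λ k → d k i j * (Γ (suc ((i ℕ.+ j ∸ k) ℕ.+ m) ∷ k ∷ [])
          + ∑ (suc ((i ℕ.+ j ∸ k) ℕ.+ m)) (λ l → d l (i ℕ.+ j ∸ k) m * Ψ ((i ℕ.+ j ∸ k) ℕ.+ m ∸ l) l k)))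

    -- With the later letters fixed, Γ becomes a sequence indexed by the first letter, which takes
    -- the place of `G`. In `Γ₃` the number n is the sum of the last two indices.
    Γ₂ : ℕ → ℕ → Carrier
    Γ₂ n i = Γ (i ∷ n ∷ [])

    Γ₃ : ℕ → ℕ → ℕ → Carrier
    Γ₃ n r i = Γ (i ∷ (n ∸ r) ∷ r ∷ [])

    -- A regrouping of `Θ` by the letters after the first. The ranges depend only on M, which will
    -- be i + j + m, so the exchange of j and m can be applied term by term.
    byDepth : ℕ → ℕ → ℕ → ℕ → Carrier
    byDepth M i j m = Γ (suc (suc M) ∷ []) + ∑ (suc (suc M)) (λ n → depth₂ i j m (Γ₂ n) n)
      + ∑ (suc M) (λ n → ∑ (suc n) (λ r → depth₃ i j m (Γ₃ n r) (n ∸ r) r))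

    byDepth-swap : ∀ M i j m → byDepth M i j m ≈ byDepth M i m j
    byDepth-swap M i j m = +-cong
      (+-congˡ (∑-cong (suc (suc M)) (λ n _ → depth₂-swap (Γ₂ n) n i j m)))
      (∑-cong (suc M) (λ n _ → ∑-cong (suc n) (λ r _ → depth₃-swap (Γ₃ n r) (n ∸ r) r i j m)))

    module _ (i j m : ℕ) where
      private
        ij = i ℕ.+ j
        M = ij ℕ.+ m

      -- The letter ⟨l+k+1⟩ of ⟨l⟩ ⧢ ⟨k⟩ leads to words of length two and so to `t₃`; the three
      -- kinds of two-letter words are the three summands of `depth₃`.
      ⨁-w-Ψ : ∀ n → ⨁ n (λ k l → w i j m (λ a → Ψ a l k) k l)
        ≈ t₃ i j m (Γ₂ (suc n)) (suc n) + ∑ (suc n) (λ r → depth₃ i j m (Γ₃ n r) (n ∸ r) r)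
      ⨁-w-Ψ n = begin
        ⨁ n (λ k l → W (λ a → Ψ a l k) k l)
          ≈⟨ ⨁-cong n expand ⟩
        ⨁ n (λ k l → W (Γ₃ n k) k l + W (Γ₃ n l) k l + (W (Γ₂ (suc n)) k l + ∑ (suc n) (λ r → d r l k * W (Γ₃ n r) k l)))
          ≈⟨ trans (⨁-+ n _ _) (+-cong (⨁-+ n _ _) (⨁-+ n _ _)) ⟩
        ⨁ n (λ k l → W (Γ₃ n k) k l) + ⨁ n (λ k l → W (Γ₃ n l) k l)
          + (⨁ n (W (Γ₂ (suc n))) + ⨁ n (λ k l → ∑ (suc n) (λ r → d r l k * W (Γ₃ n r) k l)))
          ≈⟨ +-cong (+-cong (⨁-∑ n _) (trans (⨁-swap n _) (⨁-∑ n _))) (+-congˡ (⨁-∑-comm n (suc n) _)) ⟩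
        ∑ (suc n) (λ r → W (Γ₃ n r) r (n ∸ r)) + ∑ (suc n) (λ r → W (Γ₃ n r) (n ∸ r) r)
          + (⨁ n (W (Γ₂ (suc n))) + ∑ (suc n) (λ r → ⨁ n (λ k l → d r l k * W (Γ₃ n r) k l)))
          ≈⟨ solve 4 (λ a b c e → a :+ b :+ (c :+ e) := c :+ (a :+ b :+ e)) refl _ _ _ _ ⟩
        ⨁ n (W (Γ₂ (suc n))) + (∑ (suc n) (λ r → W (Γ₃ n r) r (n ∸ r)) + ∑ (suc n) (λ r → W (Γ₃ n r) (n ∸ r) r)
          + ∑ (suc n) (λ r → ⨁ n (λ k l → d r l k * W (Γ₃ n r) k l)))
          ≈⟨ +-congˡ (trans (+-congʳ (sym (∑-+ (suc n) _ _))) (sym (∑-+ (suc n) _ _))) ⟩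
        ⨁ n (W (Γ₂ (suc n))) + ∑ (suc n) (λ r → W (Γ₃ n r) r (n ∸ r) + W (Γ₃ n r) (n ∸ r) r
          + ⨁ n (λ k l → d r l k * W (Γ₃ n r) k l))
          ≈⟨ +-congˡ (∑-cong (suc n) (λ r r<1+n → +-congˡ (reflexive
               (≡.cong (λ z → ⨁ z (λ k l → d r l k * W (Γ₃ n r) k l)) (≡.sym (ℕ.m∸n+n≡m (ℕ.s≤s⁻¹ r<1+n))))))) ⟩
        t₃ i j m (Γ₂ (suc n)) (suc n) + ∑ (suc n) (λ r → depth₃ i j m (Γ₃ n r) (n ∸ r) r) ∎
        where
        W = w i j m
        expand : ∀ k l → k ℕ.+ l ≡ n → W (λ a → Ψ a l k) k l ≈
          W (Γ₃ n k) k l + W (Γ₃ n l) k l + (W (Γ₂ (suc n)) k l + ∑ (suc n) (λ r → d r l k * W (Γ₃ n r) k l))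
        expand k l ≡.refl = begin
          W (λ a → Ψ a l k) k l
            ≈⟨ w-cong i j m k l (λ a → +-cong
                 (+-cong (reflexive (≡.cong (λ z → Γ (a ∷ z ∷ k ∷ [])) (≡.sym (ℕ.m+n∸m≡n k l))))
                         (reflexive (≡.cong (λ z → Γ (a ∷ z ∷ l ∷ [])) (≡.sym (ℕ.m+n∸n≡m k l)))))
                 (reflexive (≡.cong (λ z → Γ (a ∷ suc z ∷ []) + ∑ (suc z) (λ r → d r l k * Γ (a ∷ (z ∸ r) ∷ r ∷ []))) (ℕ.+-comm l k)))) ⟩
          W (λ a → Γ₃ n k a + Γ₃ n l a + (Γ₂ (suc n) a + ∑ (suc n) (λ r → d r l k * Γ₃ n r a))) k l
            ≈⟨ trans (w-add i j m k l _ _) (+-cong (w-add i j m k l _ _) (trans (w-add i j m k l _ _)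
                 (+-congˡ (trans (w-∑ i j m k l (suc n) (λ r a → d r l k * Γ₃ n r a))
                   (∑-cong (suc n) (λ r _ → w-scale i j m k l (d r l k) (Γ₃ n r))))))) ⟩
          W (Γ₃ n k) k l + W (Γ₃ n l) k l + (W (Γ₂ (suc n)) k l + ∑ (suc n) (λ r → d r l k * W (Γ₃ n r) k l)) ∎

      part₁ : ∑ (suc (suc M)) (λ l → d l (suc ij) m * Γ ((suc ij ℕ.+ m ∸ l) ∷ l ∷ []))
        ≈ ∑ (suc (suc M)) (λ n → t₁ i j m (Γ₂ n) n)
      part₁ = ∑-cong (suc (suc M)) (λ l l<2+M → *-congˡ (reflexive (≡.sym (shiftBy-∸ (Γ₂ l) (ℕ.s≤s⁻¹ l<2+M)))))

      part₂ : ∑ (suc ij) (λ k → d k i j * Γ (suc ((ij ∸ k) ℕ.+ m) ∷ k ∷ [])) ≈ ∑ (suc (suc M)) (λ n → t₂ i j m (Γ₂ n) n)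
      part₂ = trans
        (∑-cong (suc ij) (λ k k<1+ij → *-congˡ (reflexive (≡.sym (shiftBy-∸ (λ a → Γ₂ k (suc (a ℕ.+ m))) (ℕ.s≤s⁻¹ k<1+ij))))))
        -- Beyond k = i + j the shift vanishes, so the range can be enlarged to the one in `part₁`,
        -- which depends only on i + j + m.
        (∑-extend (ℕ.s≤s (ℕ.m≤n⇒m≤1+n (ℕ.m≤m+n ij m))) (λ n → t₂ i j m (Γ₂ n) n)
          (λ k ij<k → trans (*-congˡ (shiftBy-< (λ a → Γ₂ k (suc (a ℕ.+ m))) ij<k)) (zeroʳ _)))

      part₃ : ∑ (suc ij) (λ k → d k i j * ∑ (suc ((ij ∸ k) ℕ.+ m)) (λ l → d l (ij ∸ k) m * Ψ ((ij ∸ k) ℕ.+ m ∸ l) l k))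
        ≈ ∑ (suc M) (λ n → ⨁ n (λ k l → w i j m (λ a → Ψ a l k) k l))
      part₃ = begin
        ∑ (suc ij) (λ k → d k i j * ∑ (suc ((ij ∸ k) ℕ.+ m)) (λ l → d l (ij ∸ k) m * Ψ ((ij ∸ k) ℕ.+ m ∸ l) l k))
          ≈⟨ ∑-cong (suc ij) (λ k k<1+ij → inner k (ℕ.s≤s⁻¹ k<1+ij)) ⟩
        ∑ (suc ij) (λ k → ∑ (suc M ∸ k) (v k))
          ≈⟨ ∑-extend (ℕ.s≤s (ℕ.m≤m+n ij m)) (λ k → ∑ (suc M ∸ k) (v k))
               (λ k ij<k → ∑-0 (suc M ∸ k) (λ l _ → trans (*-congˡ (shiftBy-< {k} _ ij<k)) (zeroʳ _))) ⟩
        ∑ (suc M) (λ k → ∑ (suc M ∸ k) (v k))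
          ≈⟨ ∑-triangle (suc M) v ⟩
        ∑ (suc M) (λ n → ⨁ n v) ∎
        where
        v : ℕ → ℕ → Carrier
        v k l = w i j m (λ a → Ψ a l k) k l

        inner : ∀ k → k ℕ.≤ ij →
          d k i j * ∑ (suc ((ij ∸ k) ℕ.+ m)) (λ l → d l (ij ∸ k) m * Ψ ((ij ∸ k) ℕ.+ m ∸ l) l k) ≈ ∑ (suc M ∸ k) (v k)
        inner k k≤ij = begin
          d k i j * ∑ (suc ((ij ∸ k) ℕ.+ m)) (λ l → d l (ij ∸ k) m * Ψ ((ij ∸ k) ℕ.+ m ∸ l) l k)
            ≈⟨ ∑-*ˡ (suc ((ij ∸ k) ℕ.+ m)) (d k i j) _ ⟩
          ∑ (suc ((ij ∸ k) ℕ.+ m)) (λ l → d k i j * (d l (ij ∸ k) m * Ψ ((ij ∸ k) ℕ.+ m ∸ l) l k))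
            ≈⟨ ∑-cong (suc ((ij ∸ k) ℕ.+ m)) (λ l l< → *-congˡ (trans
                 (*-congˡ (reflexive (≡.sym (shiftBy-∸ (λ a → Ψ a l k) (ℕ.s≤s⁻¹ l<)))))
                 (reflexive (≡.sym (shiftBy-∸ (λ n → d l n m * shiftBy l (λ a → Ψ a l k) (n ℕ.+ m)) k≤ij))))) ⟩
          ∑ (suc ((ij ∸ k) ℕ.+ m)) (v k)
            ≡⟨ ≡.cong (λ z → ∑ z (v k)) (≡.trans (≡.sym (ℕ.+-suc (ij ∸ k) m))
                 (≡.trans (≡.sym (ℕ.+-∸-comm (suc m) k≤ij)) (≡.cong (_∸ k) (ℕ.+-suc ij m)))) ⟩
          ∑ (suc M ∸ k) (v k) ∎

      Θ-byDepth : Θ i j m ≈ byDepth M i j m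
      Θ-byDepth = begin
        Γ₁ + S₁ + ∑ (suc ij) (λ k → d k i j * (Γ (suc ((ij ∸ k) ℕ.+ m) ∷ k ∷ [])
          + ∑ (suc ((ij ∸ k) ℕ.+ m)) (λ l → d l (ij ∸ k) m * Ψ ((ij ∸ k) ℕ.+ m ∸ l) l k)))
          ≈⟨ +-congˡ (trans (∑-cong (suc ij) (λ k _ → distribˡ _ _ _)) (∑-+ (suc ij) _ _)) ⟩
        Γ₁ + S₁ + (∑ (suc ij) (λ k → d k i j * Γ (suc ((ij ∸ k) ℕ.+ m) ∷ k ∷ []))
          + ∑ (suc ij) (λ k → d k i j * ∑ (suc ((ij ∸ k) ℕ.+ m)) (λ l → d l (ij ∸ k) m * Ψ ((ij ∸ k) ℕ.+ m ∸ l) l k)))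
          ≈⟨ +-cong (+-congˡ part₁) (+-cong part₂ (trans part₃ (trans (∑-cong (suc M) (λ n _ → ⨁-w-Ψ n)) (∑-+ (suc M) _ _)))) ⟩
        Γ₁ + ∑ (suc (suc M)) (λ n → t₁ i j m (Γ₂ n) n) + (∑ (suc (suc M)) (λ n → t₂ i j m (Γ₂ n) n)
          + (∑ (suc M) (λ n → t₃ i j m (Γ₂ (suc n)) (suc n)) + S₃))
          -- The inserted zero is `t₃` at 0; with it all three sums of length-two terms have the
          -- same range.
          ≈⟨ solve 5 (λ g a b c s → g :+ a :+ (b :+ (c :+ s)) := g :+ (a :+ b :+ (con (ℤ.+ 0) :+ c)) :+ s) refl _ _ _ _ _ ⟩
        Γ₁ + (∑ (suc (suc M)) (λ n → t₁ i j m (Γ₂ n) n) + ∑ (suc (suc M)) (λ n → t₂ i j m (Γ₂ n) n)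
          + (t₃ i j m (Γ₂ 0) 0 + ∑ (suc M) (λ n → t₃ i j m (Γ₂ (suc n)) (suc n)))) + S₃
          ≈⟨ +-congʳ (+-congˡ (+-congˡ (∑-suc (suc M) (λ n → t₃ i j m (Γ₂ n) n)))) ⟨
        Γ₁ + (∑ (suc (suc M)) (λ n → t₁ i j m (Γ₂ n) n) + ∑ (suc (suc M)) (λ n → t₂ i j m (Γ₂ n) n)
          + ∑ (suc (suc M)) (λ n → t₃ i j m (Γ₂ n) n)) + S₃
          ≈⟨ +-congʳ (+-congˡ (trans (+-congʳ (sym (∑-+ (suc (suc M)) _ _))) (sym (∑-+ (suc (suc M)) _ (λ n → t₃ i j m (Γ₂ n) n))))) ⟩
        byDepth M i j m ∎
        where
        Γ₁ = Γ (suc (suc M) ∷ [])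
        S₁ = ∑ (suc (suc M)) (λ l → d l (suc ij) m * Γ ((suc ij ℕ.+ m ∸ l) ∷ l ∷ []))
        S₃ = ∑ (suc M) (λ n → ∑ (suc n) (λ r → depth₃ i j m (Γ₃ n r) (n ∸ r) r))

    Θ-swapʳ : ∀ i j m → Θ i j m ≈ Θ i m j
    Θ-swapʳ i j m = begin
      Θ i j m  ≈⟨ Θ-byDepth i j m ⟩
      byDepth (i ℕ.+ j ℕ.+ m) i j m  ≈⟨ byDepth-swap (i ℕ.+ j ℕ.+ m) i j m ⟩
      byDepth (i ℕ.+ j ℕ.+ m) i m j  ≡⟨ ≡.cong (λ M → byDepth M i m j) (ij+m i j m) ⟩
      byDepth (i ℕ.+ m ℕ.+ j) i m j  ≈⟨ Θ-byDepth i m j ⟨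
      Θ i m j  ∎
      where
      ij+m : ∀ i j m → i ℕ.+ j ℕ.+ m ≡ i ℕ.+ m ℕ.+ j
      ij+m i j m = ≡.trans (ℕ.+-assoc i j m) (≡.trans (≡.cong (i ℕ.+_) (ℕ.+-comm j m)) (≡.sym (ℕ.+-assoc i m j)))

    Θ-swapˡ : ∀ i j m → Θ i j m ≈ Θ j i m
    Θ-swapˡ i j m = trans
      (+-congˡ (∑-cong (suc (i ℕ.+ j)) (λ k _ → *-congʳ (d-comm k i j))))
      (reflexive (≡.cong (λ n → Γ (suc (suc n ℕ.+ m) ∷ [])
        + ∑ (suc (suc n ℕ.+ m)) (λ l → d l (suc n) m * Γ ((suc n ℕ.+ m ∸ l) ∷ l ∷ []))
        + ∑ (suc n) (λ k → d k j i * (Γ (suc ((n ∸ k) ℕ.+ m) ∷ k ∷ [])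
            + ∑ (suc ((n ∸ k) ℕ.+ m)) (λ l → d l (n ∸ k) m * Ψ ((n ∸ k) ℕ.+ m ∸ l) l k)))) (ℕ.+-comm i j)))

    -- The reversal is a product of the two adjacent transpositions. Given commutativity it
    -- expresses associativity for three letters.
    Θ-reverse : ∀ i j m → Θ i j m ≈ Θ m j i
    Θ-reverse i j m = trans (Θ-swapˡ i j m) (trans (Θ-swapʳ j i m) (Θ-swapˡ j m i))

-- Words

module Pairing {c ℓ : Level} (F : CommutativeRing c ℓ) (q : ℕ) where

  open RingTools F
  open WordAlgebra F q

  -- A list representing an element of ℭ may repeat words or contain zero coefficients. Equality is
  -- therefore tested by the linear extension of an arbitrary function on words.
  ⟪_,_⟫ : (Word → Carrier) → Poly → Carrier
  ⟪ g , [] ⟫          = 0#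
  ⟪ g , (a , u) ∷ P ⟫ = a * g u + ⟪ g , P ⟫

  ⟪⟫-congAll : ∀ {g h : Word → Carrier} {P} → All (λ au → g (proj₂ au) ≈ h (proj₂ au)) P → ⟪ g , P ⟫ ≈ ⟪ h , P ⟫
  ⟪⟫-congAll []       = refl
  ⟪⟫-congAll (e ∷ es) = +-cong (*-congˡ e) (⟪⟫-congAll es)

  ⟪⟫-cong : ∀ {g h : Word → Carrier} → (∀ u → g u ≈ h u) → ∀ P → ⟪ g , P ⟫ ≈ ⟪ h , P ⟫
  ⟪⟫-cong e []            = refl
  ⟪⟫-cong e ((a , u) ∷ P) = +-cong (*-congˡ (e u)) (⟪⟫-cong e P)

  ⟪⟫-+ : ∀ (g h : Word → Carrier) P → ⟪ (λ u → g u + h u) , P ⟫ ≈ ⟪ g , P ⟫ + ⟪ h , P ⟫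
  ⟪⟫-+ g h []            = sym (+-identityˡ 0#)
  ⟪⟫-+ g h ((a , u) ∷ P) = trans (+-congˡ (⟪⟫-+ g h P))
    (solve 5 (λ a x y z w → a :* (x :+ y) :+ (z :+ w) := a :* x :+ z :+ (a :* y :+ w)) refl a _ _ _ _)

  ⟪⟫-*ˡ : ∀ x (g : Word → Carrier) P → ⟪ (λ u → x * g u) , P ⟫ ≈ x * ⟪ g , P ⟫
  ⟪⟫-*ˡ x g []            = sym (zeroʳ x)
  ⟪⟫-*ˡ x g ((a , u) ∷ P) = trans (+-congˡ (⟪⟫-*ˡ x g P))
    (solve 4 (λ a x y z → a :* (x :* y) :+ x :* z := x :* (a :* y :+ z)) refl a x _ _)

  ⟪⟫-0 : ∀ P → ⟪ (λ _ → 0#) , P ⟫ ≈ 0#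
  ⟪⟫-0 P = trans (⟪⟫-cong (λ _ → sym (zeroˡ 0#)) P) (trans (⟪⟫-*ˡ 0# (λ _ → 0#) P) (zeroˡ _))

  ⟪⟫-∑ : ∀ n (g : ℕ → Word → Carrier) P → ⟪ (λ u → ∑ n (λ k → g k u)) , P ⟫ ≈ ∑ n (λ k → ⟪ g k , P ⟫)
  ⟪⟫-∑ zero    g P = trans (⟪⟫-cong (λ u → ∑-zero (λ k → g k u)) P) (trans (⟪⟫-0 P) (sym (∑-zero (λ k → ⟪ g k , P ⟫))))
  ⟪⟫-∑ (suc n) g P = trans (⟪⟫-cong (λ u → ∑-suc n (λ k → g k u)) P) (trans (⟪⟫-+ (g 0) _ P)
    (trans (+-congˡ (⟪⟫-∑ n (λ k → g (suc k)) P)) (sym (∑-suc n (λ k → ⟪ g k , P ⟫)))))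

  ⟪⟫-comm : ∀ (f : Word → Word → Carrier) P Q → ⟪ (λ u → ⟪ f u , Q ⟫) , P ⟫ ≈ ⟪ (λ v → ⟪ (λ u → f u v) , P ⟫) , Q ⟫
  ⟪⟫-comm f []            Q = sym (⟪⟫-0 Q)
  ⟪⟫-comm f ((a , u) ∷ P) Q = trans (+-cong (sym (⟪⟫-*ˡ a (f u) Q)) (⟪⟫-comm f P Q)) (sym (⟪⟫-+ _ _ Q))

  ⟪⟫-++ : ∀ (g : Word → Carrier) P Q → ⟪ g , P ++ Q ⟫ ≈ ⟪ g , P ⟫ + ⟪ g , Q ⟫
  ⟪⟫-++ g []            Q = sym (+-identityˡ _)
  ⟪⟫-++ g ((a , u) ∷ P) Q = trans (+-congˡ (⟪⟫-++ g P Q)) (sym (+-assoc _ _ _))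

  ⟪⟫-• : ∀ (g : Word → Carrier) k P → ⟪ g , k • P ⟫ ≈ k * ⟪ g , P ⟫
  ⟪⟫-• g k []            = sym (zeroʳ k)
  ⟪⟫-• g k ((a , u) ∷ P) = trans (+-cong (*-assoc _ _ _) (⟪⟫-• g k P)) (sym (distribˡ _ _ _))

  ⟪⟫-neg : ∀ (g : Word → Carrier) P → ⟪ g , -ₚ P ⟫ ≈ - ⟪ g , P ⟫
  ⟪⟫-neg g []            = sym -0#≈0#
  ⟪⟫-neg g ((a , u) ∷ P) = trans (+-congˡ (⟪⟫-neg g P))
    (solve 3 (λ a x y → (:- a) :* x :- y := :- (a :* x :+ y)) refl a _ _)

  ⟪⟫-prefix : ∀ (g : Word → Carrier) l P → ⟪ g , prefix l P ⟫ ≈ ⟪ (λ u → g (l ∷ u)) , P ⟫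
  ⟪⟫-prefix g l []            = refl
  ⟪⟫-prefix g l ((a , u) ∷ P) = +-congˡ (⟪⟫-prefix g l P)

  ⟪⟫-word : ∀ (g : Word → Carrier) u → ⟪ g , word u ⟫ ≈ g u
  ⟪⟫-word g u = trans (+-identityʳ _) (*-identityˡ _)

  ⟪⟫-linʳ : ∀ (g : Word → Carrier) f Q → ⟪ g , linʳ f Q ⟫ ≈ ⟪ (λ v → ⟪ g , f v ⟫) , Q ⟫
  ⟪⟫-linʳ g f []            = refl
  ⟪⟫-linʳ g f ((b , v) ∷ Q) = trans (⟪⟫-++ g (b • f v) (linʳ f Q)) (+-cong (⟪⟫-• g b (f v)) (⟪⟫-linʳ g f Q))

  ⟪⟫-bilin : ∀ (g : Word → Carrier) f P Q → ⟪ g , bilin f P Q ⟫ ≈ ⟪ (λ u → ⟪ (λ v → ⟪ g , f u v ⟫) , Q ⟫) , P ⟫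
  ⟪⟫-bilin g f []            Q = refl
  ⟪⟫-bilin g f ((a , u) ∷ P) Q = begin
    ⟪ g , bilin f ((a , u) ∷ P) Q ⟫  ≡⟨ ≡.cong ⟪ g ,_⟫ split ⟩
    ⟪ g , bilin f ((a , u) ∷ []) Q ++ bilin f P Q ⟫  ≈⟨ ⟪⟫-++ g (bilin f ((a , u) ∷ []) Q) (bilin f P Q) ⟩
    ⟪ g , bilin f ((a , u) ∷ []) Q ⟫ + ⟪ g , bilin f P Q ⟫  ≈⟨ +-cong (row Q) (⟪⟫-bilin g f P Q) ⟩
    a * ⟪ (λ v → ⟪ g , f u v ⟫) , Q ⟫ + _  ∎
    where
    split : bilin f ((a , u) ∷ P) Q ≡ bilin f ((a , u) ∷ []) Q ++ bilin f P Q
    split = List.concatMap-++ _ ((a , u) ∷ []) P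

    row : ∀ Q → ⟪ g , bilin f ((a , u) ∷ []) Q ⟫ ≈ a * ⟪ (λ v → ⟪ g , f u v ⟫) , Q ⟫
    row []            = sym (zeroʳ a)
    row ((b , v) ∷ Q) = begin
      ⟪ g , bilin f ((a , u) ∷ []) ((b , v) ∷ Q) ⟫  ≡⟨ ≡.cong ⟪ g ,_⟫ (List.++-assoc ((a * b) • f u v) _ []) ⟩
      ⟪ g , ((a * b) • f u v) ++ bilin f ((a , u) ∷ []) Q ⟫  ≈⟨ ⟪⟫-++ g ((a * b) • f u v) (bilin f ((a , u) ∷ []) Q) ⟩
      _  ≈⟨ +-cong (⟪⟫-• g (a * b) (f u v)) (row Q) ⟩
      a * b * ⟪ g , f u v ⟫ + a * ⟪ (λ v → ⟪ g , f u v ⟫) , Q ⟫ ≈⟨ solve 4 (λ a b x y → a :* b :* x :+ a :* y := a :* (b :* x :+ y)) refl a b _ _ ⟩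
      a * (b * ⟪ g , f u v ⟫ + ⟪ (λ v → ⟪ g , f u v ⟫) , Q ⟫)  ∎

  ⟪⟫-applyUpTo : ∀ (g : Word → Carrier) (f : ℕ → Poly) (h : ℕ → ℕ) n →
    ⟪ g , concatMap f (applyUpTo h n) ⟫ ≈ ∑ n (λ j → ⟪ g , f (h j) ⟫)
  ⟪⟫-applyUpTo g f h zero    = sym (∑-zero (λ j → ⟪ g , f (h j) ⟫))
  ⟪⟫-applyUpTo g f h (suc n) = trans (⟪⟫-++ g (f (h 0)) _)
    (trans (+-congˡ (⟪⟫-applyUpTo g f (λ i → h (suc i)) n)) (sym (∑-suc n (λ j → ⟪ g , f (h j) ⟫))))

  private
    _≟_ = List.≡-dec ℕ._≟_

  indicator : Word → Word → Carrier
  indicator w u with u ≟ w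
  ... | yes _ = 1#
  ... | no  _ = 0#

  coeff-⟪⟫ : ∀ P w → coeff P w ≈ ⟪ indicator w , P ⟫
  coeff-⟪⟫ []            w = refl
  coeff-⟪⟫ ((a , u) ∷ P) w with u ≟ w
  ... | yes _ = +-cong (sym (*-identityʳ a)) (coeff-⟪⟫ P w)
  ... | no  _ = trans (coeff-⟪⟫ P w) (trans (sym (+-identityˡ _)) (+-congʳ (sym (zeroʳ a))))

  ⟪⟫⇒≈ₚ : ∀ {P Q} → (∀ g → ⟪ g , P ⟫ ≈ ⟪ g , Q ⟫) → P ≈ₚ Q
  ⟪⟫⇒≈ₚ {P} {Q} e w = trans (coeff-⟪⟫ P w) (trans (e (indicator w)) (sym (coeff-⟪⟫ Q w)))

  -- Deleting all occurrences of one word shortens the list, so ⟪ g , P ⟫ = 0 for P ≈ₚ 0 by induction on the length.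
  remove : Word → Poly → Poly
  remove w []            = []
  remove w ((a , u) ∷ P) with u ≟ w
  ... | yes _ = remove w P
  ... | no  _ = (a , u) ∷ remove w P

  remove-⟪⟫ : ∀ g w P → ⟪ g , P ⟫ ≈ coeff P w * g w + ⟪ g , remove w P ⟫
  remove-⟪⟫ g w [] = solve 1 (λ x → con (+ 0) := con (+ 0) :* x :+ con (+ 0)) refl (g w)
  remove-⟪⟫ g w ((a , u) ∷ P) with u ≟ w
  ... | yes ≡.refl = trans (+-congˡ (remove-⟪⟫ g w P))
    (solve 4 (λ a c x y → a :* x :+ (c :* x :+ y) := (a :+ c) :* x :+ y) refl a _ (g w) _)
  ... | no  _ = trans (+-congˡ (remove-⟪⟫ g w P))
    (solve 3 (λ x y z → x :+ (y :+ z) := y :+ (x :+ z)) refl _ _ _)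

  coeff-remove-same : ∀ w P → coeff (remove w P) w ≈ 0#
  coeff-remove-same w [] = refl
  coeff-remove-same w ((a , u) ∷ P) with u ≟ w
  ... | yes _ = coeff-remove-same w P
  ... | no u≢w with u ≟ w
  ...   | yes u≡w = ⊥-elim (u≢w u≡w)
  ...   | no  _   = coeff-remove-same w P

  coeff-remove-other : ∀ w v P → ¬ v ≡ w → coeff (remove w P) v ≈ coeff P v
  coeff-remove-other w v [] v≢w = refl
  coeff-remove-other w v ((a , u) ∷ P) v≢w with u ≟ w
  coeff-remove-other w v ((a , u) ∷ P) v≢w | yes u≡w with u ≟ v
  ... | yes u≡v = ⊥-elim (v≢w (≡.trans (≡.sym u≡v) u≡w))
  ... | no  _   = coeff-remove-other w v P v≢w
  coeff-remove-other w v ((a , u) ∷ P) v≢w | no _ with u ≟ v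
  ... | yes _ = +-congˡ (coeff-remove-other w v P v≢w)
  ... | no  _ = coeff-remove-other w v P v≢w

  length-remove : ∀ w P → length (remove w P) ℕ.≤ length P
  length-remove w [] = ℕ.z≤n
  length-remove w ((a , u) ∷ P) with u ≟ w
  ... | yes _ = ℕ.m≤n⇒m≤1+n (length-remove w P)
  ... | no  _ = ℕ.s≤s (length-remove w P)

  vanishing : ∀ g n P → length P ℕ.≤ n → P ≈ₚ 0ₚ → ⟪ g , P ⟫ ≈ 0#
  vanishing g n       []              _         P≈0 = refl
  vanishing g (suc n) P@((a , u) ∷ P′) (ℕ.s≤s l) P≈0 = begin
    ⟪ g , P ⟫  ≈⟨ remove-⟪⟫ g u P ⟩
    coeff P u * g u + ⟪ g , remove u P ⟫  ≈⟨ +-cong (trans (*-congʳ (P≈0 u)) (zeroˡ _)) (vanishing g n (remove u P) shorter removed≈0) ⟩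
    0# + 0#  ≈⟨ +-identityˡ 0# ⟩
    0#  ∎
    where
    shorter : length (remove u P) ℕ.≤ n
    shorter with u ≟ u
    ... | yes _   = ℕ.≤-trans (length-remove u P′) l
    ... | no  u≢u = ⊥-elim (u≢u ≡.refl)

    removed≈0 : remove u P ≈ₚ 0ₚ
    removed≈0 w with w ≟ u
    ... | yes ≡.refl = coeff-remove-same w P
    ... | no  w≢u    = trans (coeff-remove-other u w P w≢u) (P≈0 w)

  -- The pairing is computed from a list, so its dependence on the coefficients alone has to be
  -- proved; `vanishing` does so for the difference.
  ≈ₚ⇒⟪⟫ : ∀ {P Q} → P ≈ₚ Q → ∀ g → ⟪ g , P ⟫ ≈ ⟪ g , Q ⟫
  ≈ₚ⇒⟪⟫ {P} {Q} P≈Q g = begin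
    ⟪ g , P ⟫  ≈⟨ solve 2 (λ x y → x := (x :- y) :+ y) refl _ ⟪ g , Q ⟫ ⟩
    (⟪ g , P ⟫ - ⟪ g , Q ⟫) + ⟪ g , Q ⟫  ≈⟨ +-congʳ (trans (⟪⟫-++ g P (-ₚ Q)) (+-congˡ (⟪⟫-neg g Q))) ⟨
    ⟪ g , P +ₚ -ₚ Q ⟫ + ⟪ g , Q ⟫  ≈⟨ +-congʳ (vanishing g _ (P +ₚ -ₚ Q) ℕ.≤-refl difference≈0) ⟩
    0# + ⟪ g , Q ⟫  ≈⟨ +-identityˡ _ ⟩
    ⟪ g , Q ⟫  ∎
    where
    difference≈0 : P +ₚ -ₚ Q ≈ₚ 0ₚ
    difference≈0 w = begin
      coeff (P +ₚ -ₚ Q) w  ≈⟨ coeff-⟪⟫ (P +ₚ -ₚ Q) w ⟩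
      ⟪ indicator w , P +ₚ -ₚ Q ⟫  ≈⟨ trans (⟪⟫-++ _ P (-ₚ Q)) (+-congˡ (⟪⟫-neg _ Q)) ⟩
      ⟪ indicator w , P ⟫ - ⟪ indicator w , Q ⟫  ≈⟨ +-cong (coeff-⟪⟫ P w) (-‿cong (coeff-⟪⟫ Q w)) ⟨
      coeff P w - coeff Q w  ≈⟨ +-congʳ (P≈Q w) ⟩
      coeff Q w - coeff Q w  ≈⟨ -‿inverseʳ _ ⟩
      0#  ∎

  -- The hypotheses are the laws for words, each tested on all functionals; bilinearity extends them
  -- to ℭ.
  module _ (f : Word → Word → Poly)
    (f-identity : ∀ g v → ⟪ g , f [] v ⟫ ≈ g v)
    (f-comm : ∀ g u v → ⟪ g , f u v ⟫ ≈ ⟪ g , f v u ⟫)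
    (f-assoc : ∀ g u v w → ⟪ (λ y → ⟪ g , f y w ⟫) , f u v ⟫ ≈ ⟪ (λ y → ⟪ g , f u y ⟫) , f v w ⟫) where

    private
      infixl 7 _∙_
      _∙_ : Poly → Poly → Poly
      _∙_ = bilin f

      ⟪⟫-∙ : ∀ g P Q → ⟪ g , P ∙ Q ⟫ ≈ ⟪ (λ u → ⟪ (λ v → ⟪ g , f u v ⟫) , Q ⟫) , P ⟫
      ⟪⟫-∙ g = ⟪⟫-bilin g f

    +ₚ-cong : ∀ {P P′ Q Q′} → P ≈ₚ P′ → Q ≈ₚ Q′ → P +ₚ Q ≈ₚ P′ +ₚ Q′
    +ₚ-cong {P} {P′} {Q} {Q′} e e′ = ⟪⟫⇒≈ₚ {P +ₚ Q} {P′ +ₚ Q′} (λ g → trans (⟪⟫-++ g P Q)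
      (trans (+-cong (≈ₚ⇒⟪⟫ {P} {P′} e g) (≈ₚ⇒⟪⟫ {Q} {Q′} e′ g)) (sym (⟪⟫-++ g P′ Q′))))

    +ₚ-comm : ∀ P Q → P +ₚ Q ≈ₚ Q +ₚ P
    +ₚ-comm P Q = ⟪⟫⇒≈ₚ {P +ₚ Q} {Q +ₚ P} (λ g → trans (⟪⟫-++ g P Q) (trans (+-comm _ _) (sym (⟪⟫-++ g Q P))))

    -ₚ-cong : ∀ {P Q} → P ≈ₚ Q → -ₚ P ≈ₚ -ₚ Q
    -ₚ-cong {P} {Q} e = ⟪⟫⇒≈ₚ { -ₚ P } { -ₚ Q } (λ g → trans (⟪⟫-neg g P) (trans (-‿cong (≈ₚ⇒⟪⟫ {P} {Q} e g)) (sym (⟪⟫-neg g Q))))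

    -ₚ-inverseʳ : ∀ P → P +ₚ -ₚ P ≈ₚ 0ₚ
    -ₚ-inverseʳ P = ⟪⟫⇒≈ₚ {P +ₚ -ₚ P} {0ₚ} (λ g → trans (⟪⟫-++ g P (-ₚ P)) (trans (+-congˡ (⟪⟫-neg g P)) (-‿inverseʳ _)))

    -ₚ-inverseˡ : ∀ P → -ₚ P +ₚ P ≈ₚ 0ₚ
    -ₚ-inverseˡ P w = trans (+ₚ-comm (-ₚ P) P w) (-ₚ-inverseʳ P w)

    ∙-cong : ∀ {P P′ Q Q′} → P ≈ₚ P′ → Q ≈ₚ Q′ → P ∙ Q ≈ₚ P′ ∙ Q′
    ∙-cong {P} {P′} {Q} {Q′} e e′ = ⟪⟫⇒≈ₚ {P ∙ Q} {P′ ∙ Q′} (λ g → begin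
      ⟪ g , P ∙ Q ⟫  ≈⟨ ⟪⟫-∙ g P Q ⟩
      ⟪ (λ u → ⟪ (λ v → ⟪ g , f u v ⟫) , Q ⟫) , P ⟫  ≈⟨ ≈ₚ⇒⟪⟫ {P} {P′} e _ ⟩
      ⟪ (λ u → ⟪ (λ v → ⟪ g , f u v ⟫) , Q ⟫) , P′ ⟫  ≈⟨ ⟪⟫-cong (λ u → ≈ₚ⇒⟪⟫ {Q} {Q′} e′ _) P′ ⟩
      ⟪ (λ u → ⟪ (λ v → ⟪ g , f u v ⟫) , Q′ ⟫) , P′ ⟫  ≈⟨ ⟪⟫-∙ g P′ Q′ ⟨
      ⟪ g , P′ ∙ Q′ ⟫  ∎)

    ∙-comm : ∀ P Q → P ∙ Q ≈ₚ Q ∙ P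
    ∙-comm P Q = ⟪⟫⇒≈ₚ {P ∙ Q} {Q ∙ P} (λ g → begin
      ⟪ g , P ∙ Q ⟫  ≈⟨ ⟪⟫-∙ g P Q ⟩
      ⟪ (λ u → ⟪ (λ v → ⟪ g , f u v ⟫) , Q ⟫) , P ⟫  ≈⟨ ⟪⟫-comm _ P Q ⟩
      ⟪ (λ v → ⟪ (λ u → ⟪ g , f u v ⟫) , P ⟫) , Q ⟫  ≈⟨ ⟪⟫-cong (λ v → ⟪⟫-cong (λ u → f-comm g u v) P) Q ⟩
      ⟪ (λ v → ⟪ (λ u → ⟪ g , f v u ⟫) , P ⟫) , Q ⟫  ≈⟨ ⟪⟫-∙ g Q P ⟨
      ⟪ g , Q ∙ P ⟫  ∎)

    ∙-assoc : ∀ P Q R → (P ∙ Q) ∙ R ≈ₚ P ∙ (Q ∙ R)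
    ∙-assoc P Q R = ⟪⟫⇒≈ₚ {(P ∙ Q) ∙ R} {P ∙ (Q ∙ R)} (λ g → begin
      ⟪ g , (P ∙ Q) ∙ R ⟫
        ≈⟨ trans (⟪⟫-∙ g (P ∙ Q) R) (⟪⟫-∙ _ P Q) ⟩
      ⟪ (λ u → ⟪ (λ v → ⟪ (λ y → ⟪ (λ w → ⟪ g , f y w ⟫) , R ⟫) , f u v ⟫) , Q ⟫) , P ⟫
        ≈⟨ ⟪⟫-cong (λ u → ⟪⟫-cong (λ v → trans (⟪⟫-comm _ (f u v) R) (⟪⟫-cong (λ w → f-assoc g u v w) R)) Q) P ⟩
      ⟪ (λ u → ⟪ (λ v → ⟪ (λ w → ⟪ (λ y → ⟪ g , f u y ⟫) , f v w ⟫) , R ⟫) , Q ⟫) , P ⟫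
        ≈⟨ trans (⟪⟫-∙ g P (Q ∙ R)) (⟪⟫-cong (λ u → ⟪⟫-∙ _ Q R) P) ⟨
      ⟪ g , P ∙ (Q ∙ R) ⟫ ∎)

    ∙-identityˡ : ∀ P → 1ₚ ∙ P ≈ₚ P
    ∙-identityˡ P = ⟪⟫⇒≈ₚ {1ₚ ∙ P} {P} (λ g → begin
      ⟪ g , 1ₚ ∙ P ⟫  ≈⟨ ⟪⟫-∙ g 1ₚ P ⟩
      ⟪ (λ u → ⟪ (λ v → ⟪ g , f u v ⟫) , P ⟫) , word [] ⟫  ≈⟨ ⟪⟫-word (λ u → ⟪ (λ v → ⟪ g , f u v ⟫) , P ⟫) [] ⟩
      ⟪ (λ v → ⟪ g , f [] v ⟫) , P ⟫  ≈⟨ ⟪⟫-cong (f-identity g) P ⟩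
      ⟪ g , P ⟫  ∎)

    ∙-distribʳ : ∀ P Q R → (Q +ₚ R) ∙ P ≈ₚ (Q ∙ P) +ₚ (R ∙ P)
    ∙-distribʳ P Q R = ⟪⟫⇒≈ₚ {(Q +ₚ R) ∙ P} {(Q ∙ P) +ₚ (R ∙ P)} (λ g → begin
      ⟪ g , (Q +ₚ R) ∙ P ⟫  ≈⟨ trans (⟪⟫-∙ g (Q +ₚ R) P) (⟪⟫-++ _ Q R) ⟩
      ⟪ (λ u → ⟪ (λ v → ⟪ g , f u v ⟫) , P ⟫) , Q ⟫ + ⟪ (λ u → ⟪ (λ v → ⟪ g , f u v ⟫) , P ⟫) , R ⟫
                                                  ≈⟨ +-cong (⟪⟫-∙ g Q P) (⟪⟫-∙ g R P) ⟨
      ⟪ g , Q ∙ P ⟫ + ⟪ g , R ∙ P ⟫  ≈⟨ ⟪⟫-++ g (Q ∙ P) (R ∙ P) ⟨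
      ⟪ g , (Q ∙ P) +ₚ (R ∙ P) ⟫  ∎)

    ∙-distribˡ : ∀ P Q R → P ∙ (Q +ₚ R) ≈ₚ (P ∙ Q) +ₚ (P ∙ R)
    ∙-distribˡ P Q R w = trans (∙-comm P (Q +ₚ R) w) (trans (∙-distribʳ P Q R w)
      (+ₚ-cong {Q ∙ P} {P ∙ Q} {R ∙ P} {P ∙ R} (∙-comm Q P) (∙-comm R P) w))

    •-cong : ∀ {k k′ P P′} → k ≈ k′ → P ≈ₚ P′ → k • P ≈ₚ k′ • P′
    •-cong {k} {k′} {P} {P′} e e′ = ⟪⟫⇒≈ₚ {k • P} {k′ • P′} (λ g → trans (⟪⟫-• g k P)
      (trans (*-cong e (≈ₚ⇒⟪⟫ {P} {P′} e′ g)) (sym (⟪⟫-• g k′ P′))))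

    •-distribʳ : ∀ P k l → (k + l) • P ≈ₚ (k • P) +ₚ (l • P)
    •-distribʳ P k l = ⟪⟫⇒≈ₚ {(k + l) • P} {(k • P) +ₚ (l • P)} (λ g → trans (⟪⟫-• g (k + l) P)
      (trans (distribʳ _ _ _) (sym (trans (⟪⟫-++ g (k • P) (l • P)) (+-cong (⟪⟫-• g k P) (⟪⟫-• g l P))))))

    •-assoc : ∀ k l P → (k * l) • P ≈ₚ k • (l • P)
    •-assoc k l P = ⟪⟫⇒≈ₚ {(k * l) • P} {k • (l • P)} (λ g → trans (⟪⟫-• g (k * l) P)
      (trans (*-assoc _ _ _) (sym (trans (⟪⟫-• g k (l • P)) (*-congˡ (⟪⟫-• g l P))))))

    •-comm : ∀ k l P → k • (l • P) ≈ₚ l • (k • P)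
    •-comm k l P = ⟪⟫⇒≈ₚ {k • (l • P)} {l • (k • P)} (λ g → begin
      ⟪ g , k • (l • P) ⟫  ≈⟨ trans (⟪⟫-• g k (l • P)) (*-congˡ (⟪⟫-• g l P)) ⟩
      k * (l * ⟪ g , P ⟫)  ≈⟨ solve 3 (λ k l x → k :* (l :* x) := l :* (k :* x)) refl k l _ ⟩
      l * (k * ⟪ g , P ⟫)  ≈⟨ trans (⟪⟫-• g l (k • P)) (*-congˡ (⟪⟫-• g k P)) ⟨
      ⟪ g , l • (k • P) ⟫  ∎)

    •-distribˡ : ∀ k P Q → k • (P +ₚ Q) ≈ₚ (k • P) +ₚ (k • Q)
    •-distribˡ k P Q = ⟪⟫⇒≈ₚ {k • (P +ₚ Q)} {(k • P) +ₚ (k • Q)} (λ g → begin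
      ⟪ g , k • (P +ₚ Q) ⟫  ≈⟨ trans (⟪⟫-• g k (P +ₚ Q)) (*-congˡ (⟪⟫-++ g P Q)) ⟩
      k * (⟪ g , P ⟫ + ⟪ g , Q ⟫)  ≈⟨ distribˡ _ _ _ ⟩
      k * ⟪ g , P ⟫ + k * ⟪ g , Q ⟫  ≈⟨ trans (⟪⟫-++ g (k • P) (k • Q)) (+-cong (⟪⟫-• g k P) (⟪⟫-• g k Q)) ⟨
      ⟪ g , (k • P) +ₚ (k • Q) ⟫  ∎)

    •-identity : ∀ P → 1# • P ≈ₚ P
    •-identity P = ⟪⟫⇒≈ₚ {1# • P} {P} (λ g → trans (⟪⟫-• g 1# P) (*-identityˡ _))

    •-zeroˡ : ∀ P → 0# • P ≈ₚ 0ₚ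
    •-zeroˡ P = ⟪⟫⇒≈ₚ {0# • P} {0ₚ} (λ g → trans (⟪⟫-• g 0# P) (zeroˡ _))

    •-∙-assoc′ : ∀ k P Q → k • (P ∙ Q) ≈ₚ (k • P) ∙ Q
    •-∙-assoc′ k P Q = ⟪⟫⇒≈ₚ {k • (P ∙ Q)} {(k • P) ∙ Q} (λ g → begin
      ⟪ g , k • (P ∙ Q) ⟫  ≈⟨ trans (⟪⟫-• g k (P ∙ Q)) (*-congˡ (⟪⟫-∙ g P Q)) ⟩
      k * ⟪ (λ u → ⟪ (λ v → ⟪ g , f u v ⟫) , Q ⟫) , P ⟫  ≈⟨ trans (⟪⟫-∙ g (k • P) Q) (⟪⟫-• _ k P) ⟨
      ⟪ g , (k • P) ∙ Q ⟫  ∎)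

    isCommutativeAlgebra : IsCommutativeAlgebra (bilin f)
    isCommutativeAlgebra = record
      { isCommutativeRing = record
        { isRing = record
          { +-isAbelianGroup = record
            { isGroup = record
              { isMonoid = isMonoid
              ; inverse = -ₚ-inverseˡ , -ₚ-inverseʳ
              ; ⁻¹-cong = λ {P} {Q} → -ₚ-cong {P} {Q}
              }
            ; comm = +ₚ-comm
            }
          ; *-cong = λ {P} {P′} {Q} {Q′} → ∙-cong {P} {P′} {Q} {Q′}
          ; *-assoc = ∙-assoc
          ; *-identity = ∙-identityˡ , (λ P w → trans (∙-comm P 1ₚ w) (∙-identityˡ P w))
          ; distrib = ∙-distribˡ , ∙-distribʳ
          }
        ; *-comm = ∙-comm
        }
      ; isModule = record
        { isBimodule = record
          { isBisemimodule = record
            { +ᴹ-isCommutativeMonoid = record { isMonoid = isMonoid ; comm = +ₚ-comm }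
            ; isPreleftSemimodule = record
              { *ₗ-cong = λ {k} {k′} {P} {P′} → •-cong {k} {k′} {P} {P′}
              ; *ₗ-zeroˡ = •-zeroˡ
              ; *ₗ-distribʳ = •-distribʳ
              ; *ₗ-identityˡ = •-identity
              ; *ₗ-assoc = •-assoc
              ; *ₗ-zeroʳ = λ _ _ → refl
              ; *ₗ-distribˡ = •-distribˡ
              }
            ; isPrerightSemimodule = record
              { *ᵣ-cong = λ {P} {P′} {k} {k′} e e′ → •-cong {k} {k′} {P} {P′} e′ e
              ; *ᵣ-zeroʳ = •-zeroˡ
              ; *ᵣ-distribˡ = •-distribʳ
              ; *ᵣ-identityʳ = •-identity
              ; *ᵣ-assoc = λ P k l w → trans (•-comm l k P w) (sym (•-assoc k l P w))
              ; *ᵣ-zeroˡ = λ _ _ → refl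
              ; *ᵣ-distribʳ = •-distribˡ
              }
            ; *ₗ-*ᵣ-assoc = λ k P l → •-comm l k P
            }
          ; -ᴹ‿cong = λ {P} {Q} → -ₚ-cong {P} {Q}
          ; -ᴹ‿inverse = -ₚ-inverseˡ , -ₚ-inverseʳ
          }
        ; *ₗ-*ᵣ-coincident = λ _ _ _ → refl
        }
      ; •-∙-assoc = •-∙-assoc′
      }
      where
      isMonoid : IsMonoid _≈ₚ_ _+ₚ_ 0ₚ
      isMonoid = record
        { isSemigroup = record
          { isMagma = record
            { isEquivalence = record
              { refl = λ w → refl ; sym = λ e w → sym (e w) ; trans = λ e e′ w → trans (e w) (e′ w) }
            ; ∙-cong = λ {P} {P′} {Q} {Q′} → +ₚ-cong {P} {P′} {Q} {Q′}
            }
          ; assoc = λ P Q R w → reflexive (≡.cong (λ S → coeff S w) (List.++-assoc P Q R))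
          }
        ; identity = (λ P w → refl) , (λ P w → reflexive (≡.cong (λ S → coeff S w) (List.++-identityʳ P)))
        }

-- Independence of the products from the fuel

module Fuel {c ℓ : Level} (F : CommutativeRing c ℓ) (q : ℕ) where

  open WordAlgebra F q

  Bounded : ℕ → Poly → Set c
  Bounded N = All (λ au → length (proj₂ au) ℕ.≤ N)

  bounded-mono : ∀ {M N P} → M ℕ.≤ N → Bounded M P → Bounded N P
  bounded-mono M≤N = All.map (λ u≤M → ℕ.≤-trans u≤M M≤N)

  bounded-word : ∀ u → Bounded (length u) (word u)
  bounded-word u = ℕ.≤-refl ∷ []

  bounded-prefix : ∀ {N} l P → Bounded N P → Bounded (suc N) (prefix l P)
  bounded-prefix l []      []       = []
  bounded-prefix l (_ ∷ P) (b ∷ bs) = ℕ.s≤s b ∷ bounded-prefix l P bs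

  bounded-• : ∀ {N} k P → Bounded N P → Bounded N (k • P)
  bounded-• k []      []       = []
  bounded-• k (_ ∷ P) (b ∷ bs) = b ∷ bounded-• k P bs

  bounded-linʳ : ∀ {M N} f Q → (∀ v → length v ℕ.≤ N → Bounded M (f v)) → Bounded N Q → Bounded M (linʳ f Q)
  bounded-linʳ f []            f≤ []       = []
  bounded-linʳ f ((b , v) ∷ Q) f≤ (l ∷ ls) = All.++⁺ (bounded-• b (f v) (f≤ v l)) (bounded-linʳ f Q f≤ ls)

  bounded-concatMap : ∀ {N} (f : ℕ → Poly) js → (∀ j → Bounded N (f j)) → Bounded N (concatMap f js)
  bounded-concatMap f []       f≤ = []
  bounded-concatMap f (j ∷ js) f≤ = All.++⁺ (f≤ j) (bounded-concatMap f js f≤)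

  -- The product ◇ recurses into the words that occur in a shuffle, so their lengths have to be
  -- controlled before any fuel estimate.
  shF-bounded : ∀ n u v → Bounded (length u ℕ.+ length v) (shF n u v)
  dmF-bounded : ∀ n u v → Bounded (length u ℕ.+ length v) (dmF n u v)

  shF-bounded n       []      v       = bounded-word v
  shF-bounded zero    (a ∷ u) []      = bounded-mono (ℕ.m≤m+n _ 0) (bounded-word (a ∷ u))
  shF-bounded (suc n) (a ∷ u) []      = bounded-mono (ℕ.m≤m+n _ 0) (bounded-word (a ∷ u))
  shF-bounded zero    (a ∷ u) (b ∷ v) = []
  shF-bounded (suc n) (a ∷ u) (b ∷ v) = All.++⁺ (All.++⁺
    (bounded-prefix a _ (shF-bounded n u (b ∷ v)))
    (bounded-mono (ℕ.≤-reflexive (≡.cong suc (≡.sym (ℕ.+-suc _ _)))) (bounded-prefix b _ (shF-bounded n (a ∷ u) v))))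
    (dmF-bounded n (a ∷ u) (b ∷ v))

  dmF-bounded n       []      v       = bounded-word v
  dmF-bounded zero    (a ∷ u) []      = bounded-mono (ℕ.m≤m+n _ 0) (bounded-word (a ∷ u))
  dmF-bounded (suc n) (a ∷ u) []      = bounded-mono (ℕ.m≤m+n _ 0) (bounded-word (a ∷ u))
  dmF-bounded zero    (a ∷ u) (b ∷ v) = []
  dmF-bounded (suc n) (a ∷ u) (b ∷ v) = All.++⁺
    (bounded-mono (ℕ.s≤s (ℕ.+-monoʳ-≤ (length u) (ℕ.n≤1+n _))) (bounded-prefix _ _ (shF-bounded n u v)))
    (bounded-concatMap _ (upTo (suc a ℕ.+ suc b)) (λ j → bounded-• _ _
      (bounded-mono (ℕ.≤-reflexive (≡.cong suc (≡.sym (ℕ.+-suc (length u) (length v)))))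
        (bounded-prefix _ _ (bounded-linʳ (shF n (x j ∷ [])) (shF n u v)
          (λ w w≤ → bounded-mono (ℕ.s≤s w≤) (shF-bounded n (x j ∷ []) w)) (shF-bounded n u v))))))

  linʳ-congAll : ∀ {f g : Word → Poly} {Q} → All (λ bv → f (proj₂ bv) ≡ g (proj₂ bv)) Q → linʳ f Q ≡ linʳ g Q
  linʳ-congAll []                  = ≡.refl
  linʳ-congAll {Q = (b , v) ∷ _} (e ∷ es) = ≡.cong₂ _++_ (≡.cong (b •_) e) (linʳ-congAll es)

  2*-pred : ∀ {x n} → 2 ℕ.* suc x ℕ.≤ suc (suc n) → 2 ℕ.* x ℕ.≤ n
  2*-pred {x} {n} le = ℕ.s≤s⁻¹ (ℕ.s≤s⁻¹ (≡.subst (ℕ._≤ suc (suc n)) (ℕ.*-suc 2 x) le))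

  2*suc≰1 : ∀ {x} → ¬ (2 ℕ.* suc x ℕ.≤ 1)
  2*suc≰1 {x} le with ≡.subst (ℕ._≤ 1) (ℕ.*-suc 2 x) le
  ... | ℕ.s≤s ()

  -- Passing from ⧢ to ◇ costs one unit at equal total length, and every other recursive call costs
  -- one unit and shortens the words. Two units per letter therefore suffice, and ◇ may start with
  -- one unit less.
  shF-fuel : ∀ n m u v → 2 ℕ.* (length u ℕ.+ length v) ℕ.≤ n → 2 ℕ.* (length u ℕ.+ length v) ℕ.≤ m →
    shF n u v ≡ shF m u v
  dmF-fuel : ∀ n m u v → 2 ℕ.* (length u ℕ.+ length v) ℕ.≤ suc n → 2 ℕ.* (length u ℕ.+ length v) ℕ.≤ suc m →
    dmF n u v ≡ dmF m u v

  shF-fuel n       m       []      v  _ _ = ≡.refl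
  shF-fuel zero    zero    (a ∷ u) v  _ _ = ≡.refl
  shF-fuel zero    (suc m) (a ∷ u) [] _ _ = ≡.refl
  shF-fuel (suc n) zero    (a ∷ u) [] _ _ = ≡.refl
  shF-fuel (suc n) (suc m) (a ∷ u) [] _ _ = ≡.refl
  shF-fuel zero    (suc m) (a ∷ u) (b ∷ v) () _
  shF-fuel (suc n) zero    (a ∷ u) (b ∷ v) _ ()
  shF-fuel (suc n) (suc m) (a ∷ u) (b ∷ v) n≥ m≥ = ≡.cong₂ _++_ (≡.cong₂ _++_
    (≡.cong (prefix a) (shF-fuel n m u (b ∷ v) (2*-pred (ℕ.m≤n⇒m≤1+n n≥)) (2*-pred (ℕ.m≤n⇒m≤1+n m≥))))
    (≡.cong (prefix b) (shF-fuel n m (a ∷ u) v (shorter (2*-pred (ℕ.m≤n⇒m≤1+n n≥))) (shorter (2*-pred (ℕ.m≤n⇒m≤1+n m≥))))))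
    (dmF-fuel n m (a ∷ u) (b ∷ v) n≥ m≥)
    where
    shorter : ∀ {k} → 2 ℕ.* (length u ℕ.+ suc (length v)) ℕ.≤ k → 2 ℕ.* (suc (length u) ℕ.+ length v) ℕ.≤ k
    shorter {k} = ≡.subst (λ z → 2 ℕ.* z ℕ.≤ k) (ℕ.+-suc (length u) (length v))

  dmF-fuel n       m       []      v  _ _ = ≡.refl
  dmF-fuel zero    zero    (a ∷ u) v  _ _ = ≡.refl
  dmF-fuel zero    (suc m) (a ∷ u) [] _ _ = ≡.refl
  dmF-fuel (suc n) zero    (a ∷ u) [] _ _ = ≡.refl
  dmF-fuel (suc n) (suc m) (a ∷ u) [] _ _ = ≡.refl
  dmF-fuel zero    (suc m) (a ∷ u) (b ∷ v) n≥ _ = ⊥-elim (2*suc≰1 {length u ℕ.+ suc (length v)} n≥)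
  dmF-fuel (suc n) zero    (a ∷ u) (b ∷ v) _ m≥ = ⊥-elim (2*suc≰1 {length u ℕ.+ suc (length v)} m≥)
  dmF-fuel (suc n) (suc m) (a ∷ u) (b ∷ v) n≥ m≥ = ≡.cong₂ _++_ (≡.cong (prefix _) tails)
    (List.concatMap-cong (λ j → ≡.cong (λ P → Δ j (suc a) (suc b) • prefix (x (suc a ℕ.+ suc b ∸ j)) P) (≡.trans
      (linʳ-congAll (All.map (λ {bw} w≤ → shF-fuel n m (x j ∷ []) (proj₂ bw)
        (ℕ.≤-trans (ℕ.*-monoʳ-≤ 2 (ℕ.s≤s w≤)) n′) (ℕ.≤-trans (ℕ.*-monoʳ-≤ 2 (ℕ.s≤s w≤)) m′)) (shF-bounded n u v)))
      (≡.cong (linʳ (shF m (x j ∷ []))) tails))) (upTo (suc a ℕ.+ suc b)))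
    where
    n′ : 2 ℕ.* suc (length u ℕ.+ length v) ℕ.≤ n
    n′ = ≡.subst (λ z → 2 ℕ.* z ℕ.≤ n) (ℕ.+-suc (length u) (length v)) (2*-pred n≥)
    m′ : 2 ℕ.* suc (length u ℕ.+ length v) ℕ.≤ m
    m′ = ≡.subst (λ z → 2 ℕ.* z ℕ.≤ m) (ℕ.+-suc (length u) (length v)) (2*-pred m≥)
    tails : shF n u v ≡ shF m u v
    tails = shF-fuel n m u v (ℕ.≤-trans (ℕ.*-monoʳ-≤ 2 (ℕ.n≤1+n _)) n′) (ℕ.≤-trans (ℕ.*-monoʳ-≤ 2 (ℕ.n≤1+n _)) m′)

-- The recursions for ⧢ and ◇ under a functional

module Words {c ℓ : Level} (F : CommutativeRing c ℓ) (e : ℕ)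
             (fin : IsFiniteField F (suc (suc e))) where

  open RingTools F
  open FiniteField F e fin using (p; q)
  open WordAlgebra F q
  open Pairing F q
  open Fuel F q
  open import Data.Nat.Combinatorics using (_C_; nCn≡1; nCk≡nC[n∸k]; nCk+nC[k+1]≡[n+1]C[k+1]; k>n⇒nCk≡0)
  open LetterAssociativity F e fin using (d)

  fromℕ≈ : ∀ n → fromℕ n ≈ ⟦ + n ⟧ℤ
  fromℕ≈ zero    = refl
  fromℕ≈ (suc n) = trans (+-congˡ (fromℕ≈ n)) (sym (1+× n 1#))

  fromℤ≈ : ∀ i → fromℤ i ≈ ⟦ i ⟧ℤ
  fromℤ≈ (+ n)    = fromℕ≈ n
  fromℤ≈ -[1+ n ] = -‿cong (fromℕ≈ (suc n))

  nC0≡1 : ∀ n → n C 0 ≡ 1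
  nC0≡1 n = ≡.trans (nCk≡nC[n∸k] {0} {n} ℕ.z≤n) (nCn≡1 n)

  sgn-C : ∀ n k → ⟦ sgn k ℤ.* + (n C k) ⟧ℤ ≈ b n k
  sgn-C n       zero    = trans (reflexive (≡.cong (λ z → ⟦ + 1 ℤ.* + z ⟧ℤ) (nC0≡1 n))) (sym (b-n-0 n))
  sgn-C zero    (suc k) = trans (*-homoℤ (sgn (suc k)) (+ (0 C suc k)))
    (trans (*-congˡ (reflexive (≡.cong (λ z → ⟦ + z ⟧ℤ) (k>n⇒nCk≡0 {0} {suc k} ℕ.z<s)))) (zeroʳ _))
  sgn-C (suc n) (suc k) = begin
    ⟦ sgn (suc k) ℤ.* + (suc n C suc k) ⟧ℤ
      ≈⟨ *-homoℤ (sgn (suc k)) _ ⟩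
    ⟦ ℤ.- sgn k ⟧ℤ * ⟦ + (suc n C suc k) ⟧ℤ
      ≈⟨ *-cong (-‿homoℤ (sgn k)) (trans (reflexive (≡.cong (λ z → ⟦ + z ⟧ℤ) (≡.sym (nCk+nC[k+1]≡[n+1]C[k+1] n k))))
           (+-homoℤ (+ (n C k)) (+ (n C suc k)))) ⟩
    (- ⟦ sgn k ⟧ℤ) * (⟦ + (n C k) ⟧ℤ + ⟦ + (n C suc k) ⟧ℤ)
      ≈⟨ solve 3 (λ s x y → (:- s) :* (x :+ y) := (:- s) :* y :- s :* x) refl _ _ _ ⟩
    (- ⟦ sgn k ⟧ℤ) * ⟦ + (n C suc k) ⟧ℤ - ⟦ sgn k ⟧ℤ * ⟦ + (n C k) ⟧ℤ
      ≈⟨ +-cong (trans (*-homoℤ (sgn (suc k)) (+ (n C suc k))) (*-congʳ (-‿homoℤ (sgn k)))) (-‿cong (*-homoℤ (sgn k) (+ (n C k)))) ⟨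
    ⟦ sgn (suc k) ℤ.* + (n C suc k) ⟧ℤ - ⟦ sgn k ℤ.* + (n C k) ⟧ℤ
      ≈⟨ +-cong (sgn-C n (suc k)) (-‿cong (sgn-C n k)) ⟩
    b n (suc k) - b n k ∎

  -- The sum defining ◇ starts at j = 0, which is the weight of no letter. Without that term, weight
  -- k + 1 matches the letter k.
  Δ-zero : ∀ i j → Δ 0 i j ≈ 0#
  Δ-zero i j with (p ∣? 0) ×-dec ((0 ℕ.<? 0) ×-dec (0 ℕ.<? i ℕ.+ j))
  ... | yes (_ , () , _)
  ... | no  _ = refl

  Δ≈d : ∀ i j k → k ℕ.< suc (i ℕ.+ j) → Δ (suc k) (suc i) (suc j) ≈ d k i j
  Δ≈d i j k k< with (p ∣? suc k) ×-dec ((0 ℕ.<? suc k) ×-dec (suc k ℕ.<? suc i ℕ.+ suc j))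
  ... | yes (p∣k , _) = begin
    fromℤ (sgn i ℤ.* + (k C i) ℤ.+ sgn j ℤ.* + (k C j))  ≈⟨ fromℤ≈ (sgn i ℤ.* + (k C i) ℤ.+ sgn j ℤ.* + (k C j)) ⟩
    ⟦ sgn i ℤ.* + (k C i) ℤ.+ sgn j ℤ.* + (k C j) ⟧ℤ  ≈⟨ +-homoℤ (sgn i ℤ.* + (k C i)) (sgn j ℤ.* + (k C j)) ⟩
    ⟦ sgn i ℤ.* + (k C i) ⟧ℤ + ⟦ sgn j ℤ.* + (k C j) ⟧ℤ  ≈⟨ +-cong (sgn-C k i) (sgn-C k j) ⟩
    b k i + b k j  ≈⟨ *-identityˡ _ ⟨
    1# * (b k i + b k j)  ≈⟨ *-congʳ (χ-yes p∣k) ⟨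
    d k i j  ∎
  ... | no ¬all = sym (trans (*-congʳ (χ-no (λ p∣k → ¬all (p∣k , ℕ.z<s , ℕ.s<s (≡.subst (k ℕ.<_) (≡.sym (ℕ.+-suc i j)) k<))))) (zeroˡ _))

  S : (Word → Carrier) → Word → Word → Carrier
  S h u v = ⟪ h , u ⧢ʷ v ⟫

  -- Induction hypotheses hold only up to some length; the words of u ⧢ v do not exceed the total
  -- length of u and v.
  S-congBounded : ∀ {h h′ : Word → Carrier} u v → (∀ y → length y ℕ.≤ length u ℕ.+ length v → h y ≈ h′ y) → S h u v ≈ S h′ u v
  S-congBounded u v e = ⟪⟫-congAll (All.map (λ {ay} y≤ → e (proj₂ ay) y≤) (shF-bounded (fuel u v) u v))

  S-cong : ∀ {h h′ : Word → Carrier} → (∀ y → h y ≈ h′ y) → ∀ u v → S h u v ≈ S h′ u v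
  S-cong e u v = ⟪⟫-cong e (u ⧢ʷ v)

  S-identityˡ : ∀ h v → S h [] v ≈ h v
  S-identityˡ h v = ⟪⟫-word h v

  S-identityʳ : ∀ h u → S h u [] ≈ h u
  S-identityʳ h []      = ⟪⟫-word h []
  S-identityʳ h (a ∷ u) = ⟪⟫-word h (a ∷ u)

  infix 9 _at_
  _at_ : (Word → Carrier) → ℕ → Word → Carrier
  (h at i) y = h (i ∷ y)

  -- B h i j is the functional z ↦ h ((⟨i⟩ ◇ ⟨j⟩) ▷ z), where (l ∷ w) ▷ z = l ∷ (w ⧢ z).
  B : (Word → Carrier) → ℕ → ℕ → Word → Carrier
  B h i j z = h (suc (i ℕ.+ j) ∷ z) + ∑ (suc (i ℕ.+ j)) (λ k → d k i j * S (h at (i ℕ.+ j ∸ k)) (k ∷ []) z)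

  ⟪⟫-dmF : ∀ h N a u b v → 2 ℕ.* suc (length u ℕ.+ length v) ℕ.≤ N →
    ⟪ h , dmF (suc N) (a ∷ u) (b ∷ v) ⟫ ≈ S (B h a b) u v
  ⟪⟫-dmF h N a u b v N≥ = begin
    ⟪ h , dmF (suc N) (a ∷ u) (b ∷ v) ⟫
      ≈⟨ ⟪⟫-++ h (prefix (x AB) (shF N u v)) _ ⟩
    ⟪ h , prefix (x AB) (shF N u v) ⟫ + ⟪ h , concatMap term (upTo AB) ⟫
      ≈⟨ +-cong (⟪⟫-prefix h (x AB) (shF N u v)) (⟪⟫-applyUpTo h term (λ j → j) AB) ⟩
    ⟪ h at x AB , shF N u v ⟫ + ∑ AB (λ j → ⟪ h , term j ⟫)
      ≈⟨ +-cong (reflexive (≡.cong₂ (λ i P → ⟪ h at i , P ⟫) (ℕ.+-suc a b) tails)) sums ⟩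
    S (h at suc (a ℕ.+ b)) u v + ∑ (suc (a ℕ.+ b)) (λ k → ⟪ (λ z → d k a b * S (h at (a ℕ.+ b ∸ k)) (k ∷ []) z) , u ⧢ʷ v ⟫)
      ≈⟨ +-congˡ (⟪⟫-∑ (suc (a ℕ.+ b)) (λ k z → d k a b * S (h at (a ℕ.+ b ∸ k)) (k ∷ []) z) (u ⧢ʷ v)) ⟨
    S (h at suc (a ℕ.+ b)) u v + S (λ z → ∑ (suc (a ℕ.+ b)) (λ k → d k a b * S (h at (a ℕ.+ b ∸ k)) (k ∷ []) z)) u v
      ≈⟨ ⟪⟫-+ _ _ (u ⧢ʷ v) ⟨
    S (B h a b) u v ∎
    where
    AB = suc a ℕ.+ suc b

    inner term : ℕ → Poly
    inner j = linʳ (shF N (x j ∷ [])) (shF N u v)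
    term j = Δ j (suc a) (suc b) • prefix (x (AB ∸ j)) (inner j)

    tails : shF N u v ≡ u ⧢ʷ v
    tails = shF-fuel N (fuel u v) u v (ℕ.≤-trans (ℕ.*-monoʳ-≤ 2 (ℕ.n≤1+n _)) N≥) (ℕ.n≤1+n _)

    ⟪⟫-term : ∀ k → k ℕ.< suc (a ℕ.+ b) →
      ⟪ h , term (suc k) ⟫ ≈ ⟪ (λ z → d k a b * S (h at (a ℕ.+ b ∸ k)) (k ∷ []) z) , u ⧢ʷ v ⟫
    ⟪⟫-term k k< = begin
      ⟪ h , term (suc k) ⟫
        ≈⟨ trans (⟪⟫-• h (Δ (suc k) (suc a) (suc b)) (prefix (x (AB ∸ suc k)) (inner (suc k))))
             (*-cong (Δ≈d a b k k<) (⟪⟫-prefix h (x (AB ∸ suc k)) (inner (suc k)))) ⟩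
      d k a b * ⟪ h at x (AB ∸ suc k) , linʳ (shF N (k ∷ [])) (shF N u v) ⟫
        ≈⟨ *-congˡ (trans (reflexive (≡.cong (λ i → ⟪ h at i , linʳ (shF N (k ∷ [])) (shF N u v) ⟫) index))
             (⟪⟫-linʳ (h at (a ℕ.+ b ∸ k)) (shF N (k ∷ [])) (shF N u v))) ⟩
      d k a b * ⟪ (λ z → ⟪ h at (a ℕ.+ b ∸ k) , shF N (k ∷ []) z ⟫) , shF N u v ⟫
        ≈⟨ *-congˡ (⟪⟫-congAll (All.map (λ {bz} z≤ → reflexive (≡.cong ⟪ h at (a ℕ.+ b ∸ k) ,_⟫
             (shF-fuel N (fuel (k ∷ []) (proj₂ bz)) (k ∷ []) (proj₂ bz) (ℕ.≤-trans (ℕ.*-monoʳ-≤ 2 (ℕ.s≤s z≤)) N≥) (ℕ.n≤1+n _))))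
             (shF-bounded N u v))) ⟩
      d k a b * ⟪ (λ z → S (h at (a ℕ.+ b ∸ k)) (k ∷ []) z) , shF N u v ⟫
        ≈⟨ trans (*-congˡ (reflexive (≡.cong ⟪ (λ z → S (h at (a ℕ.+ b ∸ k)) (k ∷ []) z) ,_⟫ tails))) (sym (⟪⟫-*ˡ (d k a b) _ (u ⧢ʷ v))) ⟩
      ⟪ (λ z → d k a b * S (h at (a ℕ.+ b ∸ k)) (k ∷ []) z) , u ⧢ʷ v ⟫ ∎
      where
      index : x (AB ∸ suc k) ≡ a ℕ.+ b ∸ k
      index = ≡.trans (≡.cong (λ i → i ∸ k ∸ 1) (ℕ.+-suc a b)) (≡.cong (_∸ 1) (ℕ.+-∸-assoc 1 (ℕ.s≤s⁻¹ k<)))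

    sums : ∑ AB (λ j → ⟪ h , term j ⟫)
      ≈ ∑ (suc (a ℕ.+ b)) (λ k → ⟪ (λ z → d k a b * S (h at (a ℕ.+ b ∸ k)) (k ∷ []) z) , u ⧢ʷ v ⟫)
    sums = begin
      ∑ AB (λ j → ⟪ h , term j ⟫)
        ≈⟨ ∑-suc (a ℕ.+ suc b) (λ j → ⟪ h , term j ⟫) ⟩
      ⟪ h , term 0 ⟫ + ∑ (a ℕ.+ suc b) (λ k → ⟪ h , term (suc k) ⟫)
        ≈⟨ +-cong (trans (⟪⟫-• h (Δ 0 (suc a) (suc b)) (prefix (x AB) (inner 0))) (trans (*-congʳ (Δ-zero (suc a) (suc b))) (zeroˡ _)))
             (reflexive (≡.cong (λ n → ∑ n (λ k → ⟪ h , term (suc k) ⟫)) (ℕ.+-suc a b))) ⟩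
      0# + ∑ (suc (a ℕ.+ b)) (λ k → ⟪ h , term (suc k) ⟫)
        ≈⟨ trans (+-identityˡ _) (∑-cong (suc (a ℕ.+ b)) ⟪⟫-term) ⟩
      ∑ (suc (a ℕ.+ b)) (λ k → ⟪ (λ z → d k a b * S (h at (a ℕ.+ b ∸ k)) (k ∷ []) z) , u ⧢ʷ v ⟫) ∎

  D : (Word → Carrier) → Word → Word → Carrier
  D h u v = ⟪ h , u ◇ʷ v ⟫

  private
    2L≤ : ∀ (u v : Word) → 2 ℕ.* suc (length u ℕ.+ length v) ℕ.≤ 2 ℕ.* (suc (length u) ℕ.+ suc (length v))
    2L≤ u v = ℕ.*-monoʳ-≤ 2 (ℕ.s≤s (ℕ.+-monoʳ-≤ (length u) (ℕ.n≤1+n (length v))))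

  D-cons : ∀ h a u b v → D h (a ∷ u) (b ∷ v) ≈ S (B h a b) u v
  D-cons h a u b v = ⟪⟫-dmF h _ a u b v (2L≤ u v)

  S-cons : ∀ h a u b v →
    S h (a ∷ u) (b ∷ v) ≈ S (h at a) u (b ∷ v) + S (h at b) (a ∷ u) v + S (B h a b) u v
  S-cons h a u b v = begin
    S h (a ∷ u) (b ∷ v)
      ≈⟨ trans (⟪⟫-++ h (prefix a (shF N u (b ∷ v)) ++ prefix b (shF N (a ∷ u) v)) (dmF N (a ∷ u) (b ∷ v)))
           (+-congʳ (⟪⟫-++ h (prefix a (shF N u (b ∷ v))) (prefix b (shF N (a ∷ u) v)))) ⟩
    ⟪ h , prefix a (shF N u (b ∷ v)) ⟫ + ⟪ h , prefix b (shF N (a ∷ u) v) ⟫ + ⟪ h , dmF N (a ∷ u) (b ∷ v) ⟫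
      ≈⟨ +-cong (+-cong (⟪⟫-prefix h a (shF N u (b ∷ v))) (⟪⟫-prefix h b (shF N (a ∷ u) v))) (reflexive (≡.cong ⟪ h ,_⟫ dm)) ⟩
    ⟪ h at a , shF N u (b ∷ v) ⟫ + ⟪ h at b , shF N (a ∷ u) v ⟫ + D h (a ∷ u) (b ∷ v)
      ≈⟨ +-cong (+-cong (reflexive (≡.cong ⟪ h at a ,_⟫ sh₁)) (reflexive (≡.cong ⟪ h at b ,_⟫ sh₂))) (D-cons h a u b v) ⟩
    S (h at a) u (b ∷ v) + S (h at b) (a ∷ u) v + S (B h a b) u v ∎
    where
    N = 2 ℕ.* (suc (length u) ℕ.+ suc (length v))

    dm : dmF N (a ∷ u) (b ∷ v) ≡ (a ∷ u) ◇ʷ (b ∷ v)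
    dm = dmF-fuel N (suc N) (a ∷ u) (b ∷ v) (ℕ.n≤1+n N) (ℕ.m≤n⇒m≤1+n (ℕ.n≤1+n N))

    sh₁ : shF N u (b ∷ v) ≡ u ⧢ʷ (b ∷ v)
    sh₁ = shF-fuel N (fuel u (b ∷ v)) u (b ∷ v) (ℕ.*-monoʳ-≤ 2 (ℕ.n≤1+n _)) (ℕ.n≤1+n _)

    sh₂ : shF N (a ∷ u) v ≡ (a ∷ u) ⧢ʷ v
    sh₂ = shF-fuel N (fuel (a ∷ u) v) (a ∷ u) v (ℕ.*-monoʳ-≤ 2 (ℕ.+-monoʳ-≤ (suc (length u)) (ℕ.n≤1+n _))) (ℕ.n≤1+n _)

+-reverse : ∀ l m n → l ℕ.+ m ℕ.+ n ≡ n ℕ.+ m ℕ.+ l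
+-reverse l m n = ≡.trans (ℕ.+-comm (l ℕ.+ m) n) (≡.trans (≡.cong (n ℕ.+_) (ℕ.+-comm l m)) (≡.sym (ℕ.+-assoc n m l)))

-- Associativity by induction on the total length

module Associativity {c ℓ : Level} (F : CommutativeRing c ℓ) (e : ℕ)
                     (fin : IsFiniteField F (suc (suc e))) where

  open RingTools F
  open FiniteField F e fin using (q)
  open WordAlgebra F q using (Word; _⧢ʷ_; _◇ʷ_)
  open Pairing F q
  open LetterAssociativity F e fin using (d; d-comm; Θ; Θ-reverse)
  open Words F e fin

  S-+ : ∀ (g h : Word → Carrier) u v → S (λ y → g y + h y) u v ≈ S g u v + S h u v
  S-+ g h u v = ⟪⟫-+ g h (u ⧢ʷ v)

  S-+₃ : ∀ (f g h : Word → Carrier) u v → S (λ y → f y + g y + h y) u v ≈ S f u v + S g u v + S h u v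
  S-+₃ f g h u v = trans (S-+ (λ y → f y + g y) h u v) (+-congʳ (S-+ f g u v))

  S-∑ : ∀ n (x : ℕ → Carrier) (g : ℕ → Word → Carrier) u v →
    S (λ y → ∑ n (λ k → x k * g k y)) u v ≈ ∑ n (λ k → x k * S (g k) u v)
  S-∑ n x g u v = trans (⟪⟫-∑ n (λ k y → x k * g k y) (u ⧢ʷ v)) (∑-cong n (λ k _ → ⟪⟫-*ˡ (x k) (g k) (u ⧢ʷ v)))

  B-comm : ∀ h i j z → B h i j z ≈ B h j i z
  B-comm h i j z = trans
    (+-congˡ (∑-cong (suc (i ℕ.+ j)) (λ k _ → *-congʳ (d-comm k i j))))
    (reflexive (≡.cong (λ n → h (suc n ∷ z) + ∑ (suc n) (λ k → d k j i * S (h at (n ∸ k)) (k ∷ []) z)) (ℕ.+-comm i j)))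

  S-comm : ∀ h u v → S h u v ≈ S h v u
  S-comm h []      v       = trans (S-identityˡ h v) (sym (S-identityʳ h v))
  S-comm h (a ∷ u) []      = trans (S-identityʳ h (a ∷ u)) (sym (S-identityˡ h (a ∷ u)))
  S-comm h (a ∷ u) (b ∷ v) = begin
    S h (a ∷ u) (b ∷ v)
      ≈⟨ S-cons h a u b v ⟩
    S (h at a) u (b ∷ v) + S (h at b) (a ∷ u) v + S (B h a b) u v
      ≈⟨ +-cong (+-cong (S-comm (h at a) u (b ∷ v)) (S-comm (h at b) (a ∷ u) v))
                (trans (S-cong (B-comm h a b) u v) (S-comm (B h b a) u v)) ⟩
    S (h at a) (b ∷ v) u + S (h at b) v (a ∷ u) + S (B h b a) v u
      ≈⟨ +-congʳ (+-comm _ _) ⟩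
    S (h at b) v (a ∷ u) + S (h at a) (b ∷ v) u + S (B h b a) v u
      ≈⟨ S-cons h b v a u ⟨
    S h (b ∷ v) (a ∷ u) ∎

  -- `B h` is the case `h at_`. Products of three words also lead to families ψ that do not come
  -- from prefixing a letter.
  B′ : (ℕ → Word → Carrier) → ℕ → ℕ → Word → Carrier
  B′ ψ i j z = ψ (suc (i ℕ.+ j)) z + ∑ (suc (i ℕ.+ j)) (λ k → d k i j * S (ψ (i ℕ.+ j ∸ k)) (k ∷ []) z)

  B′-cong : ∀ {ψ ψ′ : ℕ → Word → Carrier} → (∀ i y → ψ i y ≈ ψ′ i y) → ∀ i j z → B′ ψ i j z ≈ B′ ψ′ i j z
  B′-cong e i j z = +-cong (e _ z) (∑-cong (suc (i ℕ.+ j)) (λ k _ → *-congˡ (S-cong (e (i ℕ.+ j ∸ k)) (k ∷ []) z)))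

  B′-+ : ∀ (ψ ψ′ : ℕ → Word → Carrier) i j z → B′ (λ i y → ψ i y + ψ′ i y) i j z ≈ B′ ψ i j z + B′ ψ′ i j z
  B′-+ ψ ψ′ i j z = trans
    (+-congˡ (trans (∑-cong (suc (i ℕ.+ j)) (λ k _ → trans
        (*-congˡ (S-+ (ψ (i ℕ.+ j ∸ k)) (ψ′ (i ℕ.+ j ∸ k)) (k ∷ []) z)) (distribˡ _ _ _)))
      (∑-+ (suc (i ℕ.+ j)) _ _)))
    (solve 4 (λ a b c d → a :+ b :+ (c :+ d) := a :+ c :+ (b :+ d)) refl _ _ _ _)

  B′-+₃ : ∀ (ψ ψ′ ψ″ : ℕ → Word → Carrier) i j z →
    B′ (λ i y → ψ i y + ψ′ i y + ψ″ i y) i j z ≈ B′ ψ i j z + B′ ψ′ i j z + B′ ψ″ i j z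
  B′-+₃ ψ ψ′ ψ″ i j z = trans (B′-+ (λ i y → ψ i y + ψ′ i y) ψ″ i j z) (+-congʳ (B′-+ ψ ψ′ i j z))

  S-B′ : ∀ ψ i j u v → S (B′ ψ i j) u v ≈
    S (ψ (suc (i ℕ.+ j))) u v + ∑ (suc (i ℕ.+ j)) (λ k → d k i j * S (λ z → S (ψ (i ℕ.+ j ∸ k)) (k ∷ []) z) u v)
  S-B′ ψ i j u v = trans (S-+ _ _ u v)
    (+-congˡ (S-∑ (suc (i ℕ.+ j)) (λ k → d k i j) (λ k z → S (ψ (i ℕ.+ j ∸ k)) (k ∷ []) z) u v))

  -- h applied to (u ⧢ v) ⧢ w.
  T : (Word → Carrier) → Word → Word → Word → Carrier
  T h u v w = S (λ y → S h y w) u v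

  T-cong : ∀ {h h′ : Word → Carrier} → (∀ y → h y ≈ h′ y) → ∀ u v w → T h u v w ≈ T h′ u v w
  T-cong e u v w = S-cong (λ y → S-cong e y w) u v

  -- The functional z ↦ h (((⟨i⟩ ◇ ⟨j⟩) ◇ ⟨m⟩) ▷ z), where a word ⟨n⟩⟨k⟩ of ⟨i⟩ ◇ ⟨j⟩ contributes
  -- (⟨n⟩ ◇ ⟨m⟩) ▷ (⟨k⟩ ⧢ z).
  Ω : (Word → Carrier) → ℕ → ℕ → ℕ → Word → Carrier
  Ω h i j m = B′ (λ n → B h n m) i j

  two-letters : ∀ φ l k → S φ (l ∷ []) (k ∷ []) ≈ φ (l ∷ k ∷ []) + φ (k ∷ l ∷ [])
    + (φ (suc (l ℕ.+ k) ∷ []) + ∑ (suc (l ℕ.+ k)) (λ r → d r l k * φ ((l ℕ.+ k ∸ r) ∷ r ∷ [])))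
  two-letters φ l k = trans (S-cons φ l [] k []) (+-cong
    (+-cong (S-identityˡ (φ at l) (k ∷ [])) (S-identityʳ (φ at k) (l ∷ [])))
    (trans (S-identityˡ (B φ l k) []) (+-congˡ (∑-cong (suc (l ℕ.+ k)) (λ r _ →
      *-congˡ (S-identityʳ (φ at (l ℕ.+ k ∸ r)) (r ∷ [])))))))

  -- Given commutativity, this is associativity up to total length N. In the reversed form the
  -- induction only permutes the terms of `T-cons`.
  Symmetric : ℕ → Set (c ⊔ ℓ)
  Symmetric N = ∀ h u v w → length u ℕ.+ length v ℕ.+ length w ℕ.≤ N → T h u v w ≈ T h w v u

  module _ {N : ℕ} (symmetric : Symmetric N) where

    S-assoc-≤ : ∀ h u v w → length u ℕ.+ length v ℕ.+ length w ℕ.≤ N →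
      S (λ y → S h y w) u v ≈ S (λ y → S h u y) v w
    S-assoc-≤ h u v w ≤N = begin
      T h u v w  ≈⟨ symmetric h u v w ≤N ⟩
      S (λ y → S h y u) w v  ≈⟨ S-cong (λ y → S-comm h y u) w v ⟩
      S (λ y → S h u y) w v  ≈⟨ S-comm (λ y → S h u y) w v ⟩
      S (λ y → S h u y) v w  ∎

    -- The rule (x ▷ z) ▷ w = x ▷ (z ⧢ w) for x = ⟨i⟩ ◇ ⟨j⟩, which rests on associativity for ⟨k⟩, z
    -- and w.
    B′-S : ∀ ψ i j z w → suc (length z) ℕ.+ length w ℕ.≤ N → B′ (λ i y → S (ψ i) y w) i j z ≈ S (B′ ψ i j) z w
    B′-S ψ i j z w ≤N = trans
      (+-congˡ (∑-cong (suc (i ℕ.+ j)) (λ k _ → *-congˡ (S-assoc-≤ (ψ (i ℕ.+ j ∸ k)) (k ∷ []) z w ≤N))))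
      (sym (S-B′ ψ i j z w))

    module _ (h : Word → Carrier) (y : Word) (y≤ : suc (suc (length y)) ℕ.≤ N) where

      -- The functional x ↦ h (x ▷ y). Its value at the empty word is a placeholder: `Θ` evaluates
      -- nonempty words only.
      Γ : Word → Carrier
      Γ []      = 0#
      Γ (i ∷ z) = S (h at i) z y

      -- `Ω` contains ⟨l⟩ ⧢ (⟨k⟩ ⧢ y) where `Θ` contains (⟨l⟩ ⧢ ⟨k⟩) ⧢ y; both have total length
      -- within N.
      Ω≈Θ : ∀ i j m → Ω h i j m y ≈ Θ Γ i j m
      Ω≈Θ i j m = +-cong
        (+-congʳ (sym (S-identityˡ (h at suc (suc (i ℕ.+ j) ℕ.+ m)) y)))
        (∑-cong (suc (i ℕ.+ j)) (λ k _ → *-congˡ (trans (S-B′ (h at_) (i ℕ.+ j ∸ k) m (k ∷ []) y)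
          (+-congˡ (∑-cong (suc ((i ℕ.+ j ∸ k) ℕ.+ m)) (λ l _ → *-congˡ (trans
            (sym (S-assoc-≤ (h at ((i ℕ.+ j ∸ k) ℕ.+ m ∸ l)) (l ∷ []) (k ∷ []) y y≤))
            (two-letters (λ z → S (h at ((i ℕ.+ j ∸ k) ℕ.+ m ∸ l)) z y) l k))))))))

      Ω-reverse : ∀ i j m → Ω h i j m y ≈ Ω h m j i y
      Ω-reverse i j m = trans (Ω≈Θ i j m) (trans (Θ-reverse Γ i j m) (sym (Ω≈Θ m j i)))

    module _ (a b c : ℕ) (u v w : Word)
             (bound : length u ℕ.+ suc (length v) ℕ.+ suc (length w) ℕ.≤ N) where
      private
        l = length u
        m = length v
        n = length w

        bound₂ : suc (suc (l ℕ.+ m ℕ.+ n)) ℕ.≤ N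
        bound₂ = ≡.subst (ℕ._≤ N) (≡.trans (≡.cong (ℕ._+ suc n) (ℕ.+-suc l m)) (≡.cong suc (ℕ.+-suc (l ℕ.+ m) n))) bound

        bound-z : ∀ (z : Word) → length z ℕ.≤ l ℕ.+ m → suc (length z) ℕ.+ suc n ℕ.≤ N
        bound-z z z≤ = ℕ.≤-trans (ℕ.s≤s (ℕ.+-monoˡ-≤ (suc n) z≤))
          (ℕ.≤-trans (ℕ.≤-reflexive (≡.cong suc (ℕ.+-suc (l ℕ.+ m) n))) bound₂)

      S-Ω : ∀ h → S (B′ (λ i y → S (B h i c) y w) a b) u v ≈ T (Ω h a b c) u v w
      S-Ω h = S-congBounded u v (λ z z≤ → B′-S (λ i → B h i c) a b z w
        (ℕ.≤-trans (ℕ.+-monoʳ-≤ (suc (length z)) (ℕ.n≤1+n n)) (bound-z z z≤)))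

      -- There is one term for each nonempty set of letters among a, b, c that enters the leading
      -- product. The reversal permutes these sets.
      T-cons : ∀ h → T h (a ∷ u) (b ∷ v) (c ∷ w) ≈
        T (h at a) u (b ∷ v) (c ∷ w) + T (h at b) (a ∷ u) v (c ∷ w) + T (h at c) (a ∷ u) (b ∷ v) w
        + (T (B h a c) u (b ∷ v) w + T (B h b c) (a ∷ u) v w + T (B h a b) u v (c ∷ w)) + T (Ω h a b c) u v w
      T-cons h = begin
        S φ (a ∷ u) (b ∷ v)
          ≈⟨ S-cons φ a u b v ⟩
        S (φ at a) u (b ∷ v) + S (φ at b) (a ∷ u) v + S (B φ a b) u v
          ≈⟨ +-cong (+-cong
               (trans (S-cong (φ-cons a) u (b ∷ v)) (S-+₃ (λ y → S (h at a) y (c ∷ w)) (χ′ at a) (λ y → S (B h a c) y w) u (b ∷ v)))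
               (trans (S-cong (φ-cons b) (a ∷ u) v) (S-+₃ (λ y → S (h at b) y (c ∷ w)) (χ′ at b) (λ y → S (B h b c) y w) (a ∷ u) v)))
               last ⟩
        T (h at a) u (b ∷ v) (c ∷ w) + S (χ′ at a) u (b ∷ v) + T (B h a c) u (b ∷ v) w
          + (T (h at b) (a ∷ u) v (c ∷ w) + S (χ′ at b) (a ∷ u) v + T (B h b c) (a ∷ u) v w)
          + (T (B h a b) u v (c ∷ w) + S (B χ′ a b) u v + T (Ω h a b c) u v w)
          ≈⟨ solve 9 (λ x₁ x₂ x₃ y₁ y₂ y₃ z₁ z₂ z₃ → x₁ :+ x₂ :+ x₃ :+ (y₁ :+ y₂ :+ y₃) :+ (z₁ :+ z₂ :+ z₃)
               := x₁ :+ y₁ :+ (x₂ :+ y₂ :+ z₂) :+ (x₃ :+ y₃ :+ z₁) :+ z₃) refl _ _ _ _ _ _ _ _ _ ⟩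
        T (h at a) u (b ∷ v) (c ∷ w) + T (h at b) (a ∷ u) v (c ∷ w)
          + (S (χ′ at a) u (b ∷ v) + S (χ′ at b) (a ∷ u) v + S (B χ′ a b) u v)
          + (T (B h a c) u (b ∷ v) w + T (B h b c) (a ∷ u) v w + T (B h a b) u v (c ∷ w)) + T (Ω h a b c) u v w
          -- The three pieces with χ′ are those in which c alone leads; they form the recursion for
          -- (a ∷ u) ⧢ (b ∷ v) under χ′.
          ≈⟨ +-congʳ (+-congʳ (+-congˡ (S-cons χ′ a u b v))) ⟨
        T (h at a) u (b ∷ v) (c ∷ w) + T (h at b) (a ∷ u) v (c ∷ w) + T (h at c) (a ∷ u) (b ∷ v) w
          + (T (B h a c) u (b ∷ v) w + T (B h b c) (a ∷ u) v w + T (B h a b) u v (c ∷ w)) + T (Ω h a b c) u v w ∎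
        where
        φ χ′ : Word → Carrier
        φ y = S h y (c ∷ w)
        χ′ y = S (h at c) y w

        φ-cons : ∀ i y → φ (i ∷ y) ≈ S (h at i) y (c ∷ w) + χ′ (i ∷ y) + S (B h i c) y w
        φ-cons i y = S-cons h i y c w

        last : S (B φ a b) u v ≈ T (B h a b) u v (c ∷ w) + S (B χ′ a b) u v + T (Ω h a b c) u v w
        last = begin
          S (B φ a b) u v
            ≈⟨ S-cong (λ z → trans (B′-cong φ-cons a b z)
                 (B′-+₃ (λ i y → S (h at i) y (c ∷ w)) (λ i y → χ′ (i ∷ y)) (λ i y → S (B h i c) y w) a b z)) u v ⟩
          S (λ z → B′ (λ i y → S (h at i) y (c ∷ w)) a b z + B χ′ a b z + B′ (λ i y → S (B h i c) y w) a b z) u v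
            ≈⟨ S-+₃ (B′ (λ i y → S (h at i) y (c ∷ w)) a b) (B χ′ a b) (B′ (λ i y → S (B h i c) y w) a b) u v ⟩
          S (B′ (λ i y → S (h at i) y (c ∷ w)) a b) u v + S (B χ′ a b) u v + S (B′ (λ i y → S (B h i c) y w) a b) u v
            ≈⟨ +-cong (+-congʳ (S-congBounded u v (λ z z≤ → B′-S (h at_) a b z (c ∷ w) (bound-z z z≤)))) (S-Ω h) ⟩
          T (B h a b) u v (c ∷ w) + S (B χ′ a b) u v + T (Ω h a b c) u v w ∎

      -- Two separate reversals: that of the tails by hypothesis, for a fixed functional, and that
      -- of the letters inside the functional by `Ω-reverse`.
      T-Ω-reverse : ∀ h → T (Ω h a b c) u v w ≈ T (Ω h c b a) w v u
      T-Ω-reverse h = trans (symmetric (Ω h a b c) u v w (ℕ.≤-trans (ℕ.m≤n⇒m≤1+n (ℕ.n≤1+n _)) bound₂))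
        (S-congBounded w v (λ y y≤ → S-congBounded y u (λ z z≤ → Ω-reverse h z
          (ℕ.≤-trans (ℕ.s≤s (ℕ.s≤s (ℕ.≤-trans z≤ (ℕ.≤-trans (ℕ.+-monoˡ-≤ l y≤) (ℕ.≤-reflexive (+-reverse n m l)))))) bound₂) a b c)))

  -- If one word is empty, this is commutativity. Otherwise each term of `T-cons` has lost at least
  -- one letter to the functional, and the hypothesis for N reverses it.
  T-symmetric : ∀ N → Symmetric N
  T-symmetric N h [] v w _ = trans (S-identityˡ (λ y → S h y w) v) (trans (S-comm h v w)
    (S-cong-at-nil h w v))
    where
    S-cong-at-nil : ∀ h w v → S h w v ≈ T h w v []
    S-cong-at-nil h w v = S-cong (λ y → sym (S-identityʳ h y)) w v
  T-symmetric N h (a ∷ u) [] w _ = trans (S-identityʳ (λ y → S h y w) (a ∷ u)) (trans (S-comm h (a ∷ u) w)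
    (sym (S-identityʳ (λ y → S h y (a ∷ u)) w)))
  T-symmetric N h (a ∷ u) (b ∷ v) [] _ = trans (S-cong (λ y → S-identityʳ h y) (a ∷ u) (b ∷ v))
    (trans (S-comm h (a ∷ u) (b ∷ v)) (sym (S-identityˡ (λ y → S h y (a ∷ u)) (b ∷ v))))
  T-symmetric (suc N) h (a ∷ u) (b ∷ v) (c ∷ w) (ℕ.s≤s bound) = begin
    T h (a ∷ u) (b ∷ v) (c ∷ w)
      ≈⟨ T-cons (T-symmetric N) a b c u v w bound h ⟩
    T (h at a) u (b ∷ v) (c ∷ w) + T (h at b) (a ∷ u) v (c ∷ w) + T (h at c) (a ∷ u) (b ∷ v) w
      + (T (B h a c) u (b ∷ v) w + T (B h b c) (a ∷ u) v w + T (B h a b) u v (c ∷ w)) + T (Ω h a b c) u v w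
      ≈⟨ +-cong (+-cong (+-cong (+-cong
           (rec (h at a) u (b ∷ v) (c ∷ w) bound)
           (rec (h at b) (a ∷ u) v (c ∷ w) bound-b))
           (rec (h at c) (a ∷ u) (b ∷ v) w bound-c))
           (+-cong (+-cong
             (trans (rec (B h a c) u (b ∷ v) w (smaller (ℕ.+-monoʳ-≤ (l ℕ.+ suc m) (ℕ.n≤1+n n)) bound)) (T-cong (B-comm h a c) w (b ∷ v) u))
             (trans (rec (B h b c) (a ∷ u) v w (smaller (ℕ.+-monoʳ-≤ (suc l ℕ.+ m) (ℕ.n≤1+n n)) bound-b)) (T-cong (B-comm h b c) w v (a ∷ u))))
             (trans (rec (B h a b) u v (c ∷ w) (smaller (ℕ.+-monoˡ-≤ (suc n) (ℕ.n≤1+n (l ℕ.+ m))) bound-b)) (T-cong (B-comm h a b) (c ∷ w) v u))))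
           (T-Ω-reverse (T-symmetric N) a b c u v w bound h) ⟩
    T (h at a) (c ∷ w) (b ∷ v) u + T (h at b) (c ∷ w) v (a ∷ u) + T (h at c) w (b ∷ v) (a ∷ u)
      + (T (B h c a) w (b ∷ v) u + T (B h c b) w v (a ∷ u) + T (B h b a) (c ∷ w) v u) + T (Ω h c b a) w v u
      ≈⟨ solve 7 (λ x y z p q r s → x :+ y :+ z :+ (p :+ q :+ r) :+ s := z :+ y :+ x :+ (p :+ r :+ q) :+ s) refl _ _ _ _ _ _ _ ⟩
    T (h at c) w (b ∷ v) (a ∷ u) + T (h at b) (c ∷ w) v (a ∷ u) + T (h at a) (c ∷ w) (b ∷ v) u
      + (T (B h c a) w (b ∷ v) u + T (B h b a) (c ∷ w) v u + T (B h c b) w v (a ∷ u)) + T (Ω h c b a) w v u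
      ≈⟨ T-cons (T-symmetric N) c b a w v u (≡.subst (ℕ._≤ N) reversed bound) h ⟨
    T h (c ∷ w) (b ∷ v) (a ∷ u) ∎
    where
    rec = T-symmetric N
    l = length u
    m = length v
    n = length w
    reversed : l ℕ.+ suc m ℕ.+ suc n ≡ n ℕ.+ suc m ℕ.+ suc l
    reversed = ≡.trans (ℕ.+-suc (l ℕ.+ suc m) n)
      (≡.trans (≡.cong suc (+-reverse l (suc m) n)) (≡.sym (ℕ.+-suc (n ℕ.+ suc m) l)))
    smaller : ∀ {i j} → i ℕ.≤ j → j ℕ.≤ N → i ℕ.≤ N
    smaller = ℕ.≤-trans
    bound-b : suc l ℕ.+ m ℕ.+ suc n ℕ.≤ N
    bound-b = ≡.subst (ℕ._≤ N) (≡.cong (ℕ._+ suc n) (ℕ.+-suc l m)) bound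
    bound-c : suc l ℕ.+ suc m ℕ.+ n ℕ.≤ N
    bound-c = ≡.subst (ℕ._≤ N) (ℕ.+-suc (l ℕ.+ suc m) n) bound

  S-assoc : ∀ h u v w → S (λ y → S h y w) u v ≈ S (λ y → S h u y) v w
  S-assoc h u v w = S-assoc-≤ (T-symmetric _) h u v w ℕ.≤-refl

  D-identityˡ : ∀ h v → D h [] v ≈ h v
  D-identityˡ h v = ⟪⟫-word h v

  D-identityʳ : ∀ h u → D h u [] ≈ h u
  D-identityʳ h []      = ⟪⟫-word h []
  D-identityʳ h (a ∷ u) = ⟪⟫-word h (a ∷ u)

  D-cong : ∀ {h h′ : Word → Carrier} → (∀ y → h y ≈ h′ y) → ∀ u v → D h u v ≈ D h′ u v
  D-cong e u v = ⟪⟫-cong e (u ◇ʷ v)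

  D-comm : ∀ h u v → D h u v ≈ D h v u
  D-comm h []      v       = trans (D-identityˡ h v) (sym (D-identityʳ h v))
  D-comm h (a ∷ u) []      = trans (D-identityʳ h (a ∷ u)) (sym (D-identityˡ h (a ∷ u)))
  D-comm h (a ∷ u) (b ∷ v) = begin
    D h (a ∷ u) (b ∷ v)  ≈⟨ D-cons h a u b v ⟩
    S (B h a b) u v  ≈⟨ trans (S-cong (B-comm h a b) u v) (S-comm (B h b a) u v) ⟩
    S (B h b a) v u  ≈⟨ D-cons h b v a u ⟨
    D h (b ∷ v) (a ∷ u)  ∎

  -- Unfolding ◇ twice leaves the product of the three first letters and a shuffle of the tails,
  -- both already known to be reversible.
  D-reverse : ∀ h u v w → D (λ y → D h y w) u v ≈ D (λ y → D h y u) w v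
  D-reverse h [] v w = trans (D-identityˡ (λ y → D h y w) v) (trans (D-comm h v w)
    (D-cong (λ y → sym (D-identityʳ h y)) w v))
  D-reverse h (a ∷ u) [] w = trans (D-identityʳ (λ y → D h y w) (a ∷ u)) (trans (D-comm h (a ∷ u) w)
    (sym (D-identityʳ (λ y → D h y (a ∷ u)) w)))
  D-reverse h (a ∷ u) (b ∷ v) [] = trans (D-cong (λ y → D-identityʳ h y) (a ∷ u) (b ∷ v))
    (trans (D-comm h (a ∷ u) (b ∷ v)) (sym (D-identityˡ (λ y → D h y (a ∷ u)) (b ∷ v))))
  D-reverse h (a ∷ u) (b ∷ v) (c ∷ w) = begin
    D (λ y → D h y (c ∷ w)) (a ∷ u) (b ∷ v)  ≈⟨ expand a b c u v w ⟩
    T (Ω h a b c) u v w  ≈⟨ T-Ω-reverse (T-symmetric _) a b c u v w ℕ.≤-refl h ⟩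
    T (Ω h c b a) w v u  ≈⟨ expand c b a w v u ⟨
    D (λ y → D h y (a ∷ u)) (c ∷ w) (b ∷ v)  ∎
    where
    expand : ∀ a b c u v w → D (λ y → D h y (c ∷ w)) (a ∷ u) (b ∷ v) ≈ T (Ω h a b c) u v w
    expand a b c u v w = begin
      D (λ y → D h y (c ∷ w)) (a ∷ u) (b ∷ v)  ≈⟨ D-cons (λ y → D h y (c ∷ w)) a u b v ⟩
      S (B (λ y → D h y (c ∷ w)) a b) u v  ≈⟨ S-cong (B′-cong (λ i y → D-cons h i y c w) a b) u v ⟩
      S (B′ (λ i y → S (B h i c) y w) a b) u v  ≈⟨ S-Ω (T-symmetric _) a b c u v w ℕ.≤-refl h ⟩
      T (Ω h a b c) u v w  ∎

  D-assoc : ∀ h u v w → D (λ y → D h y w) u v ≈ D (λ y → D h u y) v w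
  D-assoc h u v w = begin
    D (λ y → D h y w) u v  ≈⟨ D-reverse h u v w ⟩
    D (λ y → D h y u) w v  ≈⟨ D-cong (λ y → D-comm h y u) w v ⟩
    D (λ y → D h u y) w v  ≈⟨ D-comm (λ y → D h u y) w v ⟩
    D (λ y → D h u y) v w  ∎

theorem6p9 : {c ℓ : Level} (q : ℕ) (F : CommutativeRing c ℓ) → IsFiniteField F q →
    WordAlgebra.IsCommutativeAlgebra F q (WordAlgebra._◇_ F q)
    × WordAlgebra.IsCommutativeAlgebra F q (WordAlgebra._⧢_ F q)
-- For q = 0 the ring would have no element, and for q = 1 it would satisfy 1 = 0; so q has the form
-- e + 2.
theorem6p9 zero F fin with () ← IsFiniteField.toFin fin (CommutativeRing.0# F)
theorem6p9 (suc zero) F fin = ⊥-elim (IsFiniteField.1≉0 fin (F.trans (F.sym (from-to F.1#))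
    (F.trans (F.reflexive (≡.cong fromFin (unique (toFin F.1#) (toFin F.0#)))) (from-to F.0#))))
  where
  module F = CommutativeRing F
  open IsFiniteField fin
  unique : (i j : Fin 1) → i ≡ j
  unique Fin.zero Fin.zero = ≡.refl
theorem6p9 (suc (suc e)) F fin =
    isCommutativeAlgebra _◇ʷ_ D-identityˡ D-comm D-assoc
  , isCommutativeAlgebra _⧢ʷ_ S-identityˡ S-comm S-assoc
  where
  open WordAlgebra F (suc (suc e)) using (_◇ʷ_; _⧢ʷ_)
  open Pairing F (suc (suc e)) using (isCommutativeAlgebra)
  open Words F e fin using (S-identityˡ)
  open Associativity F e fin
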